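{- For $1\le i\le k$ define $D_i$ on left $\mathcal A_\hbar[x_1,\dots,x_n]$-linear combinations of the elements $\overline T_\nu$ ($\nu\subseteq(n-k)^k$) by $D_i(g\,\overline T_\mu)=g\,D_i(\overline T_\mu)$ for $g\in\mathcal A_\hbar[x_1,\dots,x_n]$ and $$D_i(\overline T_\mu)=x_{\mu_i+k+1-i}\,\overline T_\mu+\sum_\lambda\bigl(\hbar-(p-q)x_{\mathtt h(\mu/\lambda)}\bigr)p^{\operatorname{ht}(\mu/\lambda)-1}q^{\operatorname{wd}(\mu/\lambda)-1}\,\overline T_\lambda,$$ the sum over $\lambda\subseteq(n-k)^k$ such that $\mu/\lambda$ is a ribbon with head in row $i$. Then for $\mu\subseteq(n-k)^k$ and $0\le r\le k$, in $\widehat H_n$, $$\overline T_\mu\,e_r(x_1,\dots,x_k)=\sum_{1\le i_1<\cdots<i_r\le k}D_{i_1}\bigl(D_{i_2}(\cdots D_{i_r}(\overline T_\mu)\cdots)\bigr).$$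
   Context: $\mathcal A_\hbar=\mathbb Q[p,q,\hbar]$; $\widehat H_n$ is generated by $T_1,\dots,T_{n-1},x_1,\dots,x_n$ with $(T_i+p)(T_i-q)=0$, braid relations, $x_ix_j=x_jx_i$, $T_ix_j=x_jT_i$ ($j\ne i,i+1$), $T_ix_i=x_{i+1}T_i+(\hbar-(p-q)x_i)$, $T_ix_{i+1}=x_iT_i-(\hbar-(p-q)x_i)$. $\overline T_i=T_i+p-q$, $\overline T_w$ via reduced words. For $\nu\subseteq(n-k)^k$, $w_\nu$ is the permutation with $w_\nu(k+1-i)=\nu_i+k+1-i$ ($1\le i\le k$), increasing on $\{k+1,\dots,n\}$. $[m]=(p^m-q^m)/(p-q)$, $[m]!=\prod_{j\le m}[j]$, $d=\binom k2+\binom{n-k}2$, $\Sigma^n_k=\frac1{[k]![n-k]!}\sum_{v\in S_k\times S_{n-k}}q^{d-\ell(v)}\overline T_v$ (scalars extended to invert $[k]![n-k]!$), $\overline T_\nu=\overline T_{w_\nu}\Sigma^n_k$. Ribbon: nonempty connected skew shape $\mu/\lambda$ with no $2\times2$ square; head = top-right box; $\operatorname{ht},\operatorname{wd}$ = numbers of rows, columns; head in row $i$ gives $\mathtt h(\mu/\lambda)=\mu_i+k+1-i$. -}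

module Defs where

open import Algebra.Bundles using (CommutativeRing; Ring)
import Algebra.Properties.Ring
import Algebra.Properties.Semiring.Exp
open import Data.Empty using (⊥)
open import Data.Fin.Base as Fin using (Fin; zero; suc; toℕ; fromℕ<; inject₁; inject≤; opposite; punchIn)
open import Data.Fin.Permutation using (Permutation′; _⟨$⟩ʳ_; _∘ₚ_; transpose; insert; remove; insert-remove; lift₀-transpose; punchIn-permute) renaming (id to idₚ; _≈_ to _≈ₚ_)
import Data.Fin.Properties as Fin
open import Data.List.Base using (List; []; _∷_; [_]; _++_; map; foldr; concatMap; cartesianProductWith; allFin; filter; length)
open import Data.List.Membership.Propositional using (_∈_)
open import Data.List.Membership.Propositional.Properties using (∈-allFin; ∈-cartesianProductWith⁺)
open import Data.List.Properties using (length-++; length-map)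
open import Data.List.Relation.Unary.All as All using (All; []; _∷_)
open import Data.List.Relation.Unary.AllPairs using ([]; _∷_)
open import Data.List.Relation.Unary.Any using (here; there)
open import Data.List.Relation.Unary.Unique.Propositional using (Unique)
import Data.List.Relation.Unary.Unique.Propositional.Properties as Unique
import Data.List.Relation.Unary.Unique.Setoid as UniqueS
import Data.List.Relation.Unary.Unique.Setoid.Properties as UniqueS
open import Data.Nat.Base as ℕ using (ℕ; zero; suc; pred; _≤_; _<_; z≤n; s≤s; _∸_; ∣_-_∣)
open import Data.Nat.Combinatorics using (_C_)
import Data.Nat.Properties as ℕ
open import Data.Product.Base using (∃; ∃-syntax; _×_; _,_; proj₁; proj₂)
open import Data.Rational.Properties using () renaming (+-*-commutativeRing to ℚ-ring)
open import Data.Sum.Base using (_⊎_; inj₁; inj₂)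
open import Data.Unit.Base using (⊤; tt)
open import Data.Vec.Base using (Vec; lookup) renaming ([] to []ᵥ; _∷_ to _∷ᵥ_)
open import Data.Vec.Properties using (∷-injective)
open import Data.Vec.Relation.Unary.Linked as Linked using (Linked; linked?)
open import Data.Vec.Relation.Unary.Linked.Properties using () renaming (lookup⁺ to linked-lookup)
open import Function.Base using (_∘_)
open import Level using (0ℓ)
open import Relation.Binary.Bundles using (Setoid)
open import Relation.Binary.Construct.Closure.ReflexiveTransitive using (Star; ε; _◅_; _◅◅_)
open import Relation.Binary.Core using (Rel)
open import Relation.Binary.PropositionalEquality using (_≡_; _≢_; refl; sym; trans; cong; cong₂; subst; subst₂; setoid; module ≡-Reasoning)
open import Relation.Nullary using (¬_; Dec; yes; no; contradiction)
open import Relation.Nullary.Decidable using (map′; _×-dec_; _→-dec_; _⊎-dec_; ¬?; does)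
open import Relation.Unary using (Pred; Decidable)

infixl 6 _⊕_
infixl 7 _⊗_
infix  8 ⊖_

data Expr (K G : Set) : Set where
  con     : K → Expr K G
  gen     : G → Expr K G
  _⊕_ _⊗_ : Expr K G → Expr K G → Expr K G
  ⊖_      : Expr K G → Expr K G

module Presented (K : CommutativeRing 0ℓ 0ℓ) (G : Set) (_∼_ : Rel (Expr (CommutativeRing.Carrier K) G) 0ℓ) where
  private module K = CommutativeRing K

  infix 4 _≋_

  -- The least congruence that contains _∼_ and makes the expressions an
  -- associative unital K-algebra.
  data _≋_ : Rel (Expr K.Carrier G) 0ℓ where
    rel         : ∀ {a b} → a ∼ b → a ≋ b
    ≋-refl      : ∀ {a} → a ≋ a
    ≋-sym       : ∀ {a b} → a ≋ b → b ≋ a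
    ≋-trans     : ∀ {a b c} → a ≋ b → b ≋ c → a ≋ c
    ⊕-cong      : ∀ {a b c d} → a ≋ b → c ≋ d → a ⊕ c ≋ b ⊕ d
    ⊗-cong      : ∀ {a b c d} → a ≋ b → c ≋ d → a ⊗ c ≋ b ⊗ d
    ⊖-cong      : ∀ {a b} → a ≋ b → ⊖ a ≋ ⊖ b
    ⊕-assoc     : ∀ a b c → (a ⊕ b) ⊕ c ≋ a ⊕ (b ⊕ c)
    ⊕-comm      : ∀ a b → a ⊕ b ≋ b ⊕ a
    ⊕-identityˡ : ∀ a → con K.0# ⊕ a ≋ a
    ⊖-inverseˡ  : ∀ a → ⊖ a ⊕ a ≋ con K.0#
    ⊗-assoc     : ∀ a b c → (a ⊗ b) ⊗ c ≋ a ⊗ (b ⊗ c)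
    ⊗-identityˡ : ∀ a → con K.1# ⊗ a ≋ a
    ⊗-distribˡ  : ∀ a b c → a ⊗ (b ⊕ c) ≋ a ⊗ b ⊕ a ⊗ c
    ⊗-distribʳ  : ∀ a b c → (b ⊕ c) ⊗ a ≋ b ⊗ a ⊕ c ⊗ a
    con-cong    : ∀ {x y} → x K.≈ y → con x ≋ con y
    con-+       : ∀ x y → con (x K.+ y) ≋ con x ⊕ con y
    con-*       : ∀ x y → con (x K.* y) ≋ con x ⊗ con y
    con-central : ∀ x a → con x ⊗ a ≋ a ⊗ con x

  ring : Ring 0ℓ 0ℓ
  ring = record
    { Carrier = Expr K.Carrier G
    ; _≈_ = _≋_ ; _+_ = _⊕_ ; _*_ = _⊗_ ; -_ = ⊖_ ; 0# = con K.0# ; 1# = con K.1#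
    ; isRing = record
      { +-isAbelianGroup = record
        { isGroup = record
          { isMonoid = record
            { isSemigroup = record
              { isMagma = record
                { isEquivalence = record { refl = ≋-refl ; sym = ≋-sym ; trans = ≋-trans }
                ; ∙-cong = ⊕-cong
                }
              ; assoc = ⊕-assoc
              }
            ; identity = ⊕-identityˡ , λ a → ≋-trans (⊕-comm a _) (⊕-identityˡ a)
            }
          ; inverse = ⊖-inverseˡ , λ a → ≋-trans (⊕-comm a _) (⊖-inverseˡ a)
          ; ⁻¹-cong = ⊖-cong
          }
        ; comm = ⊕-comm
        }
      ; *-cong = ⊗-cong
      ; *-assoc = ⊗-assoc
      ; *-identity = ⊗-identityˡ , λ a → ≋-trans (≋-sym (con-central _ a)) (⊗-identityˡ a)
      ; distrib = ⊗-distribˡ , ⊗-distribʳ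
      }
    }

data Commutative {K G : Set} (_∼_ : Rel (Expr K G) 0ℓ) : Rel (Expr K G) 0ℓ where
  given : ∀ {a b} → a ∼ b → Commutative _∼_ a b
  comm  : ∀ a b → Commutative _∼_ (a ⊗ b) (b ⊗ a)

module PresentedCommutative (K : CommutativeRing 0ℓ 0ℓ) (G : Set) (_∼_ : Rel (Expr (CommutativeRing.Carrier K) G) 0ℓ) where
  private module P = Presented K G (Commutative _∼_)

  commutativeRing : CommutativeRing 0ℓ 0ℓ
  commutativeRing = record
    { isCommutativeRing = record
      { isRing = Ring.isRing P.ring
      ; *-comm = λ a b → P.rel (comm a b)
      }
    }

-- The polynomial ring K[G].
Polynomials : CommutativeRing 0ℓ 0ℓ → Set → CommutativeRing 0ℓ 0ℓ
Polynomials K G = PresentedCommutative.commutativeRing K G (λ _ _ → ⊥)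

data Invert {K : Set} (f one : K) : Rel (Expr K ⊤) 0ℓ where
  f⁻¹*f≈1 : Invert f one (gen tt ⊗ con f) (con one)

-- The localization K[f⁻¹], with gen tt as f⁻¹.
Localization : (K : CommutativeRing 0ℓ 0ℓ) → CommutativeRing.Carrier K → CommutativeRing 0ℓ 0ℓ
Localization K f = PresentedCommutative.commutativeRing K ⊤ (Invert f (CommutativeRing.1# K))

module BigOperators (R : Ring 0ℓ 0ℓ) where
  open Ring R

  sum product : List Carrier → Carrier
  sum     = foldr _+_ 0#
  product = foldr _*_ 1#

-- The r-element sublists of a list; those of allFin k are the sequences
-- i₁ < ⋯ < iᵣ in Fin k.
sublists : {A : Set} → ℕ → List A → List (List A)
sublists zero    _        = [ [] ]
sublists (suc r) []       = []
sublists (suc r) (x ∷ xs) = map (x ∷_) (sublists r xs) ++ sublists (suc r) xs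

module QuantumIntegers (K : CommutativeRing 0ℓ 0ℓ) (p q : CommutativeRing.Carrier K) where
  open CommutativeRing K renaming (refl to ≈-refl; sym to ≈-sym; trans to ≈-trans)
  open Algebra.Properties.Semiring.Exp semiring using (_^_)
  open Algebra.Properties.Ring ring using (-‿distribˡ-*; -‿distribʳ-*)
  open import Relation.Binary.Reasoning.Setoid (CommutativeRing.setoid K)

  -- ⟨ m ⟩ is [m] = (p^m - q^m)/(p - q), with the division carried out:
  -- p^{m-1} + p^{m-2}q + ⋯ + q^{m-1}.  The lemma quotient determines it in
  -- the domain ℚ[p,q,ħ].
  ⟨_⟩ : ℕ → Carrier
  ⟨ zero  ⟩ = 0#
  ⟨ suc m ⟩ = p ^ m + q * ⟨ m ⟩

  ⟨_⟩! : ℕ → Carrier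
  ⟨ zero  ⟩! = 1#
  ⟨ suc m ⟩! = ⟨ suc m ⟩ * ⟨ m ⟩!

  quotient : ∀ m → (p - q) * ⟨ m ⟩ ≈ p ^ m - q ^ m
  quotient zero    = ≈-trans (zeroʳ _) (≈-sym (-‿inverseʳ 1#))
  quotient (suc m) = begin
    (p - q) * (P + q * M)                    ≈⟨ distribˡ _ _ _ ⟩
    (p - q) * P + (p - q) * (q * M)          ≈⟨ +-cong (distribʳ _ _ _) second ⟩
    (p * P + - q * P) + (q * P - q * Q)      ≈⟨ +-assoc _ _ _ ⟩
    p * P + (- q * P + (q * P - q * Q))      ≈⟨ +-congˡ (+-assoc _ _ _) ⟨
    p * P + ((- q * P + q * P) - q * Q)      ≈⟨ +-congˡ (+-congʳ cancel) ⟩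
    p * P + (0# - q * Q)                     ≈⟨ +-congˡ (+-identityˡ _) ⟩
    p * P - q * Q                            ∎
    where
    P = p ^ m
    Q = q ^ m
    M = ⟨ m ⟩
    cancel : - q * P + q * P ≈ 0#
    cancel = ≈-trans (≈-sym (distribʳ _ _ _)) (≈-trans (*-congʳ (-‿inverseˡ q)) (zeroˡ P))
    second : (p - q) * (q * M) ≈ q * P - q * Q
    second = begin
      (p - q) * (q * M)   ≈⟨ *-assoc _ _ _ ⟨
      ((p - q) * q) * M   ≈⟨ *-congʳ (*-comm _ _) ⟩
      (q * (p - q)) * M   ≈⟨ *-assoc _ _ _ ⟩
      q * ((p - q) * M)   ≈⟨ *-congˡ (quotient m) ⟩
      q * (P - Q)         ≈⟨ distribˡ _ _ _ ⟩
      q * P + q * - Q     ≈⟨ +-congˡ (-‿distribʳ-* q Q) ⟨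
      q * P - q * Q       ∎

-- All indices are shifted to start at 0: the
-- generators of S_n are indexed by Fin (pred n), and the i-th one swaps
-- lo i = i and hi i = i + 1.

lo hi : ∀ {n} → Fin (pred n) → Fin n
lo {suc n} i = inject₁ i
hi {suc n} i = suc i

simple : ∀ {n} → Fin (pred n) → Permutation′ n
simple i = transpose (lo i) (hi i)

-- ⟪ i₁ ∷ ⋯ ∷ iₗ ∷ [] ⟫ = s_{i₁}⋯s_{iₗ}, composed as functions (_∘ₚ_ is
-- diagrammatic composition).
⟪_⟫ : ∀ {n} → List (Fin (pred n)) → Permutation′ n
⟪ []     ⟫ = idₚ
⟪ i ∷ is ⟫ = ⟪ is ⟫ ∘ₚ simple i

IsReducedWord : ∀ {n} → Permutation′ n → List (Fin (pred n)) → Set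
IsReducedWord w is = ⟪ is ⟫ ≈ₚ w × (∀ js → ⟪ js ⟫ ≈ₚ w → length is ≤ length js)

-- j ∸ 1 , … , 1 , 0
descending : ∀ {m} → Fin (suc m) → List (Fin m)
descending         zero    = []
descending {suc m} (suc j) = map suc (descending j) ++ [ zero ]

-- Writing w = s_{j-1}⋯s₁s₀·w′ with j = w(0) and w′ fixing 0, and
-- recursing on w′.
word : ∀ {n} → Permutation′ n → List (Fin (pred n))
word {zero}        w = []
word {suc zero}    w = []
word {suc (suc n)} w = descending (w ⟨$⟩ʳ zero) ++ map suc (word (remove zero w))

swap : ∀ {m} → Fin m → Fin (suc m) → Fin (suc m)
swap zero    zero          = suc zero
swap zero    (suc zero)    = zero
swap zero    (suc (suc x)) = suc (suc x)
swap (suc i) zero          = zero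
swap (suc i) (suc x)       = suc (swap i x)

simple-swap : ∀ {m} (i : Fin m) (x : Fin (suc m)) → simple i ⟨$⟩ʳ x ≡ swap i x
simple-swap zero    zero          = refl
simple-swap zero    (suc zero)    = refl
simple-swap zero    (suc (suc x)) = refl
simple-swap (suc i) zero          = refl
simple-swap (suc i) (suc x)       =
  trans (lift₀-transpose (inject₁ i) (suc i) (suc x)) (cong suc (simple-swap i x))

⟪++⟫ : ∀ {n} (is js : List (Fin (pred n))) (x : Fin n) → ⟪ is ++ js ⟫ ⟨$⟩ʳ x ≡ ⟪ is ⟫ ⟨$⟩ʳ (⟪ js ⟫ ⟨$⟩ʳ x)
⟪++⟫ []       js x = refl
⟪++⟫ (i ∷ is) js x = cong (simple i ⟨$⟩ʳ_) (⟪++⟫ is js x)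

⟪suc⟫-zero : ∀ {m} (is : List (Fin m)) → ⟪ map suc is ⟫ ⟨$⟩ʳ zero ≡ zero {suc m}
⟪suc⟫-zero []       = refl
⟪suc⟫-zero (i ∷ is) = cong (simple (suc i) ⟨$⟩ʳ_) (⟪suc⟫-zero is)

⟪suc⟫-suc : ∀ {m} (is : List (Fin m)) (x : Fin (suc m)) → ⟪ map suc is ⟫ ⟨$⟩ʳ suc x ≡ suc (⟪ is ⟫ ⟨$⟩ʳ x)
⟪suc⟫-suc []       x = refl
⟪suc⟫-suc (i ∷ is) x = begin
  simple (suc i) ⟨$⟩ʳ (⟪ map suc is ⟫ ⟨$⟩ʳ suc x)  ≡⟨ cong (simple (suc i) ⟨$⟩ʳ_) (⟪suc⟫-suc is x) ⟩
  simple (suc i) ⟨$⟩ʳ suc (⟪ is ⟫ ⟨$⟩ʳ x)          ≡⟨ lift₀-transpose (inject₁ i) (suc i) (suc (⟪ is ⟫ ⟨$⟩ʳ x)) ⟩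
  suc (simple i ⟨$⟩ʳ (⟪ is ⟫ ⟨$⟩ʳ x))              ∎
  where open ≡-Reasoning

⟪descending⟫-zero : ∀ {m} (j : Fin (suc m)) → ⟪ descending j ⟫ ⟨$⟩ʳ zero ≡ j
⟪descending⟫-zero         zero    = refl
⟪descending⟫-zero {suc m} (suc j) = begin
  ⟪ map suc (descending j) ++ [ zero ] ⟫ ⟨$⟩ʳ zero  ≡⟨ ⟪++⟫ {suc (suc m)} (map suc (descending j)) [ zero ] zero ⟩
  ⟪ map suc (descending j) ⟫ ⟨$⟩ʳ suc zero          ≡⟨ ⟪suc⟫-suc (descending j) zero ⟩
  suc (⟪ descending j ⟫ ⟨$⟩ʳ zero)                  ≡⟨ cong suc (⟪descending⟫-zero j) ⟩
  suc j                                             ∎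
  where open ≡-Reasoning

⟪descending⟫-suc : ∀ {m} (j : Fin (suc m)) (x : Fin m) → ⟪ descending j ⟫ ⟨$⟩ʳ suc x ≡ punchIn j x
⟪descending⟫-suc         zero    x       = refl
⟪descending⟫-suc {suc m} (suc j) zero    = begin
  ⟪ map suc (descending j) ++ [ zero ] ⟫ ⟨$⟩ʳ suc zero  ≡⟨ ⟪++⟫ {suc (suc m)} (map suc (descending j)) [ zero ] (suc zero) ⟩
  ⟪ map suc (descending j) ⟫ ⟨$⟩ʳ zero                  ≡⟨ ⟪suc⟫-zero (descending j) ⟩
  zero                                                  ∎
  where open ≡-Reasoning
⟪descending⟫-suc {suc m} (suc j) (suc x) = begin
  ⟪ map suc (descending j) ++ [ zero ] ⟫ ⟨$⟩ʳ suc (suc x)  ≡⟨ ⟪++⟫ {suc (suc m)} (map suc (descending j)) [ zero ] (suc (suc x)) ⟩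
  ⟪ map suc (descending j) ⟫ ⟨$⟩ʳ suc (suc x)              ≡⟨ ⟪suc⟫-suc (descending j) (suc x) ⟩
  suc (⟪ descending j ⟫ ⟨$⟩ʳ suc x)                        ≡⟨ cong suc (⟪descending⟫-suc j x) ⟩
  suc (punchIn j x)                                        ∎
  where open ≡-Reasoning

⟪word⟫ : ∀ {n} (w : Permutation′ n) → ⟪ word w ⟫ ≈ₚ w
⟪word⟫ {suc zero}    w zero with zero ← w ⟨$⟩ʳ zero = refl
⟪word⟫ {suc (suc n)} w x = trans (⟪++⟫ {suc (suc n)} (descending (w ⟨$⟩ʳ zero)) (map suc w′) x) (lemma x)
  where
  w′ = word (remove zero w)
  open ≡-Reasoning
  lemma : ∀ x → ⟪ descending (w ⟨$⟩ʳ zero) ⟫ ⟨$⟩ʳ (⟪ map suc w′ ⟫ ⟨$⟩ʳ x) ≡ w ⟨$⟩ʳ x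
  lemma zero = begin
    ⟪ descending (w ⟨$⟩ʳ zero) ⟫ ⟨$⟩ʳ (⟪ map suc w′ ⟫ ⟨$⟩ʳ zero)  ≡⟨ cong (⟪ descending (w ⟨$⟩ʳ zero) ⟫ ⟨$⟩ʳ_) (⟪suc⟫-zero w′) ⟩
    ⟪ descending (w ⟨$⟩ʳ zero) ⟫ ⟨$⟩ʳ zero                        ≡⟨ ⟪descending⟫-zero (w ⟨$⟩ʳ zero) ⟩
    w ⟨$⟩ʳ zero                                                   ∎
  lemma (suc x) = begin
    ⟪ descending (w ⟨$⟩ʳ zero) ⟫ ⟨$⟩ʳ (⟪ map suc w′ ⟫ ⟨$⟩ʳ suc x)  ≡⟨ cong (⟪ descending (w ⟨$⟩ʳ zero) ⟫ ⟨$⟩ʳ_) (⟪suc⟫-suc w′ x) ⟩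
    ⟪ descending (w ⟨$⟩ʳ zero) ⟫ ⟨$⟩ʳ suc (⟪ w′ ⟫ ⟨$⟩ʳ x)          ≡⟨ ⟪descending⟫-suc (w ⟨$⟩ʳ zero) (⟪ w′ ⟫ ⟨$⟩ʳ x) ⟩
    punchIn (w ⟨$⟩ʳ zero) (⟪ w′ ⟫ ⟨$⟩ʳ x)                          ≡⟨ cong (punchIn (w ⟨$⟩ʳ zero)) (⟪word⟫ (remove zero w) x) ⟩
    punchIn (w ⟨$⟩ʳ zero) (remove zero w ⟨$⟩ʳ x)                   ≡⟨ punchIn-permute w zero x ⟨
    w ⟨$⟩ʳ suc x                                                   ∎

remove-unique : ∀ {n} (π : Permutation′ (suc n)) (ρ : Permutation′ n) →
                (∀ x → π ⟨$⟩ʳ suc x ≡ punchIn (π ⟨$⟩ʳ zero) (ρ ⟨$⟩ʳ x)) → remove zero π ≈ₚ ρ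
remove-unique π ρ h x =
  Fin.punchIn-injective (π ⟨$⟩ʳ zero) _ _ (trans (sym (punchIn-permute π zero x)) (h x))

word-cong : ∀ {n} {π ρ : Permutation′ n} → π ≈ₚ ρ → word π ≡ word ρ
word-cong {zero}        π≈ρ = refl
word-cong {suc zero}    π≈ρ = refl
word-cong {suc (suc n)} {π} {ρ} π≈ρ = cong₂ _++_ (cong descending (π≈ρ zero))
  (cong (map suc) (word-cong (remove-unique π (remove zero ρ) λ x →
    trans (π≈ρ (suc x)) (trans (punchIn-permute ρ zero x)
      (cong (λ j → punchIn j (remove zero ρ ⟨$⟩ʳ x)) (sym (π≈ρ zero)))))))

length-descending : ∀ {m} (j : Fin (suc m)) → length (descending j) ≡ toℕ j
length-descending         zero    = refl
length-descending {suc m} (suc j) = begin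
  length (map suc (descending j) ++ [ zero ])  ≡⟨ length-++ (map suc (descending j)) ⟩
  length (map suc (descending j)) ℕ.+ 1        ≡⟨ cong (ℕ._+ 1) (length-map suc (descending j)) ⟩
  length (descending j) ℕ.+ 1                  ≡⟨ cong (ℕ._+ 1) (length-descending j) ⟩
  toℕ j ℕ.+ 1                                  ≡⟨ ℕ.+-comm (toℕ j) 1 ⟩
  suc (toℕ j)                                  ∎
  where open ≡-Reasoning

length-word : ∀ {n} (w : Permutation′ (suc (suc n))) →
              length (word w) ≡ toℕ (w ⟨$⟩ʳ zero) ℕ.+ length (word (remove zero w))
length-word w = trans (length-++ (descending (w ⟨$⟩ʳ zero)))
  (cong₂ ℕ._+_ (length-descending (w ⟨$⟩ʳ zero)) (length-map suc (word (remove zero w))))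

swap-punchIn : ∀ {m} (i : Fin (suc m)) (j : Fin (suc (suc m))) →
  (swap i j ≡ j × ∃[ i′ ] (∀ x → swap i (punchIn j x) ≡ punchIn j (swap {m} i′ x)))
  ⊎ (toℕ (swap i j) ≤ suc (toℕ j) × ∀ x → swap i (punchIn j x) ≡ punchIn (swap i j) x)
swap-punchIn zero zero       = inj₂ (ℕ.≤-refl , λ { zero → refl ; (suc x) → refl })
swap-punchIn zero (suc zero) = inj₂ (z≤n , λ { zero → refl ; (suc x) → refl })
swap-punchIn {suc m} zero (suc (suc j)) =
  inj₁ (refl , zero , λ { zero → refl ; (suc zero) → refl ; (suc (suc x)) → refl })
swap-punchIn {suc m} (suc i) zero    = inj₁ (refl , i , λ x → refl)
swap-punchIn {suc m} (suc i) (suc j) with swap-punchIn i j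
... | inj₁ (fix , i′ , h) = inj₁ (cong suc fix , suc i′ , λ { zero → refl ; (suc x) → cong suc (h x) })
... | inj₂ (le , h)       = inj₂ (s≤s le , λ { zero → refl ; (suc x) → cong suc (h x) })

word-step : ∀ {n} (i : Fin (pred n)) (w : Permutation′ n) → length (word (w ∘ₚ simple i)) ≤ suc (length (word w))
word-step {suc (suc n)} i w = subst₂ (λ a b → a ≤ suc b) (sym (length-word σ)) (sym (length-word w))
    (cases (λ i′ → word-step {suc n} i′ (remove zero w)) (swap-punchIn i j))
  where
  open ℕ.≤-Reasoning
  σ = w ∘ₚ simple i
  j = w ⟨$⟩ʳ zero
  w′ = remove zero w
  σ0 : σ ⟨$⟩ʳ zero ≡ swap i j
  σ0 = simple-swap i j
  σsuc : ∀ x → σ ⟨$⟩ʳ suc x ≡ swap i (punchIn j (w′ ⟨$⟩ʳ x))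
  σsuc x = trans (simple-swap i (w ⟨$⟩ʳ suc x)) (cong (swap i) (punchIn-permute w zero x))
  cases : (∀ i′ → length (word (w′ ∘ₚ simple i′)) ≤ suc (length (word w′))) →
          _ → toℕ (σ ⟨$⟩ʳ zero) ℕ.+ length (word (remove zero σ)) ≤ suc (toℕ j ℕ.+ length (word w′))
  cases ih (inj₁ (fix , i′ , h)) = begin
    toℕ (σ ⟨$⟩ʳ zero) ℕ.+ length (word (remove zero σ))
      ≡⟨ cong₂ ℕ._+_ (cong toℕ σ0j) (cong length (word-cong (remove-unique σ (w′ ∘ₚ simple i′) eq))) ⟩
    toℕ j ℕ.+ length (word (w′ ∘ₚ simple i′))  ≤⟨ ℕ.+-monoʳ-≤ (toℕ j) (ih i′) ⟩
    toℕ j ℕ.+ suc (length (word w′))           ≡⟨ ℕ.+-suc (toℕ j) _ ⟩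
    suc (toℕ j ℕ.+ length (word w′))           ∎
    where
    σ0j = trans σ0 fix
    eq : ∀ x → σ ⟨$⟩ʳ suc x ≡ punchIn (σ ⟨$⟩ʳ zero) (simple i′ ⟨$⟩ʳ (w′ ⟨$⟩ʳ x))
    eq x = trans (σsuc x) (trans (h (w′ ⟨$⟩ʳ x)) (cong₂ punchIn (sym σ0j) (sym (simple-swap i′ (w′ ⟨$⟩ʳ x)))))
  cases ih (inj₂ (le , h)) = begin
    toℕ (σ ⟨$⟩ʳ zero) ℕ.+ length (word (remove zero σ))
      ≡⟨ cong₂ ℕ._+_ (cong toℕ σ0) (cong length (word-cong (remove-unique σ w′ eq))) ⟩
    toℕ (swap i j) ℕ.+ length (word w′)  ≤⟨ ℕ.+-monoˡ-≤ _ le ⟩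
    suc (toℕ j ℕ.+ length (word w′))     ∎
    where
    eq : ∀ x → σ ⟨$⟩ʳ suc x ≡ punchIn (σ ⟨$⟩ʳ zero) (w′ ⟨$⟩ʳ x)
    eq x = trans (σsuc x) (trans (h (w′ ⟨$⟩ʳ x)) (cong (λ a → punchIn a (w′ ⟨$⟩ʳ x)) (sym σ0)))

length-word-id : ∀ n → length (word (idₚ {n})) ≡ 0
length-word-id zero          = refl
length-word-id (suc zero)    = refl
length-word-id (suc (suc n)) = trans (length-word (idₚ {suc (suc n)}))
  (trans (cong length (word-cong (remove-unique (idₚ {suc (suc n)}) idₚ λ x → refl))) (length-word-id (suc n)))

length-word-≤ : ∀ {n} (js : List (Fin (pred n))) → length (word {n} ⟪ js ⟫) ≤ length js
length-word-≤ {n} []       = ℕ.≤-reflexive (length-word-id n)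
length-word-≤ {n} (j ∷ js) = ℕ.≤-trans (word-step {n} j ⟪ js ⟫) (s≤s (length-word-≤ {n} js))

reducedWord : ∀ {n} (w : Permutation′ n) → ∃ (IsReducedWord w)
reducedWord {n} w = word w , ⟪word⟫ w , λ js ⟪js⟫≈w →
  subst (λ is → length is ≤ length js) (word-cong {n} {⟪ js ⟫} {w} ⟪js⟫≈w) (length-word-≤ {n} js)

ℓ : ∀ {n} → Permutation′ n → ℕ
ℓ w = length (proj₁ (reducedWord w))

permutations : ∀ n → List (Permutation′ n)
permutations zero    = [ idₚ ]
permutations (suc n) = cartesianProductWith (insert zero) (allFin (suc n)) (permutations n)

permutationSetoid : ℕ → Setoid 0ℓ 0ℓ
permutationSetoid n = record
  { Carrier = Permutation′ n
  ; _≈_ = _≈ₚ_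
  ; isEquivalence = record
    { refl = λ _ → refl ; sym = λ e i → sym (e i) ; trans = λ e f i → trans (e i) (f i) }
  }

insert-cong : ∀ {n} j {π ρ : Permutation′ n} → π ≈ₚ ρ → insert zero j π ≈ₚ insert zero j ρ
insert-cong j π≈ρ zero    = refl
insert-cong j π≈ρ (suc i) = cong (punchIn j) (π≈ρ i)

permutations-complete : ∀ {n} (π : Permutation′ n) → ∃[ ρ ] (ρ ∈ permutations n × ρ ≈ₚ π)
permutations-complete {zero}  π = idₚ , here refl , λ ()
permutations-complete {suc n} π with permutations-complete (remove zero π)
... | ρ , ρ∈ , ρ≈ = insert zero j ρ , ∈-cartesianProductWith⁺ (insert zero) (∈-allFin j) ρ∈ ,
    λ x → trans (insert-cong j {ρ} {remove zero π} ρ≈ x) (insert-remove zero π x)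
  where j = π ⟨$⟩ʳ zero

permutations-unique : ∀ n → UniqueS.Unique (permutationSetoid n) (permutations n)
permutations-unique zero    = [] ∷ []
permutations-unique (suc n) = UniqueS.cartesianProductWith⁺ (setoid (Fin (suc n))) (permutationSetoid n)
  (permutationSetoid (suc n)) (insert zero)
  (λ {w} {x} {π} {ρ} e → e zero , λ i → Fin.punchIn-injective x _ _
    (trans (cong (λ a → punchIn a (π ⟨$⟩ʳ i)) (sym (e zero))) (e (suc i))))
  (Unique.allFin⁺ (suc n)) (permutations-unique n)

-- Young k v says that v lies in S_k × S_{n-k}.
Young : ∀ {n} → ℕ → Permutation′ n → Set
Young k v = ∀ i → (toℕ i < k → toℕ (v ⟨$⟩ʳ i) < k) × (toℕ (v ⟨$⟩ʳ i) < k → toℕ i < k)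

young? : ∀ {n} k → Decidable (Young {n} k)
young? k v = Fin.all? λ i →
  (toℕ i ℕ.<? k →-dec toℕ (v ⟨$⟩ʳ i) ℕ.<? k) ×-dec (toℕ (v ⟨$⟩ʳ i) ℕ.<? k →-dec toℕ i ℕ.<? k)

youngSubgroup : ∀ n k → List (Permutation′ n)
youngSubgroup n k = filter (young? k) (permutations n)

-- The partitions with at most k parts, all at most m.
Partition : ℕ → ℕ → Set
Partition k m = ∃ λ (ν : Vec (Fin (suc m)) k) → Linked Fin._≥_ ν

part : ∀ {k m} → Partition k m → Fin k → Fin (suc m)
part ν i = lookup (proj₁ ν) i

vectors : {A : Set} → List A → ∀ k → List (Vec A k)
vectors xs zero    = [ []ᵥ ]
vectors xs (suc k) = cartesianProductWith _∷ᵥ_ xs (vectors xs k)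

select : {A : Set} {P : Pred A 0ℓ} → Decidable P → List A → List (∃ P)
select P? []       = []
select P? (x ∷ xs) with P? x
... | yes px = (x , px) ∷ select P? xs
... | no  _  = select P? xs

partitions : ∀ k m → List (Partition k m)
partitions k m = select (linked? (λ i j → j Fin.≤? i)) (vectors (allFin (suc m)) k)

vectors-complete : ∀ {A : Set} {xs : List A} → (∀ x → x ∈ xs) → ∀ {k} (v : Vec A k) → v ∈ vectors xs k
vectors-complete all []ᵥ      = here refl
vectors-complete all (x ∷ᵥ v) = ∈-cartesianProductWith⁺ _∷ᵥ_ (all x) (vectors-complete all v)

vectors-unique : ∀ {A : Set} {xs : List A} → Unique xs → ∀ k → Unique (vectors xs k)
vectors-unique xs! zero    = [] ∷ []
vectors-unique xs! (suc k) = Unique.cartesianProductWith⁺ _∷ᵥ_ ∷-injective xs! (vectors-unique xs! k)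

select-complete : ∀ {A : Set} {P : Pred A 0ℓ} (P? : Decidable P) → (∀ {x} (a b : P x) → a ≡ b) →
                  ∀ {x xs} (px : P x) → x ∈ xs → (x , px) ∈ select P? xs
select-complete P? irr {xs = y ∷ _} px x∈ with P? y | x∈
... | yes py | here refl = here (cong (_ ,_) (irr px py))
... | yes _  | there x∈′ = there (select-complete P? irr px x∈′)
... | no ¬py | here refl = contradiction px ¬py
... | no _   | there x∈′ = select-complete P? irr px x∈′

select-unique : ∀ {A : Set} {P : Pred A 0ℓ} (P? : Decidable P) {xs} → Unique xs → Unique (select P? xs)
select-unique P? {[]}     []         = []
select-unique P? {x ∷ xs} (x∉ ∷ xs!) with P? x
... | yes px = fresh x∉ ∷ select-unique P? xs!
  where
  fresh : ∀ {ys} → All (x ≢_) ys → All ((x , px) ≢_) (select P? ys)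
  fresh {[]}     []         = []
  fresh {y ∷ ys} (x≢y ∷ as) with P? y
  ... | yes _ = (λ { refl → x≢y refl }) ∷ fresh as
  ... | no  _ = fresh as
... | no  _  = select-unique P? xs!

partitions-complete : ∀ {k m} (ν : Partition k m) → ν ∈ partitions k m
partitions-complete (v , dec) = select-complete _ (Linked.irrelevant ℕ.≤-irrelevant) dec (vectors-complete ∈-allFin v)

partitions-unique : ∀ k m → Unique (partitions k m)
partitions-unique k m = select-unique _ (vectors-unique (Unique.allFin⁺ (suc m)) k)

part-antitone : ∀ {k m} (ν : Partition k m) {i j} → i Fin.≤ j → part ν j Fin.≤ part ν i
part-antitone (v , dec) {i} {j} i≤j with toℕ i ℕ.≟ toℕ j
... | no  i≢j = linked-lookup (λ a≥b b≥c → ℕ.≤-trans b≥c a≥b) dec (ℕ.≤∧≢⇒< i≤j i≢j)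
... | yes i≡j rewrite Fin.toℕ-injective i≡j = ℕ.≤-refl

-- With indices from 0, the row i and the position k - 1 - i = opposite i
-- stand for the row i + 1 and the position k + 1 - (i + 1).
IsGrassmannian : ∀ {n k} → k ≤ n → Partition k (n ∸ k) → Permutation′ n → Set
IsGrassmannian {n} {k} k≤n ν w =
  (∀ i → toℕ (w ⟨$⟩ʳ inject≤ (opposite i) k≤n) ≡ toℕ (part ν i) ℕ.+ toℕ (opposite i)) ×
  (∀ a b → k ≤ toℕ a → a Fin.< b → w ⟨$⟩ʳ a Fin.< w ⟨$⟩ʳ b)

fromCode : ∀ {n k} → k ≤ n → (Fin k → Fin (suc (n ∸ k))) → Permutation′ n
fromCode         {k = zero}  k≤n       c = idₚ
fromCode {suc n} {k = suc k} (s≤s k≤n) c =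
  insert zero (inject≤ (c zero) (s≤s (ℕ.m∸n≤m n k))) (fromCode k≤n (c ∘ suc))

toℕ-punchIn : ∀ {n} (j : Fin (suc n)) (x : Fin n) → toℕ j ≤ toℕ x → toℕ (punchIn j x) ≡ suc (toℕ x)
toℕ-punchIn zero    x       j≤x       = refl
toℕ-punchIn (suc j) (suc x) (s≤s j≤x) = cong suc (toℕ-punchIn j x j≤x)

punchIn-mono-< : ∀ {n} (j : Fin (suc n)) {x y : Fin n} → x Fin.< y → punchIn j x Fin.< punchIn j y
punchIn-mono-< zero                    x<y       = s≤s x<y
punchIn-mono-< (suc j) {zero}  {suc y} x<y       = s≤s z≤n
punchIn-mono-< (suc j) {suc x} {suc y} (s≤s x<y) = s≤s (punchIn-mono-< j x<y)

fromCode-value : ∀ {n k} (k≤n : k ≤ n) (c : Fin k → Fin (suc (n ∸ k))) → (∀ {s t} → s Fin.≤ t → c s Fin.≤ c t) →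
                 ∀ t → toℕ (fromCode k≤n c ⟨$⟩ʳ inject≤ t k≤n) ≡ toℕ (c t) ℕ.+ toℕ t
fromCode-value {suc n} {suc k} (s≤s k≤n) c mono zero    =
  trans (Fin.toℕ-inject≤ (c zero) _) (sym (ℕ.+-identityʳ _))
fromCode-value {suc n} {suc k} (s≤s k≤n) c mono (suc t) = begin
  toℕ (punchIn j y)              ≡⟨ toℕ-punchIn j y j≤y ⟩
  suc (toℕ y)                    ≡⟨ cong suc rec ⟩
  suc (toℕ (c (suc t)) ℕ.+ toℕ t)  ≡⟨ ℕ.+-suc _ _ ⟨
  toℕ (c (suc t)) ℕ.+ suc (toℕ t)  ∎
  where
  open ≡-Reasoning
  j = inject≤ (c zero) (s≤s (ℕ.m∸n≤m n k))
  y = fromCode k≤n (c ∘ suc) ⟨$⟩ʳ inject≤ t k≤n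
  rec : toℕ y ≡ toℕ (c (suc t)) ℕ.+ toℕ t
  rec = fromCode-value k≤n (c ∘ suc) (λ s≤t → mono (s≤s s≤t)) t
  j≤y : toℕ j ≤ toℕ y
  j≤y = subst₂ _≤_ (sym (Fin.toℕ-inject≤ (c zero) _)) (sym rec)
    (ℕ.≤-trans (mono {zero} {suc t} z≤n) (ℕ.m≤m+n _ _))

fromCode-increasing : ∀ {n k} (k≤n : k ≤ n) (c : Fin k → Fin (suc (n ∸ k))) → ∀ a b → k ≤ toℕ a → a Fin.< b →
                      fromCode k≤n c ⟨$⟩ʳ a Fin.< fromCode k≤n c ⟨$⟩ʳ b
fromCode-increasing {k = zero}  k≤n       c a       b       k≤a       a<b       = a<b
fromCode-increasing {suc n} {suc k} (s≤s k≤n) c (suc a) (suc b) (s≤s k≤a) (s≤s a<b) =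
  punchIn-mono-< _ (fromCode-increasing k≤n (c ∘ suc) a b k≤a a<b)

opposite-antitone : ∀ {k} {s t : Fin k} → s Fin.≤ t → opposite t Fin.≤ opposite s
opposite-antitone {k} {s} {t} s≤t = subst₂ _≤_ (sym (Fin.opposite-prop t)) (sym (Fin.opposite-prop s))
  (ℕ.∸-monoʳ-≤ k (s≤s s≤t))

grassmannian : ∀ {n k} (k≤n : k ≤ n) (ν : Partition k (n ∸ k)) → ∃ (IsGrassmannian k≤n ν)
grassmannian k≤n ν = fromCode k≤n c , value , fromCode-increasing k≤n c
  where
  c = part ν ∘ opposite
  value : ∀ i → toℕ (fromCode k≤n c ⟨$⟩ʳ inject≤ (opposite i) k≤n) ≡ toℕ (part ν i) ℕ.+ toℕ (opposite i)
  value i = trans (fromCode-value k≤n c (part-antitone ν ∘ opposite-antitone) (opposite i))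
    (cong (λ j → toℕ (part ν j) ℕ.+ toℕ (opposite i)) (Fin.opposite-involutive i))

module Reachability {A : Set} (_⟶_ : Rel A 0ℓ) (_⟶?_ : ∀ a b → Dec (a ⟶ b)) (_≟_ : ∀ (a b : A) → Dec (a ≡ b)) where

  -- There is a path whose intermediate points lie in the list.
  Via : List A → A → A → Set
  Via []       a b = a ≡ b ⊎ a ⟶ b
  Via (v ∷ vs) a b = Via vs a b ⊎ (Via vs a v × Via vs v b)

  via? : ∀ vs a b → Dec (Via vs a b)
  via? []       a b = (a ≟ b) ⊎-dec (a ⟶? b)
  via? (v ∷ vs) a b = via? vs a b ⊎-dec (via? vs a v ×-dec via? vs v b)

  via⇒star : ∀ vs {a b} → Via vs a b → Star _⟶_ a b
  via⇒star []       (inj₁ refl)    = ε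
  via⇒star []       (inj₂ a⟶b)     = a⟶b ◅ ε
  via⇒star (v ∷ vs) (inj₁ p)       = via⇒star vs p
  via⇒star (v ∷ vs) (inj₂ (p , r)) = via⇒star vs p ◅◅ via⇒star vs r

  via-base : ∀ vs {a b} → a ≡ b ⊎ a ⟶ b → Via vs a b
  via-base []       p = p
  via-base (v ∷ vs) p = inj₁ (via-base vs p)

  via-trans : ∀ {vs v a b} → v ∈ vs → Via vs a v → Via vs v b → Via vs a b
  via-trans (here refl) p r = inj₂ (into p , outof r)
    where
    into : ∀ {vs v a} → Via (v ∷ vs) a v → Via vs a v
    into (inj₁ p)       = p
    into (inj₂ (p , _)) = p
    outof : ∀ {vs v b} → Via (v ∷ vs) v b → Via vs v b
    outof (inj₁ r)       = r
    outof (inj₂ (_ , r)) = r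
  via-trans (there v∈) (inj₁ p)        (inj₁ r)        = inj₁ (via-trans v∈ p r)
  via-trans (there v∈) (inj₁ p)        (inj₂ (r , r′)) = inj₂ (via-trans v∈ p r , r′)
  via-trans (there v∈) (inj₂ (p , p′)) (inj₁ r)        = inj₂ (p , via-trans v∈ p′ r)
  via-trans (there v∈) (inj₂ (p , _))  (inj₂ (_ , r′)) = inj₂ (p , r′)

  star⇒via : ∀ {vs} → (∀ v → v ∈ vs) → ∀ {a b} → Star _⟶_ a b → Via vs a b
  star⇒via {vs} all ε         = via-base vs (inj₁ refl)
  star⇒via {vs} all (s ◅ p) = via-trans (all _) (via-base vs (inj₂ s)) (star⇒via all p)

  star? : ∀ {vs} → (∀ v → v ∈ vs) → ∀ a b → Dec (Star _⟶_ a b)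
  star? {vs} all a b = map′ (via⇒star vs) (star⇒via all) (via? vs a b)

-- English notation: row 0 is the top row.
module Skew {k m : ℕ} (μ κ : Partition k m) where

  Box : Set
  Box = Fin k × Fin m

  -- A box is (row , column).
  InShape : Pred Box 0ℓ
  InShape (i , j) = toℕ (part κ i) ≤ toℕ j × toℕ j < toℕ (part μ i)

  Adjacent : Rel Box 0ℓ
  Adjacent (i , j) (i′ , j′) = ∣ toℕ i - toℕ i′ ∣ ℕ.+ ∣ toℕ j - toℕ j′ ∣ ≡ 1

  Step : Rel Box 0ℓ
  Step a b = InShape a × InShape b × Adjacent a b

  record IsRibbon : Set where
    field
      contained : ∀ i → part κ i Fin.≤ part μ i
      nonempty  : ∃ InShape
      connected : ∀ a b → InShape a → InShape b → Star Step a b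
      no2×2     : ∀ i i′ j j′ → toℕ i′ ≡ suc (toℕ i) → toℕ j′ ≡ suc (toℕ j) →
                  ¬ (InShape (i , j) × InShape (i , j′) × InShape (i′ , j) × InShape (i′ , j′))

  IsHead : Pred Box 0ℓ
  IsHead a = InShape a × (∀ b → InShape b → proj₁ a Fin.≤ proj₁ b × proj₂ b Fin.≤ proj₂ a)

  HeadInRow : Pred (Fin k) 0ℓ
  HeadInRow i = ∃[ j ] IsHead (i , j)

  inShape? : Decidable InShape
  inShape? (i , j) = (toℕ (part κ i) ℕ.≤? toℕ j) ×-dec (toℕ j ℕ.<? toℕ (part μ i))

  boxes : List Box
  boxes = cartesianProductWith _,_ (allFin k) (allFin m)

  ∈-boxes : ∀ b → b ∈ boxes
  ∈-boxes (i , j) = ∈-cartesianProductWith⁺ _,_ (∈-allFin i) (∈-allFin j)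

  allBoxes? : {P : Pred Box 0ℓ} → Decidable P → Dec (∀ b → P b)
  allBoxes? P? = map′ (λ h b → h (proj₁ b) (proj₂ b)) (λ h i j → h (i , j))
    (Fin.all? λ i → Fin.all? λ j → P? (i , j))

  path? : ∀ a b → Dec (Star Step a b)
  path? = star? ∈-boxes
    where
    open Reachability Step
      (λ a b → inShape? a ×-dec inShape? b ×-dec (_ ℕ.≟ 1))
      (λ (i , j) (i′ , j′) → map′ (λ (e , f) → cong₂ _,_ e f) (λ e → cong proj₁ e , cong proj₂ e)
        ((i Fin.≟ i′) ×-dec (j Fin.≟ j′)))

  isRibbon? : Dec IsRibbon
  isRibbon? = map′
    (λ (c , e , p , s) → record { contained = c ; nonempty = e ; connected = p ; no2×2 = s })
    (λ r → let open IsRibbon r in contained , nonempty , connected , no2×2)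
    ( (Fin.all? λ i → part κ i Fin.≤? part μ i)
    ×-dec map′ (λ (i , j , h) → (i , j) , h) (λ ((i , j) , h) → i , j , h)
            (Fin.any? λ i → Fin.any? λ j → inShape? (i , j))
    ×-dec (allBoxes? λ a → allBoxes? λ b → inShape? a →-dec inShape? b →-dec path? a b)
    ×-dec (Fin.all? λ i → Fin.all? λ i′ → Fin.all? λ j → Fin.all? λ j′ →
            (toℕ i′ ℕ.≟ suc (toℕ i)) →-dec (toℕ j′ ℕ.≟ suc (toℕ j)) →-dec
            ¬? (inShape? (i , j) ×-dec inShape? (i , j′) ×-dec inShape? (i′ , j) ×-dec inShape? (i′ , j′))))

  headInRow? : Decidable HeadInRow
  headInRow? i = Fin.any? λ j → inShape? (i , j) ×-dec
    (allBoxes? λ b → inShape? b →-dec ((i Fin.≤? proj₁ b) ×-dec (proj₂ b Fin.≤? j)))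

  ht wd : ℕ
  ht = length (filter (λ i → Fin.any? λ j → inShape? (i , j)) (allFin k))
  wd = length (filter (λ j → Fin.any? λ i → inShape? (i , j)) (allFin m))

open Skew using (IsRibbon; HeadInRow; isRibbon?; headInRow?; ht; wd)

ribbonsBelow : ∀ {k m} → Fin k → Partition k m → List (Partition k m)
ribbonsBelow {k} {m} i μ = filter (λ κ → isRibbon? μ κ ×-dec headInRow? μ κ i) (partitions k m)

data HeckeGenerator (n : ℕ) : Set where
  `T : Fin (pred n) → HeckeGenerator n
  `x : Fin n → HeckeGenerator n

module Hecke (K : CommutativeRing 0ℓ 0ℓ) (p q ħ : CommutativeRing.Carrier K) (n : ℕ) where
  private
    module K = CommutativeRing K

  T : Fin (pred n) → Expr K.Carrier (HeckeGenerator n)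
  T i = gen (`T i)

  x : Fin n → Expr K.Carrier (HeckeGenerator n)
  x j = gen (`x j)

  -- ħ - (p - q) x_j
  δ : Fin n → Expr K.Carrier (HeckeGenerator n)
  δ j = con ħ ⊕ ⊖ (con (p K.- q) ⊗ x j)

  data Relation : Rel (Expr K.Carrier (HeckeGenerator n)) 0ℓ where
    quadratic : ∀ i → Relation ((T i ⊕ con p) ⊗ (T i ⊕ ⊖ con q)) (con K.0#)
    braid     : ∀ i j → toℕ j ≡ suc (toℕ i) → Relation (T i ⊗ T j ⊗ T i) (T j ⊗ T i ⊗ T j)
    far       : ∀ i j → suc (toℕ i) < toℕ j → Relation (T i ⊗ T j) (T j ⊗ T i)
    xx        : ∀ i j → Relation (x i ⊗ x j) (x j ⊗ x i)
    Tx-far    : ∀ i j → j ≢ lo i → j ≢ hi i → Relation (T i ⊗ x j) (x j ⊗ T i)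
    Tx-lo     : ∀ i → Relation (T i ⊗ x (lo i)) (x (hi i) ⊗ T i ⊕ δ (lo i))
    Tx-hi     : ∀ i → Relation (T i ⊗ x (hi i)) (x (lo i) ⊗ T i ⊕ ⊖ δ (lo i))

  ring : Ring 0ℓ 0ℓ
  ring = Presented.ring K (HeckeGenerator n) Relation

data Parameter : Set where
  `p `q `ħ : Parameter

-- ℚ[p,q,ħ]
A : CommutativeRing 0ℓ 0ℓ
A = Polynomials ℚ-ring Parameter

module Scalars where
  p q ħ : CommutativeRing.Carrier A
  p = gen `p
  q = gen `q
  ħ = gen `ħ

module Grassmannian (n k : ℕ) (k≤n : k ≤ n) where
  open Scalars
  open QuantumIntegers A p q

  -- A[([k]![n-k]!)⁻¹]
  Aloc : CommutativeRing 0ℓ 0ℓ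
  Aloc = Localization A (CommutativeRing._*_ A ⟨ k ⟩! ⟨ n ∸ k ⟩!)

  scalar : CommutativeRing.Carrier A → CommutativeRing.Carrier Aloc
  scalar = con

  open Hecke Aloc (scalar p) (scalar q) (scalar ħ) n public using (T; x)

  Ĥ : Ring 0ℓ 0ℓ
  Ĥ = Hecke.ring Aloc (scalar p) (scalar q) (scalar ħ) n

  open Ring Ĥ public using (Carrier; _≈_; _+_; _*_; _-_; 0#; 1#)
  open BigOperators Ĥ public
  open Algebra.Properties.Semiring.Exp (Ring.semiring Ĥ) using (_^_)

  p̂ q̂ [k]![n-k]!⁻¹ : Carrier
  p̂           = con (scalar p)
  q̂           = con (scalar q)
  [k]![n-k]!⁻¹ = con (gen tt)

  T̄ : Fin (pred n) → Carrier
  T̄ i = T i + (p̂ - q̂)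

  T̄ₚ : Permutation′ n → Carrier
  T̄ₚ w = product (map T̄ (proj₁ (reducedWord w)))

  d : ℕ
  d = k C 2 ℕ.+ (n ∸ k) C 2

  -- d is the largest length in S_k × S_{n-k}, so ∸ does not truncate.
  Σⁿₖ : Carrier
  Σⁿₖ = [k]![n-k]!⁻¹ * sum (map (λ v → q̂ ^ (d ∸ ℓ v) * T̄ₚ v) (youngSubgroup n k))

  Shape : Set
  Shape = Partition k (n ∸ k)

  T̄ₛ : Shape → Carrier
  T̄ₛ ν = T̄ₚ (proj₁ (grassmannian k≤n ν)) * Σⁿₖ

  e : ℕ → Carrier
  e r = sum (map product (sublists r (map (λ i → x (inject≤ i k≤n)) (allFin k))))

  A[x] : CommutativeRing 0ℓ 0ℓ
  A[x] = Polynomials A (Fin n)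

  module A[x] = CommutativeRing A[x]

  embed : A[x].Carrier → Carrier
  embed (con a) = con (scalar a)
  embed (gen j) = x j
  embed (f ⊕ g) = embed f + embed g
  embed (f ⊗ g) = embed f * embed g
  embed (⊖ f)   = Ring.-_ Ĥ (embed f)

  -- Formal left A[x]-linear combinations g₁T̄_{ν₁} + ⋯ + gₛT̄_{νₛ}.  The
  -- operators are defined on these, so that no appeal to the linear
  -- independence of the T̄_ν is needed.
  Combination : Set
  Combination = List (A[x].Carrier × Shape)

  ⟦_⟧ : Combination → Carrier
  ⟦ c ⟧ = sum (map (λ (g , ν) → embed g * T̄ₛ ν) c)

  basis : Shape → Combination
  basis ν = [ (A[x].1# , ν) ]

  _·_ : A[x].Carrier → Combination → Combination
  g · c = map (λ (f , ν) → (g A[x].* f , ν)) c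

  -- The index of x_{μᵢ+k+1-i}, which is also h(μ/κ) when μ/κ has its head
  -- in row i.
  h : Fin k → Shape → Fin n
  h i μ = fromℕ< {toℕ (part μ i) ℕ.+ toℕ (opposite i)} bound
    where
    bound : toℕ (part μ i) ℕ.+ toℕ (opposite i) < n
    bound = subst (toℕ (part μ i) ℕ.+ toℕ (opposite i) <_) (ℕ.m∸n+n≡m k≤n)
      (ℕ.+-mono-≤-< (Fin.toℕ≤pred[n] (part μ i)) (Fin.toℕ<n (opposite i)))

  module _ where
    open Algebra.Properties.Semiring.Exp (CommutativeRing.semiring A) renaming (_^_ to _^ᴬ_)
    private
      module A = CommutativeRing A

    ribbonCoefficient : Fin k → Shape → Shape → A[x].Carrier
    ribbonCoefficient i μ κ =
      (con ħ A[x].- con (p A.- q) A[x].* gen (h i μ)) A[x].* con (p ^ᴬ (ht μ κ ∸ 1) A.* q ^ᴬ (wd μ κ ∸ 1))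

  D₀ : Fin k → Shape → Combination
  D₀ i μ = (gen (h i μ) , μ) ∷ map (λ κ → (ribbonCoefficient i μ κ , κ)) (ribbonsBelow i μ)

  D : Fin k → Combination → Combination
  D i = concatMap (λ (g , μ) → g · D₀ i μ)

{-# OPTIONS --safe #-}

-- Encode ν ⊆ (n-k)^k by the set {w_ν(1),…,w_ν(k)}, read as a word of n bits.
-- Removing a ribbon with head in row i from ν moves the i-th largest element
-- of the set down to a free position, and p^{ht-1} q^{wd-1} records the
-- occupied and the free positions that it passes.  So the right-hand side of
-- the theorem results from a single pass over the positions, from the bottom
-- up, in which r of the occupied positions are chosen and each of them is
-- either kept, with a factor x, or moved down, with a factor ħ - (p-q)x; this
-- is climb.
--
-- If s_j raises an element of the set for ν, then T̄_j T̄_ν = T̄_{s_j ν}, while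
-- T̄_j acts on T̄_ν by p if j and j + 1 are both occupied or both free.  The
-- same holds for the results of the later part of the pass, and therefore the
-- whole pass commutes with the raising operators T̄_j.  So does right
-- multiplication by e_r, and at the empty partition both sides are
-- e_r(x_1,…,x_k) T̄_∅, because e_r commutes with Σ.
module Submission where

open import Algebra.Bundles using (CommutativeMonoid; CommutativeRing; Ring)
import Algebra.Properties.CommutativeSemigroup
import Algebra.Properties.Group
import Algebra.Properties.Ring
import Algebra.Properties.Semigroup
import Algebra.Properties.Semiring.Exp
open import Data.Bool.Base using (Bool; true; false; if_then_else_)
open import Data.Fin using (Fin)
open import Data.Fin.Base as Fin using (zero; suc; toℕ; fromℕ; fromℕ<; inject₁; inject≤; opposite; punchIn)
open import Data.Fin.Permutation using (Permutation′; _⟨$⟩ʳ_; insert; remove; remove-insert; punchIn-permute) renaming (id to idₚ)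
import Data.Fin.Properties as Fin
open import Data.List using (foldr; map; allFin)
open import Data.List.Base using (List; []; _∷_; [_]; _++_; _∷ʳ_; _ʳ++_; length; replicate; filter; tabulate; take; reverse; foldl; cartesianProductWith)
open import Data.List.Membership.Propositional using (_∈_)
open import Data.List.Membership.Propositional.Properties using (∈-map⁺; ∈-map⁻; ∈-filter⁺; ∈-filter⁻)
open import Data.List.Membership.Propositional.Properties.WithK using (unique∧set⇒bag)
open import Data.List.Properties using (++-assoc; ++-identityʳ; ++-cancelˡ; ∷-injective; length-++; length-replicate; length-reverse; length-tabulate; map-++; map-∘; map-tabulate; filter-++; foldl-∷ʳ; take-suc-tabulate; take-all; ʳ++-defn; reverse-involutive)
open import Data.List.Relation.Binary.BagAndSetEquality using (∼bag⇒↭)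
open import Data.List.Relation.Binary.Permutation.Propositional using (_↭_)
open import Data.List.Relation.Unary.All as All using ([]; _∷_)
open import Data.List.Relation.Unary.AllPairs using ([]; _∷_)
open import Data.List.Relation.Unary.Any using (here; there)
open import Data.List.Relation.Unary.Unique.Propositional using (Unique)
import Data.List.Relation.Unary.Unique.Propositional.Properties as Unique
open import Data.Nat using (ℕ; _≤_; _∸_)
open import Data.Nat.Base as ℕ using (zero; suc; pred; _<_; z≤n; s≤s; s≤s⁻¹; ∣_-_∣)
open import Data.Nat.Combinatorics using (_C_; nCk+nC[k+1]≡[n+1]C[k+1]; nC1≡n)
import Data.Nat.Properties as ℕ
open import Data.Product.Base using (∃; ∃-syntax; _×_; _,_; proj₁; proj₂)
open import Data.Sum.Base using (_⊎_; inj₁; inj₂)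
open import Data.Unit.Base using (⊤; tt)
open import Data.Vec.Base as Vec using (Vec; []; _∷_; fromList; lookup; toList)
open import Data.Vec.Properties using (cast-is-id; length-toList; toList-injective)
open import Data.Vec.Relation.Unary.Linked as Linked using (Linked; []; [-]; _∷_)
open import Function.Base using (_∘_; id)
open import Function.Bundles using (_⇔_; mk⇔; Equivalence)
open import Level using (0ℓ)
open import Relation.Binary.Construct.Closure.ReflexiveTransitive using (Star; ε; _◅_; _◅◅_) renaming (reverse to reverse⋆)
open import Relation.Binary.Core using (Rel)
open import Relation.Binary.Definitions using (tri<; tri≈; tri>)
open import Relation.Binary.PropositionalEquality as ≡ using (_≡_; _≢_)
open import Relation.Nullary using (¬_; yes; no; contradiction; does)
open import Relation.Nullary.Decidable using (_×-dec_; does-⇔; dec-true; dec-false)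
open import Relation.Unary using (Pred; Decidable)
open import Defs

-- Finite Hecke algebras

-- The raising operators respect every single choice of r elements: the summands of `climb` for
-- chosen and for unchosen elements are treated separately. Only the two fates of a chosen element
-- mix. Raising it from j to j + 1 turns its factor x_j into x_{j+1} plus a term ħ - (p-q)x_{j+1},
-- and the latter is the move back to j, the position that has just become free. The sum over all
-- choices is needed only at the empty partition, where the products of the x's have to pass Σ.
--
-- The factor ħ - (p-q)x_j does not simply pass T̄_j. It does so on vectors on which T̄_j acts by p,
-- and then turns up with an extra q, the weight of the new free position j. Hence the eigenvalue p
-- on pairs of equal bits is carried through the whole induction together with the raising rule.
--
-- The T̄_ν are not assumed to be independent, so D_i is no operator on Ĥ. It is transposed to an
-- operation on functions from shapes to Ĥ, beginning with ν ↦ T̄_ν. The largest row i_r acts first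
-- on the shape, which is why the pass goes from the bottom up.

record HeckeFamily (R : Ring 0ℓ 0ℓ) (n : ℕ) : Set where
  open Ring R hiding (zero)
  field
    p q       : Carrier
    p-central : ∀ a → p * a ≈ a * p
    q-central : ∀ a → q * a ≈ a * q
    t         : ℕ → Carrier
    quadratic : ∀ i → suc i < n → t i * t i + q * t i ≈ p * t i + p * q
    braid     : ∀ i → suc (suc i) < n → t i * t (suc i) * t i ≈ t (suc i) * t i * t (suc i)
    far       : ∀ i j → suc i < j → t i * t j ≈ t j * t i

module Commutation (R : Ring 0ℓ 0ℓ) where
  open Ring R hiding (zero)
  open Algebra.Properties.Semigroup *-semigroup

  infix 4 _⋈_

  _⋈_ : Carrier → Carrier → Set
  a ⋈ b = a * b ≈ b * a

  ⋈-1 : ∀ {a} → a ⋈ 1#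
  ⋈-1 {a} = trans (*-identityʳ a) (sym (*-identityˡ a))

  ⋈-0 : ∀ {a} → a ⋈ 0#
  ⋈-0 {a} = trans (zeroʳ a) (sym (zeroˡ a))

  ⋈-+ : ∀ {a b c} → a ⋈ b → a ⋈ c → a ⋈ b + c
  ⋈-+ {a} {b} {c} ab ac = trans (distribˡ a b c) (trans (+-cong ab ac) (sym (distribʳ a b c)))

  pass : ∀ {a b} → a ⋈ b → ∀ y → a * (b * y) ≈ b * (a * y)
  pass = uv≈wx⇒u∙vy≈w∙xy

  slide-* : ∀ {a b c d e} → a * b ≈ b * c → c * d ≈ d * e → a * (b * d) ≈ b * d * e
  slide-* ab cd = trans (uv≈wx⇒u∙vy≈w∙xy ab _) (trans (*-congˡ cd) (sym (*-assoc _ _ _)))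

  ⋈-* : ∀ {a b c} → a ⋈ b → a ⋈ c → a ⋈ b * c
  ⋈-* = slide-*

-- Words of bits and adjacent positions.

ones zeros : ∀ {l} → Vec Bool l → ℕ
ones []           = 0
ones (false ∷ bs) = ones bs
ones (true  ∷ bs) = suc (ones bs)
zeros []           = 0
zeros (false ∷ bs) = suc (zeros bs)
zeros (true  ∷ bs) = zeros bs

zeros+ones : ∀ {l} (bs : Vec Bool l) → zeros bs ℕ.+ ones bs ≡ l
zeros+ones []           = ≡.refl
zeros+ones (false ∷ bs) = ≡.cong suc (zeros+ones bs)
zeros+ones (true  ∷ bs) = ≡.trans (ℕ.+-suc (zeros bs) (ones bs)) (≡.cong suc (zeros+ones bs))

-- Bits are listed from the top position down, so that position j is the
-- head of a suffix of length j + 1.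
data Ascend : ∀ {l} → ℕ → Vec Bool l → Vec Bool l → Set where
  here  : ∀ {l} {bs : Vec Bool l} → Ascend l (false ∷ true ∷ bs) (true ∷ false ∷ bs)
  there : ∀ {l j} {as bs : Vec Bool l} b → Ascend j as bs → Ascend j (b ∷ as) (b ∷ bs)

data Plateau : ∀ {l} → ℕ → Vec Bool l → Set where
  here  : ∀ {l} {bs : Vec Bool l} b → Plateau l (b ∷ b ∷ bs)
  there : ∀ {l j} {bs : Vec Bool l} b → Plateau j bs → Plateau j (b ∷ bs)

ascend-ones : ∀ {l j} {as bs : Vec Bool l} → Ascend j as bs → ones as ≡ ones bs
ascend-ones here              = ≡.refl
ascend-ones (there false asc) = ascend-ones asc
ascend-ones (there true  asc) = ≡.cong suc (ascend-ones asc)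

ascend-zeros : ∀ {l j} {as bs : Vec Bool l} → Ascend j as bs → zeros as ≡ zeros bs
ascend-zeros here              = ≡.refl
ascend-zeros (there false asc) = ≡.cong suc (ascend-zeros asc)
ascend-zeros (there true  asc) = ascend-zeros asc

plateau-< : ∀ {l j} {bs : Vec Bool l} → Plateau j bs → suc j < l
plateau-< (here b)       = ℕ.≤-refl
plateau-< (there b flat) = ℕ.m≤n⇒m≤1+n (plateau-< flat)

ascend-< : ∀ {l j} {as bs : Vec Bool l} → Ascend j as bs → suc j < l
ascend-< here          = ℕ.≤-refl
ascend-< (there b asc) = ℕ.m≤n⇒m≤1+n (ascend-< asc)

-- Cycles, symmetrizers and the elements T̄_ν in a finite Hecke algebra.

module HeckeWords {R : Ring 0ℓ 0ℓ} {n : ℕ} (H : HeckeFamily R n) where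
  open Ring R hiding (zero)
  open HeckeFamily H
  open Commutation R
  open import Relation.Binary.Reasoning.Setoid setoid
  open Algebra.Properties.Semigroup *-semigroup
    using ([uv∙w]x≈u[v∙wx])

  t-cong : ∀ {i j} → i ≡ j → t i ≈ t j
  t-cong i≡j = reflexive (≡.cong t i≡j)

  -- The word t_{s+z-1} ⋯ t_s of the cycle that carries position s up to position s + z.
  desc : ℕ → ℕ → Carrier
  desc s zero    = 1#
  desc s (suc z) = t (z ℕ.+ s) * desc s z

  desc-last : ∀ s z → desc s (suc z) ≈ desc (suc s) z * t s
  desc-last s zero    = ⋈-1
  desc-last s (suc z) = begin
    t (suc z ℕ.+ s) * desc s (suc z)          ≈⟨ *-cong (t-cong (≡.sym (ℕ.+-suc z s))) (desc-last s z) ⟩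
    t (z ℕ.+ suc s) * (desc (suc s) z * t s)  ≈⟨ *-assoc _ _ _ ⟨
    desc (suc s) (suc z) * t s                ∎

  desc-comm : ∀ {a} s z → (∀ i → i < z → a ⋈ t (i ℕ.+ s)) → a ⋈ desc s z
  desc-comm s zero    h = ⋈-1
  desc-comm s (suc z) h = ⋈-* (h z ℕ.≤-refl) (desc-comm s z (λ i i<z → h i (ℕ.m≤n⇒m≤1+n i<z)))

  desc-comm-above : ∀ {i} s z → z ℕ.+ s < i → t i ⋈ desc s z
  desc-comm-above {i} s z z+s<i = desc-comm s z λ j j<z →
    sym (far _ _ (ℕ.≤-<-trans (ℕ.+-monoˡ-≤ s j<z) z+s<i))

  desc-comm-below : ∀ {i} s z → suc i < s → t i ⋈ desc s z
  desc-comm-below {i} s z i<s = desc-comm s z λ j _ → far _ _ (ℕ.<-≤-trans i<s (ℕ.m≤n+m s j))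

  -- The cycle lowers the positions s + 1, ..., s + z by one and so conjugates one generator into
  -- the other. In the algebra the braid relation does this at the letters t_{i+1+s} t_{i+s}; the
  -- other letters are far enough away to commute.
  desc-shift : ∀ s z i → suc i < z → z ℕ.+ s < n → t (i ℕ.+ s) * desc s z ≈ desc s z * t (suc i ℕ.+ s)
  desc-shift s (suc z) i (s≤s 1+i≤z) bound with ℕ.m≤n⇒m<n∨m≡n 1+i≤z
  ... | inj₁ 1+i<z = slide-* (far _ _ (ℕ.+-monoˡ-< s 1+i<z)) (desc-shift s z i 1+i<z (ℕ.<⇒≤ bound))
  ... | inj₂ ≡.refl = begin
    a * (b * (a * desc s i))    ≈⟨ [uv∙w]x≈u[v∙wx] _ _ _ _ ⟨
    a * b * a * desc s i        ≈⟨ *-congʳ (braid _ bound) ⟩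
    b * a * b * desc s i        ≈⟨ [uv∙w]x≈u[v∙wx] _ _ _ _ ⟩
    b * (a * (b * desc s i))    ≈⟨ *-congˡ (*-congˡ (desc-comm-above s i ℕ.≤-refl)) ⟩
    b * (a * (desc s i * b))    ≈⟨ *-congˡ (*-assoc _ _ _) ⟨
    b * (a * desc s i * b)      ≈⟨ *-assoc _ _ _ ⟨
    b * (a * desc s i) * b      ∎
    where
    a = t (i ℕ.+ s)
    b = t (suc i ℕ.+ s)

  -- Each letter of the right factor moves to the left through `desc s y` and loses one from its
  -- index.
  desc-desc : ∀ s y z → z < y → y ℕ.+ s < n → desc s y * desc (suc s) z ≈ desc s z * desc s y
  desc-desc s y zero    z<y bound = ⋈-1
  desc-desc s y (suc z) z<y bound = begin
    desc s y * (t (z ℕ.+ suc s) * desc (suc s) z)      ≈⟨ *-assoc _ _ _ ⟨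
    desc s y * t (z ℕ.+ suc s) * desc (suc s) z        ≈⟨ *-congʳ (*-congˡ (t-cong (ℕ.+-suc z s))) ⟩
    desc s y * t (suc z ℕ.+ s) * desc (suc s) z        ≈⟨ *-congʳ (desc-shift s y z z<y bound) ⟨
    t (z ℕ.+ s) * desc s y * desc (suc s) z            ≈⟨ *-assoc _ _ _ ⟩
    t (z ℕ.+ s) * (desc s y * desc (suc s) z)          ≈⟨ *-congˡ (desc-desc s y z (ℕ.<⇒≤ z<y) bound) ⟩
    t (z ℕ.+ s) * (desc s z * desc s y)                ≈⟨ *-assoc _ _ _ ⟨
    desc s (suc z) * desc s y                          ∎

  -- This serves two neighbouring ones that have both crossed z zeros: exchanging them after the
  -- crossing is exchanging them before it.
  desc-desc-slide : ∀ s z → suc z ℕ.+ s < n →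
                    t (z ℕ.+ s) * (desc s z * desc (suc s) z) ≈ desc s z * desc (suc s) z * t s
  desc-desc-slide s z bound = begin
    t (z ℕ.+ s) * (desc s z * desc (suc s) z)    ≈⟨ *-assoc _ _ _ ⟨
    desc s (suc z) * desc (suc s) z              ≈⟨ desc-desc s (suc z) z ℕ.≤-refl bound ⟩
    desc s z * desc s (suc z)                    ≈⟨ *-congˡ (desc-last s z) ⟩
    desc s z * (desc (suc s) z * t s)            ≈⟨ *-assoc _ _ _ ⟨
    desc s z * desc (suc s) z * t s              ∎

  Eigen : Carrier → Carrier → Set
  Eigen a v = a * v ≈ p * v

  eigen-cong : ∀ {a v w} → v ≈ w → Eigen a v → Eigen a w
  eigen-cong v≈w e = trans (*-congˡ (sym v≈w)) (trans e (*-congˡ v≈w))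

  eigen-+ : ∀ {a v w} → Eigen a v → Eigen a w → Eigen a (v + w)
  eigen-+ e f = trans (distribˡ _ _ _) (trans (+-cong e f) (sym (distribˡ _ _ _)))

  eigen-comm : ∀ {a b v} → a ⋈ b → Eigen a v → Eigen a (b * v)
  eigen-comm {a} {b} {v} ab e = trans (pass ab v) (trans (*-congˡ e) (sym (pass (p-central b) v)))

  eigen-slide : ∀ {a b c v} → a * b ≈ b * c → Eigen c v → Eigen a (b * v)
  eigen-slide {a} {b} {c} {v} ab e = begin
    a * (b * v)  ≈⟨ *-assoc _ _ _ ⟨
    a * b * v    ≈⟨ *-congʳ ab ⟩
    b * c * v    ≈⟨ *-assoc _ _ _ ⟩
    b * (c * v)  ≈⟨ *-congˡ e ⟩
    b * (p * v)  ≈⟨ pass (p-central b) v ⟨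
    p * (b * v)  ∎

  eigen-q : ∀ {a v} → Eigen a v → Eigen a (q * v)
  eigen-q = eigen-comm (sym (q-central _))

  quadratic-apply : ∀ i v → suc i < n → t i * (t i * v) + q * (t i * v) ≈ p * (t i * v) + p * (q * v)
  quadratic-apply i v bound = begin
    t i * (t i * v) + q * (t i * v)  ≈⟨ +-cong (*-assoc _ _ _) (*-assoc _ _ _) ⟨
    t i * t i * v + q * t i * v      ≈⟨ distribʳ _ _ _ ⟨
    (t i * t i + q * t i) * v        ≈⟨ *-congʳ (quadratic i bound) ⟩
    (p * t i + p * q) * v            ≈⟨ distribʳ _ _ _ ⟩
    p * t i * v + p * q * v          ≈⟨ +-cong (*-assoc _ _ _) (*-assoc _ _ _) ⟩
    p * (t i * v) + p * (q * v)      ∎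

  -- The quadratic relation is (t_i - p)(t_i + q) = 0.
  eigen-symmetrized : ∀ i v → suc i < n → Eigen (t i) (q * v + t i * v)
  eigen-symmetrized i v bound = begin
    t i * (q * v + t i * v)          ≈⟨ distribˡ _ _ _ ⟩
    t i * (q * v) + t i * (t i * v)  ≈⟨ +-congʳ (pass (q-central _) _) ⟨
    q * (t i * v) + t i * (t i * v)  ≈⟨ +-comm _ _ ⟩
    t i * (t i * v) + q * (t i * v)  ≈⟨ quadratic-apply i v bound ⟩
    p * (t i * v) + p * (q * v)      ≈⟨ +-comm _ _ ⟩
    p * (q * v) + p * (t i * v)      ≈⟨ distribˡ _ _ _ ⟨
    p * (q * v + t i * v)            ∎

  -- The sum of q^{k-j} a_j over j ≤ k.
  weighted : ℕ → (ℕ → Carrier) → Carrier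
  weighted zero    a = a 0
  weighted (suc k) a = q * weighted k a + a (suc k)

  weighted-comm : ∀ {c a} k → (∀ j → j ≤ k → c ⋈ a j) → c ⋈ weighted k a
  weighted-comm zero    h = h 0 z≤n
  weighted-comm (suc k) h = ⋈-+ (⋈-* (sym (q-central _)) (weighted-comm k λ j j≤k → h j (ℕ.m≤n⇒m≤1+n j≤k)))
    (h (suc k) ℕ.≤-refl)

  -- The weighted sum over the minimal coset representatives, which carry position s to s + j for j
  -- ≤ k.
  coset : ℕ → ℕ → Carrier
  coset s k = weighted k (desc s)

  coset-comm : ∀ {c} s k → (∀ i → i < k → c ⋈ t (i ℕ.+ s)) → c ⋈ coset s k
  coset-comm s k h = weighted-comm k λ j j≤k → desc-comm s j λ i i<j → h i (ℕ.<-≤-trans i<j j≤k)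

  distribute : ∀ a b y → (q * a + b) * y ≈ q * (a * y) + b * y
  distribute a b y = trans (distribʳ y _ _) (+-congʳ (*-assoc _ _ _))

  -- A generator either pairs two consecutive representatives, which yields a vector of the form
  -- `q * v + t i * v`, or slides through a representative into a generator that already acts on y
  -- by p. The induction splits off the longest representative, so the pair is met when i is the
  -- largest index.
  coset-eigen : ∀ s k i y → i < k → k ℕ.+ s < n → (∀ j → suc j < k → Eigen (t (j ℕ.+ suc s)) y) →
                Eigen (t (i ℕ.+ s)) (coset s k * y)
  coset-eigen s (suc k) i y (s≤s i≤k) bound e with ℕ.m≤n⇒m<n∨m≡n i≤k
  ... | inj₁ i<k = eigen-cong (sym (distribute _ _ y)) (eigen-+
    (eigen-q (coset-eigen s k i y i<k (ℕ.<⇒≤ bound) λ j j<k → e j (ℕ.m≤n⇒m≤1+n j<k)))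
    (eigen-slide (desc-shift s (suc k) i (s≤s i<k) bound)
      (≡.subst (λ j → Eigen (t j) y) (ℕ.+-suc i s) (e i (s≤s i<k)))))
  coset-eigen s (suc zero)    i y _ bound e | inj₂ ≡.refl =
    eigen-cong (sym (trans (distribute _ _ y) (+-congˡ (*-assoc _ _ _)))) (eigen-symmetrized s (1# * y) bound)
  -- The two longest representatives form the pair; the generator commutes with all the shorter ones
  -- and reaches y.
  coset-eigen s (suc (suc k)) i y _ bound e | inj₂ ≡.refl = eigen-cong (sym expand) (eigen-+
    (eigen-q (eigen-q (eigen-comm
      (coset-comm s k λ j j<k → sym (far _ _ (s≤s (ℕ.+-monoˡ-≤ s j<k))))
      (≡.subst (λ j → Eigen (t j) y) (ℕ.+-suc k s) (e k ℕ.≤-refl)))))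
    (eigen-symmetrized (suc k ℕ.+ s) (desc s (suc k) * y) bound))
    where
    expand : coset s (suc (suc k)) * y ≈
             q * (q * (coset s k * y)) + (q * (desc s (suc k) * y) + t (suc k ℕ.+ s) * (desc s (suc k) * y))
    expand = begin
      coset s (suc (suc k)) * y
        ≈⟨ distribute _ _ y ⟩
      q * ((q * coset s k + desc s (suc k)) * y) + t (suc k ℕ.+ s) * desc s (suc k) * y
        ≈⟨ +-cong (trans (*-congˡ (distribute _ _ y)) (distribˡ _ _ _)) (*-assoc _ _ _) ⟩
      q * (q * (coset s k * y)) + q * (desc s (suc k) * y) + t (suc k ℕ.+ s) * (desc s (suc k) * y)
        ≈⟨ +-assoc _ _ _ ⟩
      q * (q * (coset s k * y)) + (q * (desc s (suc k) * y) + t (suc k ℕ.+ s) * (desc s (suc k) * y))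
        ∎

  -- The sum of q^{d-ℓ(v)} t_v over S_k × S_{m-k}, factored along the coset
  -- decomposition that the words of permutations follow.
  symmetrizer : ℕ → ℕ → ℕ → Carrier
  symmetrizer zero    k       s = 1#
  symmetrizer (suc m) zero    s = coset s m * symmetrizer m zero (suc s)
  symmetrizer (suc m) (suc k) s = coset s k * symmetrizer m k (suc s)

  private
    next : ∀ {m s} → suc m ℕ.+ s ≤ n → m ℕ.+ suc s ≤ n
    next {m} {s} = ≡.subst (_≤ n) (≡.sym (ℕ.+-suc m s))

  -- The excluded index is the generator that mixes the two blocks. A generator of the first block
  -- is absorbed by a coset factor of that block; one of the second block is far from those factors
  -- and passes them.
  symmetrizer-eigen : ∀ m k s i → k ≤ m → m ℕ.+ s ≤ n → suc i < m → suc i ≢ k →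
                      Eigen (t (i ℕ.+ s)) (symmetrizer m k s)
  symmetrizer-eigen (suc m) zero    s i k≤m bound (s≤s i<m) i≢k =
    coset-eigen s m i _ i<m bound λ j j<m → symmetrizer-eigen m zero (suc s) j z≤n (next bound) j<m λ ()
  symmetrizer-eigen (suc m) (suc k) s i (s≤s k≤m) bound (s≤s i<m) i≢k with ℕ.<-cmp i k
  ... | tri< i<k _ _ = coset-eigen s k i _ i<k (ℕ.≤-trans (s≤s (ℕ.+-monoˡ-≤ s k≤m)) bound) λ j j<k →
    symmetrizer-eigen m k (suc s) j k≤m (next bound) (ℕ.<-≤-trans j<k k≤m) (ℕ.<⇒≢ j<k)
  ... | tri≈ _ i≡k _ = contradiction (≡.cong suc i≡k) i≢k
  symmetrizer-eigen (suc m) (suc k) s (suc i) (s≤s k≤m) bound (s≤s i<m) i≢k | tri> _ _ k<i =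
    eigen-comm (coset-comm s k λ j j<k → sym (far _ _ (s≤s (ℕ.+-monoˡ-≤ s (ℕ.≤-trans j<k (s≤s⁻¹ k<i))))))
      (≡.subst (λ j → Eigen (t j) (symmetrizer m k (suc s))) (ℕ.+-suc i s)
        (symmetrizer-eigen m k (suc s) i k≤m (next bound) i<m (ℕ.>⇒≢ k<i)))

  symmetrizer-comm : ∀ {c} m k s → k ≤ m → (∀ i → suc i < m → suc i ≢ k → c ⋈ t (i ℕ.+ s)) →
                     c ⋈ symmetrizer m k s
  symmetrizer-comm zero    k       s k≤m h = ⋈-1
  symmetrizer-comm {c} (suc m) zero s k≤m h = ⋈-*
    (coset-comm s m λ i i<m → h i (s≤s i<m) λ ())
    (symmetrizer-comm m zero (suc s) z≤n λ i i<m _ →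
      ≡.subst (λ j → c ⋈ t j) (≡.sym (ℕ.+-suc i s)) (h (suc i) (s≤s i<m) λ ()))
  symmetrizer-comm {c} (suc m) (suc k) s (s≤s k≤m) h = ⋈-*
    (coset-comm s k λ i i<k → h i (s≤s (ℕ.<-≤-trans i<k k≤m)) (ℕ.<⇒≢ (s≤s i<k)))
    (symmetrizer-comm m k (suc s) k≤m λ i i<m i≢k →
      ≡.subst (λ j → c ⋈ t j) (≡.sym (ℕ.+-suc i s)) (h (suc i) (s≤s i<m) (λ e → i≢k (ℕ.suc-injective e))))

  -- This is T̄_w for the permutation w that the bits encode: the one on top of bs comes from
  -- position `ones bs` and climbs over `zeros bs` free positions.
  grass : ∀ {l} → Vec Bool l → Carrier
  grass []           = 1#
  grass (false ∷ bs) = grass bs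
  grass (true  ∷ bs) = grass bs * desc (ones bs) (zeros bs)

  grass-comm : ∀ {c l} (bs : Vec Bool l) → (∀ i → suc i < l → c ⋈ t i) → c ⋈ grass bs
  grass-comm []           h = ⋈-1
  grass-comm (false ∷ bs) h = grass-comm bs λ i i<l → h i (ℕ.m≤n⇒m≤1+n i<l)
  grass-comm (true  ∷ bs) h = ⋈-* (grass-comm bs λ i i<l → h i (ℕ.m≤n⇒m≤1+n i<l))
    (desc-comm (ones bs) (zeros bs) λ i i<z → h _ (s≤s (≡.subst (suc i ℕ.+ ones bs ≤_) (zeros+ones bs) (ℕ.+-monoˡ-≤ (ones bs) i<z))))

  grass-comm-length : ∀ {l} (bs : Vec Bool l) → t l ⋈ grass bs
  grass-comm-length bs = grass-comm bs λ i i<l → sym (far _ _ i<l)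

  -- The raised element crosses one zero more, which adds a letter at the left end of its factor
  -- `desc`. Elements further up see only the numbers of ones and zeros below them, which do not
  -- change.
  grass-ascend : ∀ {l j} {as bs : Vec Bool l} → Ascend j as bs → t j * grass as ≈ grass bs
  grass-ascend (here {l} {bs}) = begin
    t l * (grass bs * desc (ones bs) (zeros bs))         ≈⟨ pass (grass-comm-length bs) _ ⟩
    grass bs * (t l * desc (ones bs) (zeros bs))         ≈⟨ *-congˡ (*-congʳ (t-cong (zeros+ones bs))) ⟨
    grass bs * desc (ones bs) (suc (zeros bs))                     ∎
  grass-ascend (there false asc) = grass-ascend asc
  grass-ascend (there {as = as} {bs} true asc)
    rewrite ascend-ones asc | ascend-zeros asc =
    trans (sym (*-assoc _ _ _)) (*-congʳ (grass-ascend asc))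

  -- With w the permutation of bs, s_j w = w s_i for the index i found here.
  grass-plateau : ∀ {l j} {bs : Vec Bool l} → Plateau j bs → l ≤ n →
                ∃[ i ] t j * grass bs ≈ grass bs * t i ×
                       (suc i < ones bs ⊎ ∃[ z ] i ≡ z ℕ.+ ones bs × suc z < zeros bs)
  grass-plateau (here {l} {bs} false) bound = _ , grass-comm-length bs ,
    inj₂ (_ , ≡.sym (zeros+ones bs) , ℕ.≤-refl)
  grass-plateau (here {l} {bs} true) bound = ones bs , slide , inj₁ ℕ.≤-refl
    where
    k = ones bs
    z = zeros bs
    w = grass bs
    l≡ = ≡.sym (zeros+ones bs)
    slide : t l * (w * desc k z * desc (suc k) z) ≈ w * desc k z * desc (suc k) z * t k
    slide = begin
      t l * (w * desc k z * desc (suc k) z)    ≈⟨ *-congˡ (*-assoc _ _ _) ⟩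
      t l * (w * (desc k z * desc (suc k) z))  ≈⟨ pass (grass-comm-length bs) _ ⟩
      w * (t l * (desc k z * desc (suc k) z))  ≈⟨ *-congˡ (*-congʳ (t-cong l≡)) ⟩
      w * (t (z ℕ.+ k) * (desc k z * desc (suc k) z))
        ≈⟨ *-congˡ (desc-desc-slide k z (≡.subst (λ l → suc l < n) l≡ bound)) ⟩
      w * (desc k z * desc (suc k) z * t k)              ≈⟨ *-assoc _ _ _ ⟨
      w * (desc k z * desc (suc k) z) * t k              ≈⟨ *-congʳ (*-assoc _ _ _) ⟨
      w * desc k z * desc (suc k) z * t k                ∎
  grass-plateau (there false flat) bound with grass-plateau flat (ℕ.<⇒≤ bound)
  ... | i , slide , inj₁ i<k           = i , slide , inj₁ i<k
  ... | i , slide , inj₂ (z , e , z<m) = i , slide , inj₂ (z , e , ℕ.m≤n⇒m≤1+n z<m)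
  grass-plateau (there {bs = bs} true flat) bound with grass-plateau flat (ℕ.<⇒≤ bound)
  ... | i , slide , inj₁ i<k =
    i , slide-* slide (desc-comm-below (ones bs) (zeros bs) i<k) , inj₁ (ℕ.m≤n⇒m≤1+n i<k)
  ... | i , slide , inj₂ (z , ≡.refl , z<m) =
    suc i ,
    slide-* slide (desc-shift (ones bs) (zeros bs) z z<m (≡.subst (_< n) (≡.sym (zeros+ones bs)) bound)) ,
    inj₂ (z , ≡.sym (ℕ.+-suc z (ones bs)) , z<m)

  -- The T̄_ν of the statement as a function of bits, with c for the inverse of [k]![n-k]!;
  -- `T̄ₛ-element` makes the identification.
  element : Carrier → ∀ {l} → Vec Bool l → Carrier
  element c {l} bs = grass bs * (c * symmetrizer l (ones bs) 0)

  element-ascend : ∀ {c l j} {as bs : Vec Bool l} → Ascend j as bs → t j * element c as ≈ element c bs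
  element-ascend asc rewrite ascend-ones asc =
    trans (sym (*-assoc _ _ _)) (*-congʳ (grass-ascend asc))

  -- `t j` slides through `grass bs` and becomes a generator inside one of the two blocks, on which
  -- the symmetrizer has eigenvalue p.
  element-plateau : ∀ {c l j} {bs : Vec Bool l} → (∀ a → c * a ≈ a * c) → Plateau j bs → l ≤ n → Eigen (t j) (element c bs)
  element-plateau {l = l} {bs = bs} c-central flat bound with grass-plateau flat bound
  ... | i , slide , side = eigen-slide slide (eigen-comm (sym (c-central _))
      (≡.subst (λ m → Eigen (t m) (symmetrizer l (ones bs) 0)) (ℕ.+-identityʳ i)
        (symmetrizer-eigen (l) (ones bs) 0 i k≤ (≡.subst (_≤ n) (≡.sym (ℕ.+-identityʳ _)) bound) (i< side) (i≢ side))))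
    where
    k≤ : ones bs ≤ l
    k≤ = ≡.subst (ones bs ≤_) (zeros+ones bs) (ℕ.m≤n+m _ _)
    i< : suc i < ones bs ⊎ (∃[ z ] i ≡ z ℕ.+ ones bs × suc z < zeros bs) → suc i < l
    i< (inj₁ i<k)                = ℕ.<-≤-trans i<k k≤
    i< (inj₂ (z , ≡.refl , z<m)) = ≡.subst (suc (suc z) ℕ.+ ones bs ≤_) (zeros+ones bs) (ℕ.+-monoˡ-≤ (ones bs) z<m)
    i≢ : suc i < ones bs ⊎ (∃[ z ] i ≡ z ℕ.+ ones bs × suc z < zeros bs) → suc i ≢ ones bs
    i≢ (inj₁ i<k)              = ℕ.<⇒≢ i<k
    i≢ (inj₂ (z , ≡.refl , _)) = ℕ.>⇒≢ (s≤s (ℕ.m≤n+m (ones bs) z))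

-- The pass over the positions

-- δ_j stands for ħ - (p-q)x_j, and `t-δ` is what remains of the centrality of ħ once ħ and the
-- subtractions are eliminated. The last two fields say that T̄_i commutes with the symmetric
-- functions of x_i and x_{i+1}.
record AffineHeckeFamily (R : Ring 0ℓ 0ℓ) (n : ℕ) : Set where
  field
    finite : HeckeFamily R n
  open Ring R
  open HeckeFamily finite public
  open Commutation R
  field
    x δ       : ℕ → Carrier
    t-x-far   : ∀ {i j} → j ≢ i → j ≢ suc i → t i ⋈ x j
    t-δ-far   : ∀ {i j} → j ≢ i → j ≢ suc i → t i ⋈ δ j
    t-x       : ∀ i → suc i < n → t i * x i ≈ x (suc i) * t i + δ (suc i)
    t-δ       : ∀ i → suc i < n → t i * δ i + p * δ (suc i) ≈ δ (suc i) * t i + q * δ (suc i)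
    t-x+x     : ∀ i → suc i < n → t i ⋈ x i + x (suc i)
    t-x*x     : ∀ i → suc i < n → t i ⋈ x i * x (suc i)

module Esym (R : Ring 0ℓ 0ℓ) where
  open Ring R hiding (zero)
  open Commutation R

  esym : ℕ → List Carrier → Carrier
  esym zero    xs       = 1#
  esym (suc r) []       = 0#
  esym (suc r) (x ∷ xs) = x * esym r xs + esym (suc r) xs

-- Lists of bits are read from the bottom position up.
bubble : ∀ k {bs} → (P : List Bool → Set) → (∀ as {bs} → P (as ++ true ∷ false ∷ bs) → P (as ++ false ∷ true ∷ bs)) →
         P (replicate k true ++ false ∷ bs) → P (false ∷ replicate k true ++ bs)
bubble zero    P move h = h
bubble (suc k) P move h = move [] (bubble k (P ∘ (true ∷_)) (λ as → move (true ∷ as)) h)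

-- The predicate changes in the induction: the lowest bit of the target is absorbed into P. If this
-- bit is 0, `bubble` first brings a zero down past all the ones.
reach : ∀ bs → (P : List Bool → Set) → (∀ as {bs} → P (as ++ true ∷ false ∷ bs) → P (as ++ false ∷ true ∷ bs)) →
        P (replicate (ones (fromList bs)) true ++ replicate (zeros (fromList bs)) false) → P bs
reach []           P move h = h
reach (true  ∷ bs) P move h = reach bs (P ∘ (true ∷_)) (λ as → move (true ∷ as)) h
reach (false ∷ bs) P move h = reach bs (P ∘ (false ∷_)) (λ as → move (false ∷ as))
  (bubble (ones (fromList bs)) P move h)

module Climb {R : Ring 0ℓ 0ℓ} {n : ℕ} (H : AffineHeckeFamily R n)
             (c : Ring.Carrier R) (c-central : ∀ a → Ring._≈_ R (Ring._*_ R c a) (Ring._*_ R a c)) where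
  open Ring R hiding (zero)
  open AffineHeckeFamily H
  open Commutation R
  open Esym R
  open HeckeWords finite
  open import Relation.Binary.Reasoning.Setoid setoid
  open Algebra.Properties.Ring R using (+-cancelʳ)

  -- The sum of p^u q^v f(bs′) over the bs′ that arise from bs by setting a
  -- zero, where u ones and v zeros precede this zero.
  flips : ∀ {l} → (Vec Bool l → Carrier) → Vec Bool l → Carrier
  flips f []           = 0#
  flips f (false ∷ bs) = f (true ∷ bs) + q * flips (f ∘ (false ∷_)) bs
  flips f (true  ∷ bs) = p * flips (f ∘ (true ∷_)) bs

  flips-map : ∀ {a l} {f g : Vec Bool l → Carrier} → (∀ bs → a * f bs ≈ g bs) → ∀ bs → a * flips f bs ≈ flips g bs
  flips-map h []           = zeroʳ _
  flips-map h (false ∷ bs) = trans (distribˡ _ _ _)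
    (+-cong (h _) (trans (pass (sym (q-central _)) _) (*-congˡ (flips-map (h ∘ (false ∷_)) bs))))
  flips-map h (true  ∷ bs) = trans (pass (sym (p-central _)) _) (*-congˡ (flips-map (h ∘ (true ∷_)) bs))

  flips-ones : ∀ l (f : Vec Bool l → Carrier) → flips f (Vec.replicate l true) ≈ 0#
  flips-ones zero    f = refl
  flips-ones (suc l) f = trans (*-congˡ (flips-ones l _)) (zeroʳ p)

  -- The two rules by which T̄_j acts on the T̄_ν, stated for any family indexed by bits. They are
  -- bundled because setting a bit can turn an ascent into a plateau and a plateau into an ascent,
  -- so that each rule for `flips f` needs both rules for f.
  record Intertwines {l} (f : Vec Bool l → Carrier) : Set where
    constructor intertwines
    field
      ascend  : ∀ {j as bs} → Ascend j as bs → t j * f as ≈ f bs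
      plateau : ∀ {j bs} → Plateau j bs → Eigen (t j) (f bs)
  open Intertwines

  prefixed : ∀ {l} {f : Vec Bool (suc l) → Carrier} b → Intertwines f → Intertwines (f ∘ (b ∷_))
  prefixed b φ = intertwines (λ asc → ascend φ (there b asc)) (λ flat → plateau φ (there b flat))

  eigen-flips : ∀ {a l} {f : Vec Bool l → Carrier} → (∀ bs → Eigen a (f bs)) → ∀ bs → Eigen a (flips f bs)
  eigen-flips h bs = trans (flips-map h bs) (sym (flips-map (λ _ → refl) bs))

  -- When the moved element lands beside the raised one, both sides show two ones. The eigenvalue p
  -- on the left is then the weight of the occupied position that is passed on the right.
  flips-ascend : ∀ {l j} {f : Vec Bool l → Carrier} {as bs} → Intertwines f → Ascend j as bs → t j * flips f as ≈ flips f bs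
  flips-ascend {f = f} φ (here {l} {bs}) = begin
    t l * (f (true ∷ true ∷ bs) + q * (p * flips (f ∘ (false ∷_) ∘ (true ∷_)) bs))
      ≈⟨ distribˡ _ _ _ ⟩
    t l * f (true ∷ true ∷ bs) + t l * (q * (p * flips (f ∘ (false ∷_) ∘ (true ∷_)) bs))
      ≈⟨ +-cong (plateau φ (here true)) (trans (pass (sym (q-central _)) _) (*-congˡ (pass (sym (p-central _)) _))) ⟩
    p * f (true ∷ true ∷ bs) + q * (p * (t l * flips (f ∘ (false ∷_) ∘ (true ∷_)) bs))
      ≈⟨ +-congˡ (*-congˡ (*-congˡ (flips-map (λ _ → ascend φ here) bs))) ⟩
    p * f (true ∷ true ∷ bs) + q * (p * flips (f ∘ (true ∷_) ∘ (false ∷_)) bs)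
      ≈⟨ +-congˡ (pass (q-central p) _) ⟩
    p * f (true ∷ true ∷ bs) + p * (q * flips (f ∘ (true ∷_) ∘ (false ∷_)) bs)
      ≈⟨ distribˡ _ _ _ ⟨
    p * (f (true ∷ true ∷ bs) + q * flips (f ∘ (true ∷_) ∘ (false ∷_)) bs)
      ∎
  flips-ascend φ (there false asc) = trans (distribˡ _ _ _)
    (+-cong (ascend φ (there true asc))
      (trans (pass (sym (q-central _)) _) (*-congˡ (flips-ascend (prefixed false φ) asc))))
  flips-ascend φ (there true asc) =
    trans (pass (sym (p-central _)) _) (*-congˡ (flips-ascend (prefixed true φ) asc))

  -- If both positions are free, landing on the upper or on the lower one gives
  -- `t l * f₀₁ + q * f₀₁`, a symmetrized vector; its q is the weight of the upper position, passed
  -- on the way to the lower one.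
  flips-plateau : ∀ {l j} {f : Vec Bool l → Carrier} {bs} → l ≤ n → Intertwines f → Plateau j bs → Eigen (t j) (flips f bs)
  flips-plateau {f = f} bound φ (here {l} {bs} false) = eigen-cong rearrange (eigen-+
    (eigen-symmetrized l (f (false ∷ true ∷ bs)) bound)
    (eigen-q (eigen-q (eigen-flips (λ _ → plateau φ (here false)) bs))))
    where
    f₀₁ = f (false ∷ true ∷ bs)
    F₀₀ = flips (f ∘ (false ∷_) ∘ (false ∷_)) bs
    rearrange : (q * f₀₁ + t l * f₀₁) + q * (q * F₀₀) ≈ f (true ∷ false ∷ bs) + q * (f₀₁ + q * F₀₀)
    rearrange = begin
      (q * f₀₁ + t l * f₀₁) + q * (q * F₀₀)                ≈⟨ +-congʳ (+-comm _ _) ⟩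
      (t l * f₀₁ + q * f₀₁) + q * (q * F₀₀)                ≈⟨ +-assoc _ _ _ ⟩
      t l * f₀₁ + (q * f₀₁ + q * (q * F₀₀))                ≈⟨ +-cong (ascend φ here) (sym (distribˡ _ _ _)) ⟩
      f (true ∷ false ∷ bs) + q * (f₀₁ + q * F₀₀)          ∎
  flips-plateau bound φ (here {l} {bs} true) =
    eigen-comm (sym (p-central _)) (eigen-comm (sym (p-central _)) (eigen-flips (λ _ → plateau φ (here true)) bs))
  flips-plateau bound φ (there false flat) = eigen-+ (plateau φ (there true flat))
    (eigen-q (flips-plateau (ℕ.<⇒≤ bound) (prefixed false φ) flat))
  flips-plateau bound φ (there true flat) =
    eigen-comm (sym (p-central _)) (flips-plateau (ℕ.<⇒≤ bound) (prefixed true φ) flat)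

  -- The list holds the bits from position l upwards that are still to be passed, the vector those
  -- below, as altered so far; r elements remain to be chosen. The factors stand to the left of the
  -- recursive call because each D_i leaves the earlier coefficients in front.
  climb : List Bool → ℕ → ∀ {l} → Vec Bool l → Carrier
  climb []          zero    bs = element c bs
  climb []          (suc r) bs = 0#
  climb (false ∷ R) r       bs = climb R r (false ∷ bs)
  climb (true  ∷ R) zero    bs = climb R zero (true ∷ bs)
  climb (true  ∷ R) (suc r) {l} bs =
    climb R (suc r) (true ∷ bs) + (x l * climb R r (true ∷ bs) + δ l * flips (λ as → climb R r (false ∷ as)) bs)

  t-x-below : ∀ {j l} → suc j < l → t j ⋈ x l
  t-x-below j<l = t-x-far (ℕ.>⇒≢ (ℕ.<-trans ℕ.≤-refl j<l)) (ℕ.>⇒≢ j<l)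

  t-δ-below : ∀ {j l} → suc j < l → t j ⋈ δ l
  t-δ-below j<l = t-δ-far (ℕ.>⇒≢ (ℕ.<-trans ℕ.≤-refl j<l)) (ℕ.>⇒≢ j<l)

  private
    shift : ∀ {l m} → l ℕ.+ suc m ≤ n → suc l ℕ.+ m ≤ n
    shift {l} {m} = ≡.subst (_≤ n) (ℕ.+-suc l m)

  -- T̄_j for two positions already passed commutes with every x and δ still to come, so the two
  -- rules spread from `element` to the outcome of the remaining pass.
  climb-intertwines : ∀ R r {l} → l ℕ.+ length R ≤ n → Intertwines (climb R r {l})
  climb-intertwines [] zero {l} bound = intertwines element-ascend
    λ flat → element-plateau c-central flat (≡.subst (_≤ n) (ℕ.+-identityʳ l) bound)
  climb-intertwines [] (suc r) bound = intertwines (λ _ → zeroʳ _) (λ _ → trans (zeroʳ _) (sym (zeroʳ p)))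
  climb-intertwines (false ∷ R) r       bound = prefixed false (climb-intertwines R r (shift bound))
  climb-intertwines (true  ∷ R) zero    bound = prefixed true (climb-intertwines R zero (shift bound))
  climb-intertwines (true  ∷ R) (suc r) {l} bound = intertwines
    (λ asc → trans (distribˡ _ _ _) (+-cong
      (ascend (prefixed true (climb-intertwines R (suc r) (shift bound))) asc)
      (trans (distribˡ _ _ _) (+-cong
        (trans (pass (t-x-below (ascend-< asc)) _) (*-congˡ (ascend (prefixed true φ) asc)))
        (trans (pass (t-δ-below (ascend-< asc)) _) (*-congˡ (flips-ascend (prefixed false φ) asc)))))))
    (λ flat → eigen-+
      (plateau (prefixed true (climb-intertwines R (suc r) (shift bound))) flat)
      (eigen-+
        (eigen-comm (t-x-below (plateau-< flat)) (plateau (prefixed true φ) flat))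
        (eigen-comm (t-δ-below (plateau-< flat)) (flips-plateau (ℕ.m+n≤o⇒m≤o l bound) (prefixed false φ) flat))))
    where
    φ = climb-intertwines R r (shift bound)

  -- On y, the summand δ_{i+1} t_i on the right of `t-δ` becomes p δ_{i+1} and cancels against the
  -- left. The q that is left is the weight of position i, which moves starting from i + 1 have to
  -- pass.
  t-δ-eigen : ∀ i y → suc i < n → Eigen (t i) y → t i * (δ i * y) ≈ δ (suc i) * (q * y)
  t-δ-eigen i y bound e = +-cancelʳ (p * (δ (suc i) * y)) _ _ (begin
    t i * (δ i * y) + p * (δ (suc i) * y)      ≈⟨ +-cong (*-assoc _ _ _) (*-assoc _ _ _) ⟨
    t i * δ i * y + p * δ (suc i) * y          ≈⟨ distribʳ _ _ _ ⟨
    (t i * δ i + p * δ (suc i)) * y            ≈⟨ *-congʳ (t-δ i bound) ⟩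
    (δ (suc i) * t i + q * δ (suc i)) * y      ≈⟨ distribʳ _ _ _ ⟩
    δ (suc i) * t i * y + q * δ (suc i) * y    ≈⟨ +-cong (*-assoc _ _ _) (*-assoc _ _ _) ⟩
    δ (suc i) * (t i * y) + q * (δ (suc i) * y)
      ≈⟨ +-cong (trans (*-congˡ e) (sym (pass (p-central _) y))) (pass (q-central _) y) ⟩
    p * (δ (suc i) * y) + δ (suc i) * (q * y)  ≈⟨ +-comm _ _ ⟩
    δ (suc i) * (q * y) + p * (δ (suc i) * y)  ∎)

  -- All the work is in the case of an empty prefix. Below the pair that is exchanged, T̄_j is far
  -- from the x and δ met on the way and commutes with them.
  climb-move : ∀ as R r {l} (bs : Vec Bool l) → l ℕ.+ length (as ++ true ∷ false ∷ R) ≤ n →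
               t (l ℕ.+ length as) * climb (as ++ true ∷ false ∷ R) r bs ≈ climb (as ++ false ∷ true ∷ R) r bs
  climb-move [] R r {l} bs bound = trans (*-congʳ (t-cong (ℕ.+-identityʳ l))) (base r)
    where
    l+2 : suc (suc l) ℕ.+ length R ≤ n
    l+2 = shift {suc l} (shift {l} bound)
    l<n : suc l < n
    l<n = ℕ.m+n≤o⇒m≤o (suc (suc l)) l+2
    base : ∀ r → t l * climb (true ∷ false ∷ R) r bs ≈ climb (false ∷ true ∷ R) r bs
    base zero    = ascend (climb-intertwines R zero l+2) here
    base (suc r) = begin
      t l * (climb R (suc r) (false ∷ true ∷ bs) + (x l * A₀₁ + δ l * F₀₀))
        ≈⟨ trans (distribˡ _ _ _) (+-cong (ascend (climb-intertwines R (suc r) l+2) here) (distribˡ _ _ _)) ⟩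
      climb R (suc r) (true ∷ false ∷ bs) + (t l * (x l * A₀₁) + t l * (δ l * F₀₀))
        ≈⟨ +-congˡ (+-cong
             (trans (trans (sym (*-assoc _ _ _)) (trans (*-congʳ (t-x l l<n)) (distribʳ _ _ _)))
               (+-congʳ (trans (*-assoc _ _ _) (*-congˡ (ascend φ here)))))
             (t-δ-eigen l F₀₀ l<n (eigen-flips (λ _ → plateau φ (here false)) bs))) ⟩
      -- The extra term `δ (suc l) * A₀₁` is the move of the raised element back to position l, and
      -- `q * F₀₀` collects its moves past l.
      climb R (suc r) (true ∷ false ∷ bs) + ((x (suc l) * A₁₀ + δ (suc l) * A₀₁) + δ (suc l) * (q * F₀₀))
        ≈⟨ +-congˡ (trans (+-assoc _ _ _) (+-congˡ (sym (distribˡ _ _ _)))) ⟩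
      climb R (suc r) (true ∷ false ∷ bs) + (x (suc l) * A₁₀ + δ (suc l) * (A₀₁ + q * F₀₀))
        ∎
      where
      φ   = climb-intertwines R r l+2
      A₀₁ = climb R r (false ∷ true ∷ bs)
      A₁₀ = climb R r (true ∷ false ∷ bs)
      F₀₀ = flips (λ as → climb R r (false ∷ false ∷ as)) bs
  climb-move (a ∷ as) R r {l} bs bound =
    trans (*-congʳ (t-cong (ℕ.+-suc l (length as)))) (step a r)
    where
    j = suc l ℕ.+ length as
    rec : ∀ r b (bs : Vec Bool l) → t j * climb (as ++ true ∷ false ∷ R) r (b ∷ bs) ≈ climb (as ++ false ∷ true ∷ R) r (b ∷ bs)
    rec r b bs = climb-move as R r (b ∷ bs) (shift bound)
    l<j : l < j
    l<j = s≤s (ℕ.m≤m+n l (length as))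
    step : ∀ a r → t j * climb (a ∷ as ++ true ∷ false ∷ R) r bs ≈ climb (a ∷ as ++ false ∷ true ∷ R) r bs
    step false r       = rec r false bs
    step true  zero    = rec zero true bs
    step true  (suc r) = trans (distribˡ _ _ _) (+-cong (rec (suc r) true bs) (trans (distribˡ _ _ _) (+-cong
      (trans (pass (t-x-far (ℕ.<⇒≢ l<j) (ℕ.<⇒≢ (ℕ.m≤n⇒m≤1+n l<j))) _) (*-congˡ (rec r true bs)))
      (trans (pass (t-δ-far (ℕ.<⇒≢ l<j) (ℕ.<⇒≢ (ℕ.m≤n⇒m≤1+n l<j))) _) (*-congˡ (flips-map (rec r false) bs))))))

  -- Elementary symmetric polynomials and the empty partition.

  xs : ℕ → ℕ → List Carrier
  xs s zero    = []
  xs s (suc m) = x s ∷ xs (suc s) m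

  esym-comm : ∀ {a} r s m → (∀ i → s ≤ i → a ⋈ x i) → a ⋈ esym r (xs s m)
  esym-comm zero    s m       h = ⋈-1
  esym-comm (suc r) s zero    h = ⋈-0
  esym-comm (suc r) s (suc m) h = ⋈-+ (⋈-* (h s ℕ.≤-refl) (esym-comm r (suc s) m λ i s<i → h i (ℕ.<⇒≤ s<i)))
    (esym-comm (suc r) (suc s) m λ i s<i → h i (ℕ.<⇒≤ s<i))

  -- e_r of the whole list is a polynomial in y + z, yz and the e's of zs. This form is required
  -- because T̄_j commutes with y + z and yz but has a δ in its relations with y and z.
  esym-comm-pair : ∀ {a} r {y z} zs → a ⋈ y + z → a ⋈ y * z → (∀ r → a ⋈ esym r zs) → a ⋈ esym r (y ∷ z ∷ zs)
  esym-comm-pair zero          zs sum prod h = ⋈-1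
  esym-comm-pair {a} (suc zero) {y} {z} zs sum prod h =
    trans (*-congˡ expand) (trans (⋈-+ sum (h 1)) (*-congʳ (sym expand)))
    where
    expand : y * 1# + (z * 1# + esym 1 zs) ≈ (y + z) + esym 1 zs
    expand = trans (+-cong (*-identityʳ y) (+-congʳ (*-identityʳ z))) (sym (+-assoc _ _ _))
  esym-comm-pair {a} (suc (suc r)) {y} {z} zs sum prod h =
    trans (*-congˡ expand) (trans (⋈-+ (⋈-+ (⋈-* prod (h r)) (⋈-* sum (h (suc r)))) (h (suc (suc r))))
      (*-congʳ (sym expand)))
    where
    e₀ = esym r zs
    e₁ = esym (suc r) zs
    e₂ = esym (suc (suc r)) zs
    expand : y * (z * e₀ + e₁) + (z * e₁ + e₂) ≈ (y * z * e₀ + (y + z) * e₁) + e₂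
    expand = begin
      y * (z * e₀ + e₁) + (z * e₁ + e₂)          ≈⟨ +-assoc _ _ _ ⟨
      (y * (z * e₀ + e₁) + z * e₁) + e₂          ≈⟨ +-congʳ (+-congʳ (distribˡ _ _ _)) ⟩
      ((y * (z * e₀) + y * e₁) + z * e₁) + e₂    ≈⟨ +-congʳ (+-assoc _ _ _) ⟩
      (y * (z * e₀) + (y * e₁ + z * e₁)) + e₂    ≈⟨ +-congʳ (+-cong (sym (*-assoc _ _ _)) (sym (distribʳ _ _ _))) ⟩
      (y * z * e₀ + (y + z) * e₁) + e₂           ∎

  -- The excluded indices are the two ends of the block, where only one of x_j and x_{j+1} is among
  -- the variables.
  esym-symmetric : ∀ r j s m → suc j < n → suc j ≢ s → suc j ≢ m ℕ.+ s → t j ⋈ esym r (xs s m)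
  esym-symmetric zero    j s m       j<n j≢s j≢m = ⋈-1
  esym-symmetric (suc r) j s zero    j<n j≢s j≢m = ⋈-0
  esym-symmetric (suc r) j s (suc m) j<n j≢s j≢m with j ℕ.≟ s
  esym-symmetric (suc r) j s (suc zero)    j<n j≢s j≢m | yes ≡.refl = contradiction ≡.refl j≢m
  esym-symmetric (suc r) j s (suc (suc m)) j<n j≢s j≢m | yes ≡.refl =
    esym-comm-pair (suc r) (xs (suc (suc s)) m) (t-x+x s j<n) (t-x*x s j<n)
      λ r → esym-comm r (suc (suc s)) m λ i s<i → t-x-below s<i
  ... | no j≢s′ = ⋈-+
    (⋈-* (t-x-far (j≢s′ ∘ ≡.sym) (j≢s ∘ ≡.sym)) (rec r))
    (rec (suc r))
    where
    rec : ∀ r → t j ⋈ esym r (xs (suc s) m)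
    rec r = esym-symmetric r j (suc s) m j<n (j≢s′ ∘ ℕ.suc-injective)
      (λ e → j≢m (≡.trans e (ℕ.+-suc m s)))

  climb-zeros : ∀ m r {l} (bs : Vec Bool l) → climb (replicate m false) (suc r) bs ≈ 0#
  climb-zeros zero    r bs = refl
  climb-zeros (suc m) r bs = climb-zeros m r (false ∷ bs)

  -- All positions below the current one are occupied, so `flips-ones` removes every move and each
  -- chosen element just contributes its x.
  climb-minimal : ∀ k m r l → climb (replicate k true ++ replicate m false) r (Vec.replicate l true)
                  ≈ esym r (xs l k) * climb (replicate k true ++ replicate m false) zero (Vec.replicate l true)
  climb-minimal zero    m zero    l = sym (*-identityˡ _)
  climb-minimal zero    m (suc r) l = trans (climb-zeros m r _) (sym (zeroˡ _))
  climb-minimal (suc k) m zero    l = sym (*-identityˡ _)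
  climb-minimal (suc k) m (suc r) l = begin
    climb bs (suc r) ts + (x l * climb bs r ts + δ l * flips (λ as → climb bs r (false ∷ as)) (Vec.replicate l true))
      ≈⟨ +-cong (climb-minimal k m (suc r) (suc l)) (+-cong (*-congˡ (climb-minimal k m r (suc l))) (*-congˡ (flips-ones l _))) ⟩
    esym (suc r) ys * M + (x l * (esym r ys * M) + δ l * 0#)
      ≈⟨ +-congˡ (trans (+-congˡ (zeroʳ _)) (+-identityʳ _)) ⟩
    esym (suc r) ys * M + x l * (esym r ys * M)
      ≈⟨ +-comm _ _ ⟩
    x l * (esym r ys * M) + esym (suc r) ys * M
      ≈⟨ +-congʳ (*-assoc _ _ _) ⟨
    x l * esym r ys * M + esym (suc r) ys * M
      ≈⟨ distribʳ _ _ _ ⟨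
    (x l * esym r ys + esym (suc r) ys) * M
      ∎
    where
    bs = replicate k true ++ replicate m false
    ts = Vec.replicate (suc l) true
    ys = xs (suc l) k
    M  = climb bs zero ts

  zeros-replicate : ∀ l → zeros (Vec.replicate l true) ≡ 0
  zeros-replicate zero    = ≡.refl
  zeros-replicate (suc l) = zeros-replicate l

  ones-replicate : ∀ l → ones (Vec.replicate l true) ≡ l
  ones-replicate zero    = ≡.refl
  ones-replicate (suc l) = ≡.cong suc (ones-replicate l)

  grass-full : ∀ l → grass (Vec.replicate l true) ≈ 1#
  grass-full zero    = refl
  grass-full (suc l) rewrite zeros-replicate l = trans (*-identityʳ _) (grass-full l)

  -- For the empty partition `grass` is 1, so only the central factor and the symmetrizer are left,
  -- whose generators avoid the boundary between the two blocks.
  climb-minimal-element : ∀ k m {l} {bs : Vec Bool l} {a} → bs ≡ Vec.replicate l true → l ℕ.+ (k ℕ.+ m) ≤ n →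
    (∀ i → suc i < n → suc i ≢ k ℕ.+ l → a ⋈ t i) →
    a ⋈ climb (replicate k true ++ replicate m false) zero bs
  climb-minimal-element (suc k) m {l} ≡.refl bound h =
    climb-minimal-element k m ≡.refl (shift bound) λ i i<n i≢ → h i i<n (λ e → i≢ (≡.trans e (≡.sym (ℕ.+-suc k l))))
  climb-minimal-element zero m {l} {a = a} ≡.refl bound h = zerosAbove m bound ≡.refl (grass-full l)
    where
    -- Free positions added on top change neither the number of ones nor `grass`.
    zerosAbove : ∀ m {l′} {bs : Vec Bool l′} → l′ ℕ.+ m ≤ n → ones bs ≡ ones (Vec.replicate l true) → grass bs ≈ 1# →
                 a ⋈ climb (replicate m false) zero bs
    zerosAbove (suc m) bound k≡ g = zerosAbove m (shift bound) k≡ g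
    zerosAbove zero {l′} {bs} bound k≡ g = ⋈-* (trans (*-congˡ g) (trans ⋈-1 (*-congʳ (sym g))))
      (⋈-* (sym (c-central a)) (symmetrizer-comm l′ (ones bs) 0 k≤ λ i i<l i≢k →
        ≡.subst (λ j → a ⋈ t j) (≡.sym (ℕ.+-identityʳ i))
          (h i (ℕ.<-≤-trans i<l (≡.subst (_≤ n) (ℕ.+-identityʳ l′) bound))
            (λ e → i≢k (≡.trans e (≡.sym (≡.trans k≡ (ones-replicate l))))))))
      where
      k≤ : ones bs ≤ l′
      k≤ = ≡.subst (ones bs ≤_) (zeros+ones bs) (ℕ.m≤n+m _ _)

  -- T̄_j multiplies from the left and e_r from the right, so the two never meet on the way up. The
  -- number of variables is fixed beforehand, since every word on the way has the same number of
  -- ones.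
  climb-esym : ∀ bs r → length bs ≤ n → climb bs r [] ≈ climb bs zero [] * esym r (xs 0 (ones (fromList bs)))
  climb-esym bs r = reach bs (λ bs → length bs ≤ n → climb bs r [] ≈ climb bs zero [] * e) move minimal
    where
    k = ones (fromList bs)
    e = esym r (xs 0 k)
    move : ∀ as {bs} → (length (as ++ true ∷ false ∷ bs) ≤ n →
             climb (as ++ true ∷ false ∷ bs) r [] ≈ climb (as ++ true ∷ false ∷ bs) zero [] * e) →
           length (as ++ false ∷ true ∷ bs) ≤ n →
           climb (as ++ false ∷ true ∷ bs) r [] ≈ climb (as ++ false ∷ true ∷ bs) zero [] * e
    move as {bs} h bound = begin
      climb (as ++ false ∷ true ∷ bs) r []                             ≈⟨ climb-move as bs r [] bound′ ⟨
      t (length as) * climb (as ++ true ∷ false ∷ bs) r []             ≈⟨ *-congˡ (h bound′) ⟩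
      t (length as) * (climb (as ++ true ∷ false ∷ bs) zero [] * e)    ≈⟨ *-assoc _ _ _ ⟨
      t (length as) * climb (as ++ true ∷ false ∷ bs) zero [] * e      ≈⟨ *-congʳ (climb-move as bs zero [] bound′) ⟩
      climb (as ++ false ∷ true ∷ bs) zero [] * e                      ∎
      where
      same : ∀ as → length (as ++ false ∷ true ∷ bs) ≡ length (as ++ true ∷ false ∷ bs)
      same []       = ≡.refl
      same (a ∷ as) = ≡.cong suc (same as)
      bound′ = ≡.subst (_≤ n) (same as) bound
    minimal : length (replicate k true ++ replicate (zeros (fromList bs)) false) ≤ n →
              climb (replicate k true ++ replicate (zeros (fromList bs)) false) r [] ≈
              climb (replicate k true ++ replicate (zeros (fromList bs)) false) zero [] * e
    minimal bound = trans (climb-minimal k (zeros (fromList bs)) r 0)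
      (climb-minimal-element k (zeros (fromList bs)) ≡.refl (≡.subst (_≤ n) len bound)
        λ i i<n i≢k → sym (esym-symmetric r i 0 k i<n (λ ()) i≢k))
      where
      len : length (replicate k true ++ replicate (zeros (fromList bs)) false) ≡ k ℕ.+ zeros (fromList bs)
      len = ≡.trans (length-++ (replicate k true)) (≡.cong₂ ℕ._+_ (length-replicate k) (length-replicate (zeros (fromList bs))))

-- Shapes, bits and ribbons

module Shapes where
  open ≡ using (refl; sym; trans; cong; cong₂; subst; subst₂; module ≡-Reasoning)

  zeroBits : ℕ → List Bool
  zeroBits d = replicate d false

  Rows : ℕ → ℕ → Set
  Rows k m = Vec (Fin (suc m)) k

  -- Weakly decreasing rows bounded by c, with each drop d recorded: the drops are the lengths of
  -- the runs of zeros in `bits`.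
  data Below {m} (c : ℕ) : ∀ {k} → Rows k m → Set where
    []   : Below c []
    cons : ∀ {k a} {v : Rows k m} d → c ≡ d ℕ.+ toℕ a → Below (toℕ a) v → Below c (a ∷ v)

  ≤⇒+ : ∀ {a c} → a ≤ c → ∃[ d ] c ≡ d ℕ.+ a
  ≤⇒+ {a} {c} a≤c = c ∸ a , sym (ℕ.m∸n+n≡m a≤c)

  linked⇒below : ∀ {k m} (v : Rows k m) → Linked Fin._≥_ v → ∀ {c} → (∀ i → toℕ (lookup v i) ≤ c) → Below c v
  linked⇒below []      _          v≤c = []
  linked⇒below (a ∷ v) dec        v≤c with ≤⇒+ (v≤c zero)
  ... | d , e = cons d e (linked⇒below v (Linked.tail dec) λ i → part-antitone (a ∷ v , dec) {zero} {suc i} z≤n)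

  below⇒linked : ∀ {k m c} {v : Rows k m} → Below c v → Linked Fin._≥_ v
  below⇒linked []                        = []
  below⇒linked (cons d e [])             = [-]
  below⇒linked (cons d e b@(cons d′ e′ _)) = subst (_ ≤_) (sym e′) (ℕ.m≤n+m _ d′) ∷ below⇒linked b

  partition-below : ∀ {k m} (ν : Partition k m) → Below m (proj₁ ν)
  partition-below (v , dec) = linked⇒below v dec λ i → Fin.toℕ≤pred[n] (lookup v i)

  -- The bits of w_ν: position j, counted from the end of the list, holds a 1
  -- iff j is one of the values ν_i + k - i.
  bits : ∀ {k m} → ℕ → Rows k m → List Bool
  bits c []      = zeroBits c
  bits c (a ∷ v) = zeroBits (c ∸ toℕ a) ++ true ∷ bits (toℕ a) v

  bits-∷ : ∀ {k m} d a (v : Rows k m) → bits (d ℕ.+ toℕ a) (a ∷ v) ≡ zeroBits d ++ true ∷ bits (toℕ a) v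
  bits-∷ d a v = cong (λ e → zeroBits e ++ true ∷ bits (toℕ a) v) (ℕ.m+n∸n≡m d (toℕ a))

  zeroBits-+ : ∀ d e bs → zeroBits (d ℕ.+ e) ++ bs ≡ zeroBits d ++ zeroBits e ++ bs
  zeroBits-+ zero    e bs = refl
  zeroBits-+ (suc d) e bs = cong (false ∷_) (zeroBits-+ d e bs)

  bits-raise : ∀ {k m} d {b} {v : Rows k m} → Below b v → bits (d ℕ.+ b) v ≡ zeroBits d ++ bits b v
  bits-raise d {b} [] = trans (sym (++-identityʳ _)) (trans (zeroBits-+ d b []) (cong (zeroBits d ++_) (++-identityʳ _)))
  bits-raise d {v = a ∷ v} (cons e refl bel) = begin
    bits (d ℕ.+ (e ℕ.+ toℕ a)) (a ∷ v)                    ≡⟨ cong (λ c → bits c (a ∷ v)) (ℕ.+-assoc d e (toℕ a)) ⟨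
    bits (d ℕ.+ e ℕ.+ toℕ a) (a ∷ v)                      ≡⟨ bits-∷ (d ℕ.+ e) a v ⟩
    zeroBits (d ℕ.+ e) ++ true ∷ bits (toℕ a) v           ≡⟨ zeroBits-+ d e _ ⟩
    zeroBits d ++ zeroBits e ++ true ∷ bits (toℕ a) v     ≡⟨ cong (zeroBits d ++_) (bits-∷ e a v) ⟨
    zeroBits d ++ bits (e ℕ.+ toℕ a) (a ∷ v)              ∎
    where open ≡-Reasoning

  zeroBits-cancel : ∀ d e {as bs} → zeroBits d ++ true ∷ as ≡ zeroBits e ++ true ∷ bs → d ≡ e × as ≡ bs
  zeroBits-cancel zero    zero    refl = refl , refl
  zeroBits-cancel (suc d) (suc e) eq with zeroBits-cancel d e (proj₂ (∷-injective eq))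
  ... | refl , as≡bs = refl , as≡bs

  bits-injective : ∀ {k m c} {v w : Rows k m} → Below c v → Below c w → bits c v ≡ bits c w → v ≡ w
  bits-injective []            []             _  = refl
  bits-injective {c = c} {a ∷ v} {b ∷ w} (cons d e bel) (cons d′ e′ bel′) eq
    with zeroBits-cancel (c ∸ toℕ a) (c ∸ toℕ b) eq
  ... | c∸a≡c∸b , eq′ with Fin.toℕ-injective {i = a} {b}
      (ℕ.∸-cancelˡ-≡ (subst (toℕ a ≤_) (sym e) (ℕ.m≤n+m _ d)) (subst (toℕ b ≤_) (sym e′) (ℕ.m≤n+m _ d′)) c∸a≡c∸b)
  ... | refl = cong (a ∷_) (bits-injective bel bel′ eq′)

  upper : ∀ {k m} → ℕ → Rows k m → Fin k → List Bool
  upper c (a ∷ v) zero    = zeroBits (c ∸ toℕ a)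
  upper c (a ∷ v) (suc i) = zeroBits (c ∸ toℕ a) ++ true ∷ upper (toℕ a) v i

  lower : ∀ {k m} → Rows k m → Fin k → List Bool
  lower (a ∷ v) zero    = bits (toℕ a) v
  lower (a ∷ v) (suc i) = lower v i

  bits-split : ∀ {k m} c (v : Rows k m) i → bits c v ≡ upper c v i ++ true ∷ lower v i
  bits-split c (a ∷ v) zero    = refl
  bits-split c (a ∷ v) (suc i) = trans (cong (λ bs → zeroBits (c ∸ toℕ a) ++ true ∷ bs) (bits-split (toℕ a) v i))
    (sym (++-assoc (zeroBits (c ∸ toℕ a)) _ _))

  listOnes : List Bool → ℕ
  listOnes bs = ones (fromList bs)

  listOnes-++ : ∀ as bs → listOnes (as ++ bs) ≡ listOnes as ℕ.+ listOnes bs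
  listOnes-++ []           bs = refl
  listOnes-++ (false ∷ as) bs = listOnes-++ as bs
  listOnes-++ (true  ∷ as) bs = cong suc (listOnes-++ as bs)

  listOnes-zeroBits : ∀ d → listOnes (zeroBits d) ≡ 0
  listOnes-zeroBits zero    = refl
  listOnes-zeroBits (suc d) = listOnes-zeroBits d

  upper-ones : ∀ {k m} c (v : Rows k m) i → listOnes (upper c v i) ≡ toℕ i
  upper-ones c (a ∷ v) zero    = listOnes-zeroBits (c ∸ toℕ a)
  upper-ones c (a ∷ v) (suc i) = trans (listOnes-++ (zeroBits (c ∸ toℕ a)) _)
    (cong₂ ℕ._+_ (listOnes-zeroBits (c ∸ toℕ a)) (cong suc (upper-ones (toℕ a) v i)))

  bits-length : ∀ {k m c} {v : Rows k m} → Below c v → length (bits c v) ≡ c ℕ.+ k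
  bits-length {c = c} [] = trans (length-replicate c) (sym (ℕ.+-identityʳ c))
  bits-length {suc k} {c = c} {a ∷ v} (cons d refl bel) = begin
    length (bits (d ℕ.+ toℕ a) (a ∷ v))          ≡⟨ cong length (bits-∷ d a v) ⟩
    length (zeroBits d ++ true ∷ bits (toℕ a) v) ≡⟨ length-++ (zeroBits d) ⟩
    length (zeroBits d) ℕ.+ suc (length (bits (toℕ a) v)) ≡⟨ cong₂ (λ x y → x ℕ.+ suc y) (length-replicate d) (bits-length bel) ⟩
    d ℕ.+ suc (toℕ a ℕ.+ k)                       ≡⟨ cong (d ℕ.+_) (ℕ.+-suc (toℕ a) k) ⟨
    d ℕ.+ (toℕ a ℕ.+ suc k)                       ≡⟨ ℕ.+-assoc d (toℕ a) (suc k) ⟨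
    d ℕ.+ toℕ a ℕ.+ suc k                         ∎
    where open ≡-Reasoning

  bits-ones : ∀ {k m} c (v : Rows k m) → listOnes (bits c v) ≡ k
  bits-ones c []      = listOnes-zeroBits c
  bits-ones c (a ∷ v) = trans (listOnes-++ (zeroBits (c ∸ toℕ a)) _)
    (cong₂ ℕ._+_ (listOnes-zeroBits (c ∸ toℕ a)) (cong suc (bits-ones (toℕ a) v)))

  -- This length is the position of the 1 of row i, that is, the index of the variable in D_i.
  lower-length : ∀ {k m c} {v : Rows k m} i → Below c v → length (lower v i) ≡ toℕ (lookup v i) ℕ.+ toℕ (opposite i)
  lower-length {suc k} zero    (cons d e bel) = trans (bits-length bel) (cong (_ ℕ.+_) (sym (Fin.toℕ-fromℕ k)))
  lower-length {v = a ∷ v} (suc i) (cons d e bel) = trans (lower-length i bel) (cong (toℕ (lookup v i) ℕ.+_) (sym (Fin.toℕ-inject₁ (opposite i))))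

  split-unique : ∀ as as′ {bs bs′} → as ++ true ∷ bs ≡ as′ ++ true ∷ bs′ → listOnes as ≡ listOnes as′ → as ≡ as′ × bs ≡ bs′
  split-unique []           []            refl _ = refl , refl
  split-unique []           (true ∷ as′)  refl ()
  split-unique (true ∷ as)  []            refl ()
  split-unique (false ∷ as) (false ∷ as′) eq o with split-unique as as′ (proj₂ (∷-injective eq)) o
  ... | refl , bs≡ = refl , bs≡
  split-unique (true ∷ as)  (true ∷ as′)  eq o with split-unique as as′ (proj₂ (∷-injective eq)) (ℕ.suc-injective o)
  ... | refl , bs≡ = refl , bs≡

  -- A single term of `flips` as a relation: u and v count the ones and zeros passed, and will be
  -- height - 1 and width - 1 of a ribbon.
  data Flip : ℕ → ℕ → List Bool → List Bool → Set where
    here  : ∀ {bs} → Flip 0 0 (false ∷ bs) (true ∷ bs)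
    skip₀ : ∀ {u v as bs} → Flip u v as bs → Flip u (suc v) (false ∷ as) (false ∷ bs)
    skip₁ : ∀ {u v as bs} → Flip u v as bs → Flip (suc u) v (true ∷ as) (true ∷ bs)

  flip-zeroBits : ∀ v bs → Flip 0 v (zeroBits (suc v) ++ bs) (zeroBits v ++ true ∷ bs)
  flip-zeroBits zero    bs = here
  flip-zeroBits (suc v) bs = skip₀ (flip-zeroBits v bs)

  flip-prefix : ∀ {u v as bs} d → Flip u v as bs → Flip u (d ℕ.+ v) (zeroBits d ++ as) (zeroBits d ++ bs)
  flip-prefix zero    f = f
  flip-prefix (suc d) f = skip₀ (flip-prefix d f)

  flip-inversion : ∀ {u v} d as {bs} → Flip u v (zeroBits d ++ as) bs →
    (∃[ e ] d ≡ suc (v ℕ.+ e) × u ≡ 0 × bs ≡ zeroBits v ++ true ∷ zeroBits e ++ as)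
    ⊎ (∃[ v′ ] ∃[ bs′ ] v ≡ d ℕ.+ v′ × bs ≡ zeroBits d ++ bs′ × Flip u v′ as bs′)
  flip-inversion zero    as f         = inj₂ (_ , _ , refl , refl , f)
  flip-inversion (suc d) as here      = inj₁ (d , refl , refl , refl)
  flip-inversion (suc d) as (skip₀ f) with flip-inversion d as f
  ... | inj₁ (e , refl , refl , refl)         = inj₁ (e , refl , refl , refl)
  ... | inj₂ (v′ , bs′ , refl , refl , f′) = inj₂ (v′ , bs′ , refl , refl , f′)

  -- Strip u v μ κ: μ/κ is a ribbon of height u + 1 and width v + 1 with its
  -- head in row 0.  In all rows but the last one of the ribbon, κ is forced
  -- by the shape of μ.
  data Strip {m} : ℕ → ℕ → ∀ {k} → Rows (suc k) m → Rows (suc k) m → Set where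
    last : ∀ {k v a a′} {w : Rows k m} → toℕ a ≡ suc (v ℕ.+ toℕ a′) → Below (toℕ a′) w → Strip 0 v (a ∷ w) (a′ ∷ w)
    step : ∀ {k u v d a a′ b b′} {w w′ : Rows k m} → suc (toℕ a′) ≡ toℕ b → toℕ a ≡ d ℕ.+ toℕ b →
           Strip u v (b ∷ w) (b′ ∷ w′) → Strip (suc u) (d ℕ.+ v) (a ∷ b ∷ w) (a′ ∷ b′ ∷ w′)

  data Ribbon {m} : ∀ {k} → Fin k → ℕ → ℕ → Rows k m → Rows k m → Set where
    head : ∀ {k u v} {μ κ : Rows (suc k) m} → Strip u v μ κ → Ribbon zero u v μ κ
    skip : ∀ {k u v a i} {μ κ : Rows k m} → Ribbon i u v μ κ → Ribbon (suc i) u v (a ∷ μ) (a ∷ κ)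

  -- In a `step`, row 0 of κ ends one column before row 1 of μ, and since a row index lower by one
  -- adds one to the position, its 1 stands exactly where the 1 of row 1 of μ stood. Thus only the
  -- last row of the ribbon sets a new bit. κ has one row more than w and a bound smaller by one, so
  -- the two words have equal length.
  strip⇒flip : ∀ {k m u v a b} {w : Rows k m} {κ} → Strip u v (a ∷ w) κ → Below (toℕ a) w → toℕ a ≡ suc b →
               Below b κ × Flip u v (bits (suc b) w) (bits b κ)
  strip⇒flip {v = v} (last {a′ = a′} {w} e bel) _ e′ with ℕ.suc-injective (trans (sym e′) e)
  ... | refl = cons v refl bel ,
    subst₂ (Flip 0 v) (sym (bits-raise (suc v) bel)) (sym (bits-∷ v a′ w)) (flip-zeroBits v (bits (toℕ a′) w))
  strip⇒flip (step {v = v} {d = d} {a′ = a′} {b} {b′} {w} {w′} sa′≡b e s) (cons d′ _ bel) e′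
    with trans (sym e′) (trans e (trans (cong (d ℕ.+_) (sym sa′≡b)) (ℕ.+-suc d (toℕ a′))))
  ... | refl with strip⇒flip s bel (sym sa′≡b)
  ... | bel′ , f = cons d refl bel′ , subst₂ (Flip _ (d ℕ.+ v))
      (trans (sym (bits-∷ d b w)) (cong (λ c → bits c (b ∷ w)) (trans (cong (d ℕ.+_) (sym sa′≡b)) (ℕ.+-suc d (toℕ a′)))))
      (sym (bits-∷ d a′ (b′ ∷ w′)))
      (flip-prefix d (skip₁ (subst (λ c → Flip _ v (bits c w) (bits (toℕ a′) (b′ ∷ w′))) sa′≡b f)))

  strip-positive : ∀ {k m u v a} {w : Rows k m} {κ} → Strip u v (a ∷ w) κ → ∃[ b ] toℕ a ≡ suc b
  strip-positive (last e _) = _ , e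
  strip-positive (step {d = d} sa′≡b e _) = _ , trans e (trans (cong (d ℕ.+_) (sym sa′≡b)) (ℕ.+-suc d _))

  below-raise : ∀ {k m} d {c} {v : Rows k m} → Below c v → Below (d ℕ.+ c) v
  below-raise d []                       = []
  below-raise d (cons {a = a} e refl bel) = cons (d ℕ.+ e) (sym (ℕ.+-assoc d e (toℕ a))) bel

  ribbon⇒flip : ∀ {k m i u v c} {μ κ : Rows k m} → Ribbon i u v μ κ → Below c μ →
    ∃[ bs ] Flip u v (lower μ i) bs × bits c κ ≡ upper c μ i ++ false ∷ bs
  ribbon⇒flip {c = c} {a ∷ w} {κ} (head s) (cons d refl bel) with strip-positive s
  ... | b , e with strip⇒flip s bel e
  ... | bel′ , f = bits b κ , subst (λ c → Flip _ _ (bits c w) (bits b κ)) (sym e) f , (begin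
      bits (d ℕ.+ toℕ a) κ                                  ≡⟨ cong (λ c → bits (d ℕ.+ c) κ) e ⟩
      bits (d ℕ.+ suc b) κ                                  ≡⟨ bits-raise d (below-raise 1 bel′) ⟩
      zeroBits d ++ bits (suc b) κ                          ≡⟨ cong (zeroBits d ++_) (bits-raise 1 bel′) ⟩
      zeroBits d ++ false ∷ bits b κ                        ≡⟨ cong (λ e → zeroBits e ++ false ∷ bits b κ) (ℕ.m+n∸n≡m d (toℕ a)) ⟨
      zeroBits (d ℕ.+ toℕ a ∸ toℕ a) ++ false ∷ bits b κ    ∎)
      where open ≡-Reasoning
  ribbon⇒flip {c = c} (skip {a = a} r) (cons d e bel) with ribbon⇒flip r bel
  ... | bs , f , eq = bs , f , trans (cong (λ bs → zeroBits (c ∸ toℕ a) ++ true ∷ bs) eq)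
    (sym (++-assoc (zeroBits (c ∸ toℕ a)) _ _))

  lowerFin : ∀ {m} (a : Fin (suc m)) e {d} → toℕ a ≡ d ℕ.+ e → ∃[ a′ ] toℕ {suc m} a′ ≡ e
  lowerFin a e {d} eq = fromℕ< bound , Fin.toℕ-fromℕ< bound
    where
    bound = ℕ.≤-<-trans (subst (e ≤_) (sym eq) (ℕ.m≤n+m e d)) (Fin.toℕ<n a)

  -- If the zero that is set lies in the first run of zeros, the ribbon ends in row 0. Otherwise the
  -- flip passes the 1 of the next row, and row 0 of κ is forced.
  flip⇒strip : ∀ {k m u v a bs} {w : Rows k m} → Below (toℕ a) w → Flip u v (bits (toℕ a) w) bs →
    ∃[ κ ] ∃[ b ] Strip u v (a ∷ w) κ × toℕ a ≡ suc b × Below b κ × bits b κ ≡ bs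
  flip⇒strip {a = a} {bs} {[]} [] f
    with flip-inversion (toℕ a) [] (subst (λ as → Flip _ _ as bs) (sym (++-identityʳ (zeroBits (toℕ a)))) f)
  ... | inj₂ (_ , _ , _ , _ , ())
  ... | inj₁ (e , eq , refl , refl) with lowerFin a e eq
  ... | a′ , refl = a′ ∷ [] , _ , last eq [] , eq , cons _ refl [] ,
    trans (bits-∷ _ a′ []) (cong (λ bs → zeroBits _ ++ true ∷ bs) (sym (++-identityʳ _)))
  flip⇒strip {v = v} {a = a} {bs} {b ∷ w} (cons d a≡ bel) f
    with flip-inversion d (true ∷ bits (toℕ b) w)
      (subst (λ as → Flip _ _ as bs) (trans (cong (λ c → bits c (b ∷ w)) a≡) (bits-∷ d b w)) f)
  ... | inj₁ (e , refl , refl , refl) = case (lowerFin a (e ℕ.+ toℕ b) {suc v} a≡′)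
    where
    a≡′ : toℕ a ≡ suc v ℕ.+ (e ℕ.+ toℕ b)
    a≡′ = trans a≡ (cong suc (ℕ.+-assoc v e (toℕ b)))
    case : (∃[ a′ ] toℕ a′ ≡ e ℕ.+ toℕ b) → _
    case (a′ , eq) = a′ ∷ b ∷ w , v ℕ.+ toℕ a′ ,
      last (trans a≡′ (cong (λ c → suc (v ℕ.+ c)) (sym eq))) (cons e eq bel) ,
      trans a≡′ (cong (λ c → suc (v ℕ.+ c)) (sym eq)) ,
      cons v refl (cons e eq bel) ,
      trans (bits-∷ v a′ (b ∷ w))
        (cong (λ bs → zeroBits v ++ true ∷ bs) (trans (cong (λ c → bits c (b ∷ w)) eq) (bits-∷ e b w)))
  ... | inj₂ (v′ , _ , refl , refl , skip₁ f′) with flip⇒strip bel f′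
  ... | (b′ ∷ w′) , c , s , b≡ , bel′ , refl with lowerFin b c b≡
  ... | a′ , refl = a′ ∷ b′ ∷ w′ , d ℕ.+ toℕ a′ , step (sym b≡) a≡ s ,
    trans a≡ (trans (cong (d ℕ.+_) b≡) (ℕ.+-suc d (toℕ a′))) , cons d refl bel′ , bits-∷ d a′ (b′ ∷ w′)

  flip⇒ribbon : ∀ {k m u v c bs} {μ : Rows k m} i → Below c μ → Flip u v (lower μ i) bs →
    ∃[ κ ] Ribbon i u v μ κ × Below c κ
  flip⇒ribbon {μ = a ∷ w} zero (cons d refl bel) f with flip⇒strip bel f
  ... | κ , b , s , a≡ , bel′ , _ =
    κ , head s , subst (λ c → Below (d ℕ.+ c) κ) (sym a≡) (below-raise d (below-raise 1 bel′))
  flip⇒ribbon {μ = a ∷ w} (suc i) (cons d e bel) f with flip⇒ribbon i bel f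
  ... | κ , r , bel′ = a ∷ κ , skip r , cons d e bel′

  flip-functional : ∀ {u v as bs bs′} → Flip u v as bs → Flip u v as bs′ → bs ≡ bs′
  flip-functional here      here       = refl
  flip-functional (skip₀ f) (skip₀ f′) = cong (false ∷_) (flip-functional f f′)
  flip-functional (skip₁ f) (skip₁ f′) = cong (true ∷_) (flip-functional f f′)

  -- μ/κ is a ribbon with its head in row i, in terms of single rows and pairs
  -- of consecutive rows.
  record LocalRibbon {k m} (i : Fin k) (μ κ : Rows k m) : Set where
    field
      above    : ∀ r → toℕ r < toℕ i → lookup κ r ≡ lookup μ r
      proper   : toℕ (lookup κ i) < toℕ (lookup μ i)
      contains : ∀ r → toℕ (lookup κ r) ≤ toℕ (lookup μ r)
      link     : ∀ r r′ → toℕ r′ ≡ suc (toℕ r) → toℕ i ≤ toℕ r →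
                 toℕ (lookup κ r′) < toℕ (lookup μ r′) → suc (toℕ (lookup κ r)) ≡ toℕ (lookup μ r′)
  open LocalRibbon

  strip⇒local : ∀ {k m u v} {μ κ : Rows (suc k) m} → Strip u v μ κ → LocalRibbon zero μ κ
  strip⇒local (last {v = v} {a} {a′} e bel) = record
    { above    = λ r ()
    ; proper   = a′<a
    ; contains = λ { zero → ℕ.<⇒≤ a′<a ; (suc r) → ℕ.≤-refl }
    ; link     = λ { r (suc r′) _ _ lt → contradiction lt (ℕ.<-irrefl refl) }
    }
    where
    a′<a : toℕ a′ < toℕ a
    a′<a = subst (toℕ a′ <_) (sym e) (s≤s (ℕ.m≤n+m (toℕ a′) v))
  strip⇒local (step {d = d} {a} {a′} {b} e e′ s) = record
    { above    = λ r ()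
    ; proper   = a′<a
    ; contains = λ { zero → ℕ.<⇒≤ a′<a ; (suc r) → contains rec r }
    ; link     = λ { zero    (suc zero) _ _ _  → e
                   ; (suc r) (suc r′)   q _ lt → link rec r r′ (ℕ.suc-injective q) z≤n lt }
    }
    where
    rec = strip⇒local s
    a′<a : toℕ a′ < toℕ a
    a′<a = subst₂ _≤_ (sym e) (sym e′) (ℕ.m≤n+m (toℕ b) d)

  ribbon⇒local : ∀ {k m i u v} {μ κ : Rows k m} → Ribbon i u v μ κ → LocalRibbon i μ κ
  ribbon⇒local (head s) = strip⇒local s
  ribbon⇒local (skip r) = record
    { above    = λ { zero _ → refl ; (suc r) lt → above rec r (s≤s⁻¹ lt) }
    ; proper   = proper rec
    ; contains = λ { zero → ℕ.≤-refl ; (suc r) → contains rec r }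
    ; link     = λ { (suc r) (suc r′) q le lt → link rec r r′ (ℕ.suc-injective q) (s≤s⁻¹ le) lt }
    }
    where rec = ribbon⇒local r

  -- A ribbon that has ended cannot start again: at the first row r′ where κ is shorter, the row r
  -- before it would satisfy κ_r + 1 = μ_{r′} although κ_r = μ_r ≥ μ_{r′}.
  rows-equal : ∀ {k m} a (w w′ : Rows k m) → Below (toℕ a) w →
    (∀ r → toℕ (lookup w′ r) ≤ toℕ (lookup w r)) →
    (∀ r r′ → toℕ r′ ≡ suc (toℕ r) → toℕ (lookup (a ∷ w′) r′) < toℕ (lookup (a ∷ w) r′) →
       suc (toℕ (lookup (a ∷ w′) r)) ≡ toℕ (lookup (a ∷ w) r′)) →
    w ≡ w′
  rows-equal a []      []        bel            le lk = refl
  rows-equal a (b ∷ w) (b′ ∷ w′) (cons d e bel) le lk with ℕ.m≤n⇒m<n∨m≡n (le zero)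
  ... | inj₁ b′<b = contradiction (subst (toℕ b ≤_) (sym e) (ℕ.m≤n+m (toℕ b) d))
    (ℕ.<⇒≱ (ℕ.≤-reflexive (lk zero (suc zero) refl b′<b)))
  ... | inj₂ b′≡b with refl ← Fin.toℕ-injective b′≡b =
    cong (b ∷_) (rows-equal b w w′ bel (le ∘ suc) λ r r′ q → lk (suc r) (suc r′) (cong suc q))

  local⇒strip : ∀ {k m c c′} {μ κ : Rows (suc k) m} → Below c μ → Below c′ κ → LocalRibbon zero μ κ →
                ∃[ u ] ∃[ v ] Strip u v μ κ
  local⇒strip {μ = a ∷ []} {a′ ∷ []} _ (cons _ _ bel′) ℓ with ≤⇒+ (proper ℓ)
  ... | v , e = 0 , v , last (trans e (ℕ.+-suc v (toℕ a′))) bel′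
  local⇒strip {μ = a ∷ b ∷ w} {a′ ∷ b′ ∷ w′} (cons _ _ bel@(cons d e bel₂)) (cons _ _ bel′) ℓ
    with ℕ.m≤n⇒m<n∨m≡n (contains ℓ (suc zero))
  ... | inj₁ b′<b with local⇒strip bel bel′ (record
        { above    = λ r ()
        ; proper   = b′<b
        ; contains = contains ℓ ∘ suc
        ; link     = λ r r′ q _ → link ℓ (suc r) (suc r′) (cong suc q) z≤n
        })
  ...   | u , v , s = suc u , d ℕ.+ v , step (link ℓ zero (suc zero) refl z≤n b′<b) e s
  local⇒strip {μ = a ∷ b ∷ w} {a′ ∷ b′ ∷ w′} (cons _ _ bel@(cons d e bel₂)) (cons _ _ bel′) ℓ | inj₂ b′≡b
    with ≤⇒+ (proper ℓ) | Fin.toℕ-injective b′≡b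
  ... | v , e | refl with rows-equal b w w′ bel₂ (λ r → contains ℓ (suc (suc r)))
        (λ r r′ q → link ℓ (suc r) (suc r′) (cong suc q) z≤n)
  ...   | refl = 0 , v , last (trans e (ℕ.+-suc v (toℕ a′))) bel′

  local⇒ribbon : ∀ {k m c c′} {μ κ : Rows k m} {i} → Below c μ → Below c′ κ → LocalRibbon i μ κ →
                 ∃[ u ] ∃[ v ] Ribbon i u v μ κ
  local⇒ribbon {μ = _ ∷ _} {i = zero} bel bel′ ℓ with local⇒strip bel bel′ ℓ
  ... | u , v , s = u , v , head s
  local⇒ribbon {μ = a ∷ μ} {a′ ∷ κ} {suc i} (cons _ _ bel) (cons _ _ bel′) ℓ
    with refl ← above ℓ zero (s≤s z≤n)
    with local⇒ribbon bel bel′ (record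
      { above    = λ r lt → above ℓ (suc r) (s≤s lt)
      ; proper   = proper ℓ
      ; contains = contains ℓ ∘ suc
      ; link     = λ r r′ q le → link ℓ (suc r) (suc r′) (cong suc q) (s≤s le)
      })
  ... | u , v , r = u , v , skip r

  -- Ribbons as sets of boxes compared with the local conditions.

  module _ {k m} (μ κ : Partition k m) where
    open Skew μ κ

    private
      M N : Fin k → ℕ
      M r = toℕ (part μ r)
      N r = toℕ (part κ r)

      M≤m : ∀ r → M r ≤ m
      M≤m r = Fin.toℕ≤pred[n] (part μ r)

      column : ∀ c r → c < M r → ∃[ j ] toℕ {m} j ≡ c
      column c r c<M = fromℕ< (ℕ.<-≤-trans c<M (M≤m r)) , Fin.toℕ-fromℕ< _

    adjacent-rows : ∀ i i′ (j j′ : ℕ) → i < i′ → ∣ i - i′ ∣ ℕ.+ ∣ j - j′ ∣ ≡ 1 → i′ ≡ suc i × j ≡ j′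
    adjacent-rows zero    (suc zero)    j j′ _ e = refl , ℕ.∣m-n∣≡0⇒m≡n (ℕ.suc-injective e)
    adjacent-rows zero    (suc (suc _)) j j′ _ ()
    adjacent-rows (suc i) (suc i′) j j′ (s≤s lt) e with adjacent-rows i i′ j j′ lt e
    ... | refl , j≡j′ = refl , j≡j′

    -- The path takes a vertical step from row r to row r′, and the column of this step lies in the
    -- skew shape in both rows.
    crossing : ∀ {a b r r′} → toℕ r′ ≡ suc (toℕ r) → Star Step a b → toℕ (proj₁ a) ≤ toℕ r → toℕ r < toℕ (proj₁ b) →
               N r < M r′
    crossing e ε a≤r r<b = contradiction a≤r (ℕ.<⇒≱ r<b)
    crossing {a = i , j} {r = r} {r′} e (_◅_ {j = i′ , j′} (inA , inC , adj) path) a≤r r<b with toℕ i′ ℕ.≤? toℕ r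
    ... | yes c≤r = crossing e path c≤r r<b
    ... | no  c≰r with adjacent-rows (toℕ i) (toℕ i′) (toℕ j) (toℕ j′) (ℕ.≤-<-trans a≤r (ℕ.≰⇒> c≰r)) adj
    ... | i′≡ , j≡j′ with Fin.toℕ-injective {i = i} {r} (ℕ.≤-antisym a≤r (s≤s⁻¹ (subst (toℕ r <_) i′≡ (ℕ.≰⇒> c≰r))))
    ... | refl with Fin.toℕ-injective {i = i′} {r′} (trans i′≡ (sym e))
    ... | refl = ℕ.≤-<-trans (proj₁ inA) (subst (_< M r′) (sym j≡j′) (proj₂ inC))

    -- For `link`, connectedness gives κ_r < μ_{r′} through `crossing`. If κ_r + 1 were still less
    -- than μ_{r′}, the columns κ_r and κ_r + 1 would contain a 2×2 square in rows r and r′.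
    isRibbon⇒local : ∀ {i} → IsRibbon → HeadInRow i → LocalRibbon i (proj₁ μ) (proj₁ κ)
    isRibbon⇒local {i} ribbon (j , (N≤j , j<M) , extreme) = record
      { above    = above′
      ; proper   = ℕ.≤-<-trans N≤j j<M
      ; contains = contained
      ; link     = link′
      }
      where
      open IsRibbon ribbon
      rowBox : ∀ {r} → N r < M r → ∃[ j ] InShape (r , j)
      rowBox {r} N<M with column (N r) r N<M
      ... | j , e = j , ℕ.≤-reflexive (sym e) , subst (_< M r) (sym e) N<M
      above′ : ∀ r → toℕ r < toℕ i → part κ r ≡ part μ r
      above′ r r<i with ℕ.m≤n⇒m<n∨m≡n (contained r)
      ... | inj₁ N<M = contradiction (proj₁ (extreme _ (proj₂ (rowBox N<M)))) (ℕ.<⇒≱ r<i)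
      ... | inj₂ N≡M = Fin.toℕ-injective N≡M
      link′ : ∀ r r′ → toℕ r′ ≡ suc (toℕ r) → toℕ i ≤ toℕ r → N r′ < M r′ → suc (N r) ≡ M r′
      link′ r r′ e i≤r N<M with ℕ.m≤n⇒m<n∨m≡n
        (crossing {r = r} {r′} e (connected _ _ (N≤j , j<M) (proj₂ (rowBox N<M))) i≤r (ℕ.≤-reflexive (sym e)))
      ... | inj₂ eq = eq
      ... | inj₁ lt with column (N r) r′ (ℕ.<⇒≤ lt) | column (suc (N r)) r′ lt
      ... | j₀ , e₀ | j₁ , e₁ = contradiction
          ((ℕ.≤-reflexive (sym e₀) , subst (_< M r) (sym e₀) (ℕ.<-trans ℕ.≤-refl lt₁)) ,
           (subst (N r ≤_) (sym e₁) (ℕ.n≤1+n _) , subst (_< M r) (sym e₁) lt₁) ,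
           (subst (N r′ ≤_) (sym e₀) N′≤N , subst (_< M r′) (sym e₀) (ℕ.<-trans ℕ.≤-refl lt)) ,
           (subst (N r′ ≤_) (sym e₁) (ℕ.m≤n⇒m≤1+n N′≤N) , subst (_< M r′) (sym e₁) lt))
          (no2×2 r r′ j₀ j₁ e (trans e₁ (cong suc (sym e₀))))
        where
        r≤r′ : toℕ r ≤ toℕ r′
        r≤r′ = subst (toℕ r ≤_) (sym e) (ℕ.n≤1+n _)
        lt₁ : suc (N r) < M r
        lt₁ = ℕ.<-≤-trans lt (part-antitone μ r≤r′)
        N′≤N : N r′ ≤ N r
        N′≤N = part-antitone κ r≤r′

    module _ {i} (ℓ : LocalRibbon i (proj₁ μ) (proj₁ κ)) where

      below-head : ∀ {r j} → InShape (r , j) → toℕ i ≤ toℕ r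
      below-head {r} (N≤j , j<M) = ℕ.≮⇒≥ λ r<i →
        ℕ.<⇒≢ (ℕ.≤-<-trans N≤j j<M) (cong toℕ (above ℓ r r<i))

      headBox : ∃[ j ] suc (toℕ j) ≡ M i × InShape (i , j)
      headBox with ≤⇒+ (proper ℓ)
      ... | d , e with column (d ℕ.+ N i) i (ℕ.≤-reflexive (sym (trans e (ℕ.+-suc d (N i)))))
      ... | j , e′ = j , eq , subst (N i ≤_) (sym e′) (ℕ.m≤n+m (N i) d) , ℕ.≤-reflexive eq
        where eq = trans (cong suc e′) (sym (trans e (ℕ.+-suc d (N i))))

      rightward : ∀ d {r j j′} → toℕ j′ ≡ d ℕ.+ toℕ j → InShape (r , j) → InShape (r , j′) → Star Step (r , j) (r , j′)
      rightward zero    {r} {j} {j′} e a b with refl ← Fin.toℕ-injective e = ε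
      rightward (suc d) {r} {j} {j′} e a b with column (suc (toℕ j)) r
        (ℕ.≤-<-trans (subst (suc (toℕ j) ≤_) (sym e) (s≤s (ℕ.m≤n+m _ d))) (proj₂ b))
      ... | j₁ , e₁ = (a , c , adj) ◅ rightward d (trans e (trans (sym (ℕ.+-suc d _)) (cong (d ℕ.+_) (sym e₁)))) c b
        where
        c : InShape (r , j₁)
        c = ℕ.≤-trans (proj₁ a) (subst (toℕ j ≤_) (sym e₁) (ℕ.n≤1+n _)) ,
            ℕ.≤-<-trans (subst₂ _≤_ (sym e₁) (sym e) (s≤s (ℕ.m≤n+m _ d))) (proj₂ b)
        adj : ∣ toℕ r - toℕ r ∣ ℕ.+ ∣ toℕ j - toℕ j₁ ∣ ≡ 1
        adj = cong₂ ℕ._+_ (ℕ.∣n-n∣≡0 (toℕ r)) (trans (cong (∣ toℕ j -_∣) (trans e₁ (ℕ.+-comm 1 _))) (ℕ.∣m-m+n∣≡n (toℕ j) 1))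

      -- Follow row r to its right end. By `link` this is the first column of the row above, so one
      -- can go up there and continue.
      toHead : ∀ d {r j j₀} → suc (toℕ j₀) ≡ M i → InShape (i , j₀) → toℕ r ≡ d ℕ.+ toℕ i → InShape (r , j) →
               Star Step (r , j) (i , j₀)
      toHead zero {r} {j} e₀ h e a with refl ← Fin.toℕ-injective e
        with ≤⇒+ (s≤s⁻¹ (subst (toℕ j <_) (sym e₀) (proj₂ a)))
      ... | d , e′ = rightward d e′ a h
      toHead (suc d) {r} {j} e₀ h e a with ℕ.<-trans (ℕ.≤-reflexive (sym e)) (Fin.toℕ<n r)
      ... | bound with link ℓ (fromℕ< bound) r (trans e (cong suc (sym (Fin.toℕ-fromℕ< bound))))
        (subst (toℕ i ≤_) (sym (Fin.toℕ-fromℕ< bound)) (ℕ.m≤n+m _ d)) (ℕ.≤-<-trans (proj₁ a) (proj₂ a))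
      ... | N₁≡M with column (N (fromℕ< bound)) r (ℕ.≤-reflexive N₁≡M)
      ... | j₁ , e₁ with ≤⇒+ (s≤s⁻¹ (subst (toℕ j <_) (sym (trans (cong suc e₁) N₁≡M)) (proj₂ a)))
      ... | d′ , e′ = rightward d′ e′ a c ◅◅ (c , b , adj) ◅ toHead d e₀ h (Fin.toℕ-fromℕ< bound) b
        where
        r₁ = fromℕ< bound
        r₁≤r : toℕ r₁ ≤ toℕ r
        r₁≤r = subst₂ _≤_ (sym (Fin.toℕ-fromℕ< bound)) (sym e) (ℕ.n≤1+n _)
        c : InShape (r , j₁)
        c = subst (N r ≤_) (sym e₁) (part-antitone κ r₁≤r) , ℕ.≤-reflexive (trans (cong suc e₁) N₁≡M)
        b : InShape (r₁ , j₁)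
        b = ℕ.≤-reflexive (sym e₁) , ℕ.<-≤-trans (proj₂ c) (part-antitone μ r₁≤r)
        adj : ∣ toℕ r - toℕ r₁ ∣ ℕ.+ ∣ toℕ j₁ - toℕ j₁ ∣ ≡ 1
        adj = cong₂ ℕ._+_
          (trans (ℕ.∣-∣-comm (toℕ r) (toℕ r₁))
            (trans (cong₂ ∣_-_∣ (Fin.toℕ-fromℕ< bound) (trans e (ℕ.+-comm 1 _))) (ℕ.∣m-m+n∣≡n (d ℕ.+ toℕ i) 1)))
          (ℕ.∣n-n∣≡0 (toℕ j₁))

      step-sym : ∀ {a b} → Step a b → Step b a
      step-sym {i , j} {i′ , j′} (a , b , adj) =
        b , a , trans (cong₂ ℕ._+_ (ℕ.∣-∣-comm (toℕ i′) (toℕ i)) (ℕ.∣-∣-comm (toℕ j′) (toℕ j))) adj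

      local⇒isRibbon : IsRibbon
      local⇒isRibbon = record
        { contained = contains ℓ
        ; nonempty  = _ , proj₂ (proj₂ headBox)
        ; connected = λ a b inA inB → path inA ◅◅ reverse⋆ step-sym (path inB)
        -- The upper left box gives κ_r ≤ j and the lower right one j + 1 < μ_{r′}, against κ_r + 1
        -- = μ_{r′}.
        ; no2×2     = λ r r′ j j′ er ej (a , _ , _ , d) →
            ℕ.<⇒≱ (subst₂ _<_ ej
              (sym (link ℓ r r′ er (below-head a) (ℕ.≤-<-trans (proj₁ d) (proj₂ d)))) (proj₂ d)) (s≤s (proj₁ a))
        }
        where
        path : ∀ {a} → InShape a → Star Step a (i , proj₁ headBox)
        path inA with ≤⇒+ (below-head inA)
        ... | d , e = toHead d (proj₁ (proj₂ headBox)) (proj₂ (proj₂ headBox)) e inA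

      local⇒head : HeadInRow i
      local⇒head with headBox
      ... | j , e , inH = j , inH , λ (r , j′) inB → below-head inB ,
        s≤s⁻¹ (subst (toℕ j′ <_) (sym e) (ℕ.<-≤-trans (proj₂ inB) (part-antitone μ (below-head inB))))

  -- Height and width of a ribbon.

  number : ∀ {k} → (Fin k → Bool) → ℕ
  number {zero}  g = 0
  number {suc k} g = (if g zero then suc else id) (number (g ∘ suc))

  -- Together with `does-⇔` this exchanges a decidable predicate for an equivalent one inside a
  -- count.
  number-cong : ∀ {k} {g h : Fin k → Bool} → (∀ i → g i ≡ h i) → number g ≡ number h
  number-cong {zero}  eq = refl
  number-cong {suc k} eq = cong₂ (λ b → if b then suc else id) (eq zero) (number-cong (eq ∘ suc))

  number-none : ∀ {k} {g : Fin k → Bool} → (∀ i → g i ≡ false) → number g ≡ 0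
  number-none {zero}  eq = refl
  number-none {suc k} eq rewrite eq zero = number-none (eq ∘ suc)

  length-filter-tabulate : ∀ {A : Set} {P : Pred A 0ℓ} (P? : Decidable P) {k} (f : Fin k → A) →
                           length (filter P? (tabulate f)) ≡ number (λ i → does (P? (f i)))
  length-filter-tabulate P? {zero}  f = refl
  length-filter-tabulate P? {suc k} f with does (P? (f zero))
  ... | true  = cong suc (length-filter-tabulate P? (f ∘ suc))
  ... | false = length-filter-tabulate P? (f ∘ suc)

  number-interval : ∀ {m} lo w → lo ℕ.+ w ≤ m →
    number {m} (λ j → does ((lo ℕ.≤? toℕ j) ×-dec (toℕ j ℕ.<? lo ℕ.+ w))) ≡ w
  number-interval {zero}  zero    zero    _    = refl
  number-interval {suc m} zero    zero    _    = number-none {suc m} λ j → dec-false ((0 ℕ.≤? toℕ j) ×-dec (toℕ j ℕ.<? 0)) λ ()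
  number-interval {suc m} zero    (suc w) le   = cong suc (trans
    (number-cong {m} λ j → does-⇔ (mk⇔ (λ (_ , lt) → z≤n , s≤s⁻¹ lt) (λ (_ , lt) → z≤n , s≤s lt)) ((0 ℕ.≤? suc (toℕ j)) ×-dec (suc (toℕ j) ℕ.<? suc w)) ((0 ℕ.≤? toℕ j) ×-dec (toℕ j ℕ.<? w)))
    (number-interval zero w (s≤s⁻¹ le)))
  number-interval {suc m} (suc lo) w      le   = trans
    (number-cong {m} λ j → does-⇔ (mk⇔ (λ (a , b) → s≤s⁻¹ a , s≤s⁻¹ b) (λ (a , b) → s≤s a , s≤s b))
      ((suc lo ℕ.≤? suc (toℕ j)) ×-dec (suc (toℕ j) ℕ.<? suc lo ℕ.+ w)) ((lo ℕ.≤? toℕ j) ×-dec (toℕ j ℕ.<? lo ℕ.+ w)))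
    (number-interval lo w (s≤s⁻¹ le))

  nonemptyRows : ∀ {k m} → Rows k m → Rows k m → ℕ
  nonemptyRows μ κ = number λ r → does (toℕ (lookup κ r) ℕ.<? toℕ (lookup μ r))

  strip-rows : ∀ {k m u v} {μ κ : Rows (suc k) m} → Strip u v μ κ → nonemptyRows μ κ ≡ suc u
  strip-rows s@(last {a = a} {a′} {w} _ _)
    rewrite dec-true (toℕ a′ ℕ.<? toℕ a) (proper (strip⇒local s)) =
    cong suc (number-none λ r → dec-false (toℕ (lookup w r) ℕ.<? _) (ℕ.<-irrefl refl))
  strip-rows s@(step {a = a} {a′} _ _ s′)
    rewrite dec-true (toℕ a′ ℕ.<? toℕ a) (proper (strip⇒local s)) = cong suc (strip-rows s′)

  ribbon-rows : ∀ {k m i u v} {μ κ : Rows k m} → Ribbon i u v μ κ → nonemptyRows μ κ ≡ suc u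
  ribbon-rows (head s) = strip-rows s
  ribbon-rows (skip {a = a} r) rewrite dec-false (toℕ a ℕ.<? toℕ a) (ℕ.<-irrefl refl) = ribbon-rows r

  Column : ∀ {k m} → Rows k m → Rows k m → ℕ → Set
  Column {k} μ κ j = ∃ λ (r : Fin k) → toℕ (lookup κ r) ≤ j × j < toℕ (lookup μ r)

  -- Consecutive rows of the ribbon share a column, so the nonempty columns form an interval without
  -- gaps, and counting them is `number-interval`.
  strip-columns : ∀ {k m u v a} {w : Rows k m} {κ} → Strip u v (a ∷ w) κ →
    ∃[ lo ] toℕ a ≡ lo ℕ.+ suc v × (∀ j → Column (a ∷ w) κ j ⇔ (lo ≤ j × j < toℕ a))
  strip-columns (last {v = v} {a} {a′} e bel) = toℕ a′ , trans e (ℕ.+-comm (suc v) (toℕ a′)) , λ j → mk⇔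
    (λ { (zero , c) → c ; (suc r , le , lt) → contradiction (ℕ.≤-<-trans le lt) (ℕ.<-irrefl refl) })
    (λ c → zero , c)
  strip-columns (step {v = v} {d} {a} {a′} {b} {b′} {w} {w′} e e′ s) with strip-columns s
  ... | lo , eq , cols = lo , width , λ j → mk⇔
    (λ { (zero , le , lt) → ℕ.≤-trans lo≤a′ le , lt
       ; (suc r , c) → proj₁ (Equivalence.to (cols j) (r , c)) , ℕ.<-≤-trans (proj₂ (Equivalence.to (cols j) (r , c))) b≤a })
    (λ (le , lt) → cover j le lt)
    where
    open ≡-Reasoning
    width : toℕ a ≡ lo ℕ.+ suc (d ℕ.+ v)
    width = begin
      toℕ a                   ≡⟨ e′ ⟩
      d ℕ.+ toℕ b             ≡⟨ cong (d ℕ.+_) eq ⟩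
      d ℕ.+ (lo ℕ.+ suc v)    ≡⟨ ℕ.+-assoc d lo (suc v) ⟨
      d ℕ.+ lo ℕ.+ suc v      ≡⟨ cong (ℕ._+ suc v) (ℕ.+-comm d lo) ⟩
      lo ℕ.+ d ℕ.+ suc v      ≡⟨ ℕ.+-assoc lo d (suc v) ⟩
      lo ℕ.+ (d ℕ.+ suc v)    ≡⟨ cong (lo ℕ.+_) (ℕ.+-suc d v) ⟩
      lo ℕ.+ suc (d ℕ.+ v)    ∎
    b≤a : toℕ b ≤ toℕ a
    b≤a = subst (toℕ b ≤_) (sym e′) (ℕ.m≤n+m (toℕ b) d)
    lo≤a′ : lo ≤ toℕ a′
    lo≤a′ = subst (lo ≤_) (sym (ℕ.suc-injective (trans e (trans eq (ℕ.+-suc lo v))))) (ℕ.m≤m+n lo v)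
    cover : ∀ j → lo ≤ j → j < toℕ a → Column (a ∷ b ∷ w) (a′ ∷ b′ ∷ w′) j
    cover j le lt with j ℕ.<? toℕ b
    ... | yes j<b with Equivalence.from (cols j) (le , j<b)
    ...   | r , c = suc r , c
    -- Row 0 of κ has length b - 1, so the columns from b on are met in row 0.
    cover j le lt | no j≮b = zero , ℕ.<⇒≤ (ℕ.<-≤-trans (ℕ.≤-reflexive e) (ℕ.≮⇒≥ j≮b)) , lt

  ribbon-columns : ∀ {k m i u v} {μ κ : Rows k m} → Ribbon i u v μ κ →
    ∃[ lo ] toℕ (lookup μ i) ≡ lo ℕ.+ suc v × (∀ j → Column μ κ j ⇔ (lo ≤ j × j < toℕ (lookup μ i)))
  ribbon-columns {μ = _ ∷ _} (head s) = strip-columns s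
  ribbon-columns (skip r) with ribbon-columns r
  ... | lo , eq , cols = lo , eq , λ j → mk⇔
    (λ { (zero , le , lt) → contradiction (ℕ.≤-<-trans le lt) (ℕ.<-irrefl refl) ; (suc r , c) → Equivalence.to (cols j) (r , c) })
    (λ c → let r , c′ = Equivalence.from (cols j) c in suc r , c′)

  module _ {k m} (μ κ : Partition k m) {i u v} (r : Ribbon i u v (proj₁ μ) (proj₁ κ)) where
    open Skew μ κ

    ribbon-ht : ht ≡ suc u
    ribbon-ht = trans (length-filter-tabulate (λ r → Fin.any? λ j → inShape? (r , j)) id) (trans
      (number-cong {k} λ r → does-⇔ (mk⇔
        (λ (j , le , lt) → ℕ.≤-<-trans le lt)
        (λ lt → let bound = ℕ.<-≤-trans lt (Fin.toℕ≤pred[n] (part μ r)) in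
          fromℕ< bound , ℕ.≤-reflexive (sym (Fin.toℕ-fromℕ< bound)) ,
          subst (_< toℕ (part μ r)) (sym (Fin.toℕ-fromℕ< bound)) lt))
        (Fin.any? λ j → inShape? (r , j)) (toℕ (part κ r) ℕ.<? toℕ (part μ r)))
      (ribbon-rows r))

    ribbon-wd : wd ≡ suc v
    ribbon-wd with ribbon-columns r
    ... | lo , eq , cols = trans (length-filter-tabulate (λ j → Fin.any? λ r → inShape? (r , j)) id) (trans
      (number-cong {m} λ j → does-⇔ (mk⇔
        (λ c → let le , lt = Equivalence.to (cols (toℕ j)) c in le , subst (toℕ j <_) eq lt)
        (λ (le , lt) → Equivalence.from (cols (toℕ j)) (le , subst (toℕ j <_) (sym eq) lt)))
        (Fin.any? λ i → inShape? (i , j)) ((lo ℕ.≤? toℕ j) ×-dec (toℕ j ℕ.<? lo ℕ.+ suc v)))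
      (number-interval lo (suc v) (subst (_≤ m) eq (Fin.toℕ≤pred[n] (part μ i)))))

open Shapes

-- The Young symmetrizer

C2-suc : ∀ m → suc m C 2 ≡ m ℕ.+ m C 2
C2-suc m = ≡.trans (≡.sym (nCk+nC[k+1]≡[n+1]C[k+1] m 1)) (≡.cong (ℕ._+ m C 2) (nC1≡n m))

-- The number of positions that remain for v(0) when v ∈ S_k × S_{m+1-k}, less one.
top : ℕ → ℕ → ℕ
top m zero    = m
top m (suc k) = k

maxLength : ℕ → ℕ → ℕ
maxLength m k = k C 2 ℕ.+ (m ∸ k) C 2

maxLength-suc : ∀ m k → maxLength (suc m) k ≡ top m k ℕ.+ maxLength m (pred k)
maxLength-suc m zero    = C2-suc m
maxLength-suc m (suc k) = ≡.trans (≡.cong (ℕ._+ (m ∸ k) C 2) (C2-suc k)) (ℕ.+-assoc k (k C 2) _)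

ℓ-remove : ∀ {m} (v : Permutation′ (suc m)) → ℓ v ≡ toℕ (v ⟨$⟩ʳ zero) ℕ.+ ℓ (remove zero v)
ℓ-remove {zero}  v with zero ← v ⟨$⟩ʳ zero = ≡.refl
ℓ-remove {suc m} v = length-word v

punchIn-< : ∀ {m k} (j : Fin (suc m)) (y : Fin m) → toℕ j ≤ k → toℕ (punchIn j y) < suc k ⇔ toℕ y < k
punchIn-< zero    y       j≤k       = mk⇔ s≤s⁻¹ s≤s
punchIn-< (suc j) zero    (s≤s j≤k) = mk⇔ (λ _ → s≤s z≤n) (λ _ → s≤s z≤n)
punchIn-< (suc j) (suc y) (s≤s j≤k) = mk⇔ (s≤s ∘ Equivalence.to (punchIn-< j y j≤k) ∘ s≤s⁻¹)
  (s≤s ∘ Equivalence.from (punchIn-< j y j≤k) ∘ s≤s⁻¹)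

-- Inserting a value from the first block shifts the boundary between the blocks of values by
-- exactly one, which is `punchIn-<`. For k = 0 both sides hold always, and `pred` leaves k at 0.
young-remove : ∀ {m} k (v : Permutation′ (suc m)) (ρ : Permutation′ m) →
               (∀ x → v ⟨$⟩ʳ suc x ≡ punchIn (v ⟨$⟩ʳ zero) (ρ ⟨$⟩ʳ x)) →
               Young k v ⇔ (toℕ (v ⟨$⟩ʳ zero) ≤ top m k × Young (pred k) ρ)
young-remove zero    v ρ h = mk⇔
  (λ _ → s≤s⁻¹ (Fin.toℕ<n (v ⟨$⟩ʳ zero)) , λ i → (λ ()) , λ ())
  (λ _ i → (λ ()) , λ ())
young-remove (suc k) v ρ h = mk⇔
  (λ y → let j≤k = s≤s⁻¹ (proj₁ (y zero) (s≤s z≤n)) in j≤k , λ x →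
    (λ x<k → Equivalence.to (punchIn-< _ _ j≤k) (≡.subst (λ z → toℕ z < suc k) (h x) (proj₁ (y (suc x)) (s≤s x<k)))) ,
    (λ ρx<k → s≤s⁻¹ (proj₂ (y (suc x)) (≡.subst (λ z → toℕ z < suc k) (≡.sym (h x)) (Equivalence.from (punchIn-< _ _ j≤k) ρx<k)))))
  (λ { (j≤k , y) zero → (λ _ → s≤s j≤k) , (λ _ → s≤s z≤n)
     ; (j≤k , y) (suc x) →
       (λ x<k → ≡.subst (λ z → toℕ z < suc k) (≡.sym (h x)) (Equivalence.from (punchIn-< _ _ j≤k) (proj₁ (y x) (s≤s⁻¹ x<k)))) ,
       (λ vx<k → s≤s (proj₂ (y x) (Equivalence.to (punchIn-< _ _ j≤k) (≡.subst (λ z → toℕ z < suc k) (h x) vx<k)))) })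

-- This keeps the truncated subtraction in the exponent of q exact, so that the exponent splits
-- along v(0) and the rest of v by `∸-interchange`.
ℓ-≤-maxLength : ∀ {m} k (v : Permutation′ m) → Young k v → ℓ v ≤ maxLength m k
ℓ-≤-maxLength {zero}  k v y = z≤n
ℓ-≤-maxLength {suc m} k v y with Equivalence.to (young-remove k v (remove zero v) (punchIn-permute v zero)) y
... | j≤ , y′ = ≡.subst₂ _≤_ (≡.sym (ℓ-remove v)) (≡.sym (maxLength-suc m k))
  (ℕ.+-mono-≤ j≤ (ℓ-≤-maxLength (pred k) (remove zero v) y′))

∸-interchange : ∀ {a b c d} → c ≤ a → d ≤ b → (a ℕ.+ b) ∸ (c ℕ.+ d) ≡ (a ∸ c) ℕ.+ (b ∸ d)
∸-interchange {a} {b} {c} {d} c≤a d≤b = begin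
  a ℕ.+ b ∸ (c ℕ.+ d)    ≡⟨ ℕ.∸-+-assoc (a ℕ.+ b) c d ⟨
  a ℕ.+ b ∸ c ∸ d        ≡⟨ ≡.cong (_∸ d) (ℕ.+-∸-comm b c≤a) ⟩
  a ∸ c ℕ.+ b ∸ d        ≡⟨ ℕ.+-∸-assoc (a ∸ c) d≤b ⟩
  a ∸ c ℕ.+ (b ∸ d)      ∎
  where open ≡.≡-Reasoning

-- Sums over lists, and the Young symmetrizer as a product of coset sums.

module Sums (R : Ring 0ℓ 0ℓ) where
  open Ring R hiding (zero)
  open BigOperators R

  sum-++ : ∀ xs ys → sum (xs ++ ys) ≈ sum xs + sum ys
  sum-++ []       ys = sym (+-identityˡ _)
  sum-++ (x ∷ xs) ys = trans (+-congˡ (sum-++ xs ys)) (sym (+-assoc _ _ _))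

  sum-cong : ∀ {A : Set} {f g : A → Carrier} → (∀ a → f a ≈ g a) → ∀ xs → sum (map f xs) ≈ sum (map g xs)
  sum-cong h []       = refl
  sum-cong h (a ∷ xs) = +-cong (h a) (sum-cong h xs)

  sum-*ˡ : ∀ {A : Set} c (f : A → Carrier) xs → sum (map (λ a → c * f a) xs) ≈ c * sum (map f xs)
  sum-*ˡ c f []       = sym (zeroʳ c)
  sum-*ˡ c f (a ∷ xs) = trans (+-congˡ (sum-*ˡ c f xs)) (sym (distribˡ _ _ _))

  sum-+ : ∀ {A : Set} (f g : A → Carrier) xs → sum (map (λ a → f a + g a) xs) ≈ sum (map f xs) + sum (map g xs)
  sum-+ f g []       = sym (+-identityˡ _)
  sum-+ f g (a ∷ xs) = trans (+-congˡ (sum-+ f g xs)) (interchange _ _ _ _)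
    where open Algebra.Properties.CommutativeSemigroup (CommutativeMonoid.commutativeSemigroup +-commutativeMonoid) using (interchange)

  product-++ : ∀ xs ys → product (xs ++ ys) ≈ product xs * product ys
  product-++ []       ys = sym (*-identityˡ _)
  product-++ (x ∷ xs) ys = trans (*-congˡ (product-++ xs ys)) (sym (*-assoc _ _ _))

  product-cong : ∀ {A : Set} {f g : A → Carrier} → (∀ a → f a ≈ g a) → ∀ xs → product (map f xs) ≈ product (map g xs)
  product-cong h []       = refl
  product-cong h (a ∷ xs) = *-cong (h a) (product-cong h xs)

  sum-zeros : ∀ N → sum (tabulate {n = N} λ _ → 0#) ≈ 0#
  sum-zeros zero    = refl
  sum-zeros (suc N) = trans (+-identityˡ _) (sum-zeros N)

  module _ {A B : Set} {P : Pred B 0ℓ} (P? : Decidable P) (f : B → Carrier) where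

    sum-filter-none : ∀ {g : A → B} → (∀ a → ¬ P (g a)) → ∀ xs → sum (map f (filter P? (map g xs))) ≈ 0#
    sum-filter-none {g} ¬P []       = refl
    sum-filter-none {g} ¬P (a ∷ xs) with P? (g a)
    ... | yes p = contradiction p (¬P a)
    ... | no  _ = sum-filter-none ¬P xs

    sum-filter-map : ∀ {Q : Pred A 0ℓ} (Q? : Decidable Q) {g : A → B} {f′ : A → Carrier} {c} → (∀ a → P (g a) ⇔ Q a) →
                     (∀ a → Q a → f (g a) ≈ c * f′ a) → ∀ xs →
                     sum (map f (filter P? (map g xs))) ≈ c * sum (map f′ (filter Q? xs))
    sum-filter-map Q? P⇔Q h [] = sym (zeroʳ _)
    sum-filter-map Q? {g} P⇔Q h (a ∷ xs) with P? (g a) | Q? a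
    ... | yes p | yes q = trans (+-cong (h a q) (sum-filter-map Q? P⇔Q h xs)) (sym (distribˡ _ _ _))
    ... | yes p | no ¬q = contradiction (Equivalence.to (P⇔Q a) p) ¬q
    ... | no ¬p | yes q = contradiction (Equivalence.from (P⇔Q a) q) ¬p
    ... | no  _ | no  _ = sum-filter-map Q? P⇔Q h xs

  sum-filter-product : ∀ {A B X : Set} {P : Pred X 0ℓ} (P? : Decidable P) (f : X → Carrier) (g : A → B → X) (c : A → Carrier) S bs →
    (∀ a → sum (map f (filter P? (map (g a) bs))) ≈ c a * S) → ∀ as →
    sum (map f (filter P? (cartesianProductWith g as bs))) ≈ sum (map c as) * S
  sum-filter-product P? f g c S bs h []       = sym (zeroˡ S)
  sum-filter-product P? f g c S bs h (a ∷ as) = begin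
    sum (map f (filter P? (map (g a) bs ++ cartesianProductWith g as bs)))
      ≡⟨ ≡.cong (sum ∘ map f) (filter-++ P? (map (g a) bs) _) ⟩
    sum (map f (filter P? (map (g a) bs) ++ filter P? (cartesianProductWith g as bs)))
      ≡⟨ ≡.cong sum (map-++ f (filter P? (map (g a) bs)) _) ⟩
    sum (map f (filter P? (map (g a) bs)) ++ map f (filter P? (cartesianProductWith g as bs)))
      ≈⟨ sum-++ (map f (filter P? (map (g a) bs))) _ ⟩
    sum (map f (filter P? (map (g a) bs))) + sum (map f (filter P? (cartesianProductWith g as bs)))
      ≈⟨ +-cong (h a) (sum-filter-product P? f g c S bs h as) ⟩
    c a * S + sum (map c as) * S
      ≈⟨ distribʳ _ _ _ ⟨
    (c a + sum (map c as)) * S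
      ∎
    where open import Relation.Binary.Reasoning.Setoid setoid

module YoungSum {R : Ring 0ℓ 0ℓ} {n : ℕ} (H : HeckeFamily R n) where
  open Ring R hiding (zero)
  open HeckeFamily H
  open HeckeWords H
  open Commutation R
  open BigOperators R
  open Sums R
  open Algebra.Properties.Semiring.Exp semiring using (_^_; ^-homo-*)
  open import Relation.Binary.Reasoning.Setoid setoid

  letters : ∀ {m} → ℕ → List (Fin m) → Carrier
  letters s is = product (map (λ i → t (toℕ i ℕ.+ s)) is)

  letters-++ : ∀ {m} s (is js : List (Fin m)) → letters s (is ++ js) ≈ letters s is * letters s js
  letters-++ s is js = trans (reflexive (≡.cong product (map-++ _ is js))) (product-++ (map _ is) _)

  letters-suc : ∀ {m} s (is : List (Fin m)) → letters s (map suc is) ≈ letters (suc s) is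
  letters-suc s []       = refl
  letters-suc s (i ∷ is) = *-cong (t-cong (≡.sym (ℕ.+-suc (toℕ i) s))) (letters-suc s is)

  letters-descending : ∀ {m} s (j : Fin (suc m)) → letters s (descending j) ≈ desc s (toℕ j)
  letters-descending         s zero    = refl
  letters-descending {suc m} s (suc j) = begin
    letters s (map suc (descending j) ++ [ zero ])        ≈⟨ letters-++ s (map suc (descending j)) [ zero ] ⟩
    letters s (map suc (descending j)) * (t s * 1#)       ≈⟨ *-cong (letters-suc s (descending j)) (*-identityʳ _) ⟩
    letters (suc s) (descending j) * t s                  ≈⟨ *-congʳ (letters-descending (suc s) j) ⟩
    desc (suc s) (toℕ j) * t s                            ≈⟨ desc-last s (toℕ j) ⟨
    desc s (suc (toℕ j))                                  ∎

  letters-word : ∀ {m} s (v : Permutation′ (suc m)) →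
                 letters s (word v) ≈ desc s (toℕ (v ⟨$⟩ʳ zero)) * letters (suc s) (word (remove zero v))
  letters-word {zero}  s v with zero ← v ⟨$⟩ʳ zero = sym (*-identityˡ 1#)
  letters-word {suc m} s v = trans (letters-++ s (descending (v ⟨$⟩ʳ zero)) _)
    (*-cong (letters-descending s (v ⟨$⟩ʳ zero)) (letters-suc s (word (remove zero v))))

  weight : ∀ {m} → ℕ → ℕ → Permutation′ m → Carrier
  weight {m} k s v = q ^ (maxLength m k ∸ ℓ v) * letters s (word v)

  q^-central : ∀ e {a} → a ⋈ q ^ e
  q^-central zero    = ⋈-1
  q^-central (suc e) = ⋈-* (sym (q-central _)) (q^-central e)

  weight-insert : ∀ {m} k s (j : Fin (suc m)) (ρ : Permutation′ m) → toℕ j ≤ top m k → Young (pred k) ρ →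
    weight k s (insert zero j ρ) ≈ (q ^ (top m k ∸ toℕ j) * desc s (toℕ j)) * weight (pred k) (suc s) ρ
  weight-insert {m} k s j ρ j≤ y = begin
    q ^ (maxLength (suc m) k ∸ ℓ v) * letters s (word v)
      ≈⟨ *-cong (reflexive (≡.cong (q ^_) exponent)) (trans (letters-word s v) (*-congˡ (reflexive (≡.cong (letters (suc s)) w≡)))) ⟩
    q ^ (a ℕ.+ b) * (desc s (toℕ j) * letters (suc s) (word ρ))
      ≈⟨ *-congʳ (^-homo-* q a b) ⟩
    (q ^ a * q ^ b) * (desc s (toℕ j) * letters (suc s) (word ρ))
      ≈⟨ *-assoc _ _ _ ⟩
    q ^ a * (q ^ b * (desc s (toℕ j) * letters (suc s) (word ρ)))
      ≈⟨ *-congˡ (pass (q^-central b) _) ⟨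
    q ^ a * (desc s (toℕ j) * (q ^ b * letters (suc s) (word ρ)))
      ≈⟨ *-assoc _ _ _ ⟨
    (q ^ a * desc s (toℕ j)) * (q ^ b * letters (suc s) (word ρ))
      ∎
    where
    v = insert zero j ρ
    a = top m k ∸ toℕ j
    b = maxLength m (pred k) ∸ ℓ ρ
    w≡ : word (remove zero v) ≡ word ρ
    w≡ = word-cong (remove-insert zero j ρ)
    exponent : maxLength (suc m) k ∸ ℓ v ≡ a ℕ.+ b
    exponent = ≡.trans (≡.cong₂ _∸_ (maxLength-suc m k) (≡.trans (ℓ-remove v) (≡.cong (λ w → toℕ j ℕ.+ length w) w≡)))
      (∸-interchange j≤ (ℓ-≤-maxLength (pred k) ρ y))

  -- `weighted` is built from its last term, while the sum over v(0) begins with v(0) = 0.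
  weighted-front : ∀ k a → q ^ suc k * a 0 + weighted k (a ∘ suc) ≈ weighted (suc k) a
  weighted-front zero    a = +-congʳ (*-congʳ (*-identityʳ q))
  weighted-front (suc k) a = begin
    q ^ suc (suc k) * a 0 + (q * weighted k (a ∘ suc) + a (suc (suc k)))  ≈⟨ +-assoc _ _ _ ⟨
    (q ^ suc (suc k) * a 0 + q * weighted k (a ∘ suc)) + a (suc (suc k))  ≈⟨ +-congʳ (trans (+-congʳ (*-assoc _ _ _)) (sym (distribˡ _ _ _))) ⟩
    q * (q ^ suc k * a 0 + weighted k (a ∘ suc)) + a (suc (suc k))        ≈⟨ +-congʳ (*-congˡ (weighted-front k a)) ⟩
    q * weighted (suc k) a + a (suc (suc k))                              ∎

  -- The list of permutations runs over all values of v(0); the cutoff removes those outside the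
  -- block of 0.
  term : ℕ → (ℕ → Carrier) → ℕ → Carrier
  term k a j = if does (j ℕ.<? suc k) then q ^ (k ∸ j) * a j else 0#

  term-≤ : ∀ {k} a {j} → j ≤ k → term k a j ≡ q ^ (k ∸ j) * a j
  term-≤ {k} a {j} j≤k = ≡.cong (λ b → if b then q ^ (k ∸ j) * a j else 0#) (dec-true (j ℕ.<? suc k) (s≤s j≤k))

  term-> : ∀ {k} a {j} → ¬ j ≤ k → term k a j ≡ 0#
  term-> {k} a {j} j≰k = ≡.cong (λ b → if b then q ^ (k ∸ j) * a j else 0#) (dec-false (j ℕ.<? suc k) (j≰k ∘ s≤s⁻¹))

  sum-term : ∀ {N} k a → k < N → sum (tabulate {n = N} (λ j → term k a (toℕ j))) ≈ weighted k a
  sum-term {suc N} zero    a k<N       = trans (+-cong (*-identityˡ _) (sum-zeros N)) (+-identityʳ _)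
  sum-term {suc N} (suc k) a (s≤s k<N) = trans (+-congˡ (sum-term k (a ∘ suc) k<N)) (weighted-front k a)

  youngSum : ∀ m k s → k ≤ m → sum (map (weight k s) (youngSubgroup m k)) ≈ symmetrizer m k s
  youngSum zero    zero s _   = trans (+-identityʳ _) (*-identityˡ _)
  youngSum (suc m) k    s k≤m = begin
    sum (map (weight k s) (youngSubgroup (suc m) k))
      ≈⟨ sum-filter-product (young? k) (weight k s) (insert zero) (λ j → term K (desc s) (toℕ j)) S (permutations m) inner (allFin (suc m)) ⟩
    sum (map (λ j → term K (desc s) (toℕ j)) (allFin (suc m))) * S
      ≡⟨ ≡.cong (λ xs → sum xs * S) (map-tabulate {n = suc m} id (λ j → term K (desc s) (toℕ j))) ⟩
    sum (tabulate (λ (j : Fin (suc m)) → term K (desc s) (toℕ j))) * S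
      ≈⟨ *-cong (sum-term K (desc s) (s≤s (K≤m k k≤m))) (youngSum m (pred k) (suc s) (ℕ.pred-mono-≤ k≤m)) ⟩
    coset s K * symmetrizer m (pred k) (suc s)
      ≡⟨ factors k ⟩
    symmetrizer (suc m) k s
      ∎
    where
    K = top m k
    S = sum (map (weight (pred k) (suc s)) (youngSubgroup m (pred k)))
    K≤m : ∀ k → k ≤ suc m → top m k ≤ m
    K≤m zero    _         = ℕ.≤-refl
    K≤m (suc k) (s≤s k≤m) = k≤m
    factors : ∀ k → coset s (top m k) * symmetrizer m (pred k) (suc s) ≡ symmetrizer (suc m) k s
    factors zero    = ≡.refl
    factors (suc k) = ≡.refl
    young⇔ : ∀ j ρ → Young k (insert zero j ρ) ⇔ (toℕ j ≤ K × Young (pred k) ρ)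
    young⇔ j ρ = young-remove k (insert zero j ρ) ρ (λ x → ≡.refl)
    inner : ∀ j → sum (map (weight k s) (filter (young? k) (map (insert zero j) (permutations m)))) ≈ term K (desc s) (toℕ j) * S
    inner j with toℕ j ℕ.≤? K
    ... | yes j≤K = trans (sum-filter-map (young? k) (weight k s) (young? (pred k))
      (λ ρ → mk⇔ (proj₂ ∘ Equivalence.to (young⇔ j ρ)) (λ y → Equivalence.from (young⇔ j ρ) (j≤K , y)))
      (λ ρ y → weight-insert k s j ρ j≤K y) (permutations m))
      (*-congʳ (sym (reflexive (term-≤ (desc s) j≤K))))
    ... | no  j≰K = trans (sum-filter-none (young? k) (weight k s)
      (λ ρ y → j≰K (proj₁ (Equivalence.to (young⇔ j ρ) y))) (permutations m))
      (sym (trans (*-congʳ (reflexive (term-> (desc s) j≰K))) (zeroˡ S)))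

-- The affine relations in terms of T̄

module Bar (R : Ring 0ℓ 0ℓ) (p q ħ : Ring.Carrier R)
           (p-central : ∀ a → Ring._≈_ R (Ring._*_ R p a) (Ring._*_ R a p))
           (q-central : ∀ a → Ring._≈_ R (Ring._*_ R q a) (Ring._*_ R a q))
           (ħ-central : ∀ a → Ring._≈_ R (Ring._*_ R ħ a) (Ring._*_ R a ħ)) where
  open Ring R
  open Commutation R
  open Algebra.Properties.Ring R
  open Algebra.Properties.CommutativeSemigroup (CommutativeMonoid.commutativeSemigroup +-commutativeMonoid)
    using (x∙yz≈y∙xz)
  open import Relation.Binary.Reasoning.Setoid setoid

  bar : Carrier → Carrier
  bar T = T + (p - q)

  ⋈--‿ : ∀ {a b} → a ⋈ b → a ⋈ - b
  ⋈--‿ {a} {b} ab = trans (sym (-‿distribʳ-* a b)) (trans (-‿cong ab) (-‿distribˡ-* b a))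

  p-q-central : ∀ a → a ⋈ p - q
  p-q-central a = ⋈-+ (sym (p-central a)) (⋈--‿ (sym (q-central a)))

  bar-⋈ : ∀ {T a} → T ⋈ a → bar T ⋈ a
  bar-⋈ Ta = sym (⋈-+ (sym Ta) (p-q-central _))

  bar+q : ∀ T → bar T + q ≈ T + p
  bar+q T = trans (+-assoc T _ q) (+-congˡ (trans (+-assoc p _ q) (trans (+-congˡ (-‿inverseˡ q)) (+-identityʳ p))))

  bar-p : ∀ T → bar T ≈ (T - q) + p
  bar-p T = trans (+-congˡ (+-comm p _)) (sym (+-assoc T _ p))

  -- T̄ + q = T + p and T̄ - p = T - q, so (T̄ + q)(T̄ - p) is the same product.
  bar-quadratic : ∀ {T} → (T + p) * (T - q) ≈ 0# → bar T * bar T + q * bar T ≈ p * bar T + p * q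
  bar-quadratic {T} h = begin
    bar T * bar T + q * bar T              ≈⟨ distribʳ _ _ _ ⟨
    (bar T + q) * bar T                    ≈⟨ *-cong (bar+q T) (bar-p T) ⟩
    (T + p) * ((T - q) + p)                ≈⟨ distribˡ _ _ _ ⟩
    (T + p) * (T - q) + (T + p) * p        ≈⟨ +-cong h (*-congʳ (sym (bar+q T))) ⟩
    0# + (bar T + q) * p                   ≈⟨ +-identityˡ _ ⟩
    (bar T + q) * p                        ≈⟨ p-central _ ⟨
    p * (bar T + q)                        ≈⟨ distribˡ _ _ _ ⟩
    p * bar T + p * q                      ∎

  bar-inverse : ∀ {T} → (T + p) * (T - q) ≈ 0# → T * bar T ≈ p * q
  bar-inverse {T} h = +-cancelʳ ((p - q) * bar T + q * bar T) _ _ (begin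
    T * bar T + ((p - q) * bar T + q * bar T)  ≈⟨ +-assoc _ _ _ ⟨
    T * bar T + (p - q) * bar T + q * bar T    ≈⟨ +-congʳ (distribʳ _ _ _) ⟨
    bar T * bar T + q * bar T                  ≈⟨ bar-quadratic h ⟩
    p * bar T + p * q                          ≈⟨ +-comm _ _ ⟩
    p * q + p * bar T                          ≈⟨ +-congˡ (*-congʳ (trans (+-assoc p _ q) (trans (+-congˡ (-‿inverseˡ q)) (+-identityʳ p)))) ⟨
    p * q + ((p - q) + q) * bar T              ≈⟨ +-congˡ (distribʳ _ _ _) ⟩
    p * q + ((p - q) * bar T + q * bar T)      ∎)

  -- T * T̄ = pq would give the braid relation for T̄ by inversion if pq were invertible. The
  -- product is expanded instead: what accompanies TST is symmetric in S and T up to the order of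
  -- the summands.
  bar-triple : ∀ {S T} → T * bar T ≈ p * q →
    bar T * bar S * bar T ≈
    T * S * T + (p - q) * (T * S + (S * T + (p * q + ((p - q) * S + ((p - q) * T + (p - q) * (p - q))))))
  bar-triple {S} {T} inv = begin
    (T + D) * (S + D) * (T + D)
      ≈⟨ *-congʳ (trans (distribʳ _ _ _) (+-congʳ (trans (distribˡ _ _ _) (+-congˡ (sym (D⋈ T)))))) ⟩
    ((T * S + D * T) + D * (S + D)) * (T + D)
      ≈⟨ trans (distribʳ _ _ _) (+-congʳ (distribʳ _ _ _)) ⟩
    (T * S * (T + D) + D * T * (T + D)) + D * (S + D) * (T + D)
      ≈⟨ +-cong (+-cong (trans (distribˡ _ _ _) (+-congˡ (sym (D⋈ _)))) (trans (*-assoc _ _ _) (*-congˡ inv)))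
           (trans (*-assoc _ _ _) (*-congˡ expand)) ⟩
    ((T * S * T + D * (T * S)) + D * (p * q)) + D * (S * T + (D * S + (D * T + D * D)))
      ≈⟨ trans (+-congʳ (+-assoc _ _ _)) (+-assoc _ _ _) ⟩
    T * S * T + ((D * (T * S) + D * (p * q)) + D * (S * T + (D * S + (D * T + D * D))))
      ≈⟨ +-congˡ (trans (+-congʳ (sym (distribˡ _ _ _))) (sym (distribˡ _ _ _))) ⟩
    T * S * T + D * ((T * S + p * q) + (S * T + (D * S + (D * T + D * D))))
      ≈⟨ +-congˡ (*-congˡ (trans (+-assoc _ _ _) (+-congˡ (x∙yz≈y∙xz _ _ _)))) ⟩
    T * S * T + D * (T * S + (S * T + (p * q + (D * S + (D * T + D * D)))))
      ∎
    where
    D = p - q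
    D⋈ : ∀ a → D * a ≈ a * D
    D⋈ a = sym (p-q-central a)
    expand : (S + D) * (T + D) ≈ S * T + (D * S + (D * T + D * D))
    expand = trans (distribʳ _ _ _)
      (trans (+-cong (trans (distribˡ _ _ _) (+-congˡ (sym (D⋈ S)))) (distribˡ _ _ _)) (+-assoc _ _ _))

  bar-braid : ∀ {S T} → T * bar T ≈ p * q → S * bar S ≈ p * q → T * S * T ≈ S * T * S →
              bar T * bar S * bar T ≈ bar S * bar T * bar S
  bar-braid invT invS h = trans (bar-triple invT) (trans
    (+-cong h (*-congˡ (trans (x∙yz≈y∙xz _ _ _) (+-congˡ (+-congˡ (+-congˡ (x∙yz≈y∙xz _ _ _)))))))
    (sym (bar-triple invS)))

  δ : Carrier → Carrier
  δ y = ħ - (p - q) * y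

  δ-+ : ∀ y → δ y + (p - q) * y ≈ ħ
  δ-+ y = trans (+-assoc _ _ _) (trans (+-congˡ (-‿inverseˡ _)) (+-identityʳ ħ))

  δ-⋈ : ∀ {a y} → a ⋈ y → a ⋈ δ y
  δ-⋈ ay = ⋈-+ (sym (ħ-central _)) (⋈--‿ (⋈-* (p-q-central _) ay))

  module _ {T y z} (lo : T * y ≈ z * T + δ y) where

    -- The added (p-q)y completes δ y to ħ, and ħ is split again as (p-q)z + δ z, whose first part
    -- turns z T into z T̄.
    bar-lo : bar T * y ≈ z * bar T + δ z
    bar-lo = begin
      bar T * y                          ≈⟨ distribʳ _ _ _ ⟩
      T * y + (p - q) * y                ≈⟨ +-congʳ lo ⟩
      z * T + δ y + (p - q) * y          ≈⟨ trans (+-assoc _ _ _) (+-congˡ (δ-+ y)) ⟩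
      z * T + ħ                          ≈⟨ +-congˡ (trans (+-comm _ _) (δ-+ z)) ⟨
      z * T + ((p - q) * z + δ z)        ≈⟨ +-assoc _ _ _ ⟨
      z * T + (p - q) * z + δ z          ≈⟨ +-congʳ (+-congˡ (p-q-central z)) ⟨
      z * T + z * (p - q) + δ z          ≈⟨ +-congʳ (distribˡ _ _ _) ⟨
      z * bar T + δ z                    ∎

    -- This expresses that ħ is central: write it as δ y + (p-q)y to the right of T̄ and as δ z +
    -- (p-q)z to the left, and move the linear parts by `bar-lo`.
    bar-δ : bar T * δ y + p * δ z ≈ δ z * bar T + q * δ z
    bar-δ = +-cancelʳ (bar T * ((p - q) * y)) _ _ (begin
      (bar T * δ y + p * δ z) + bar T * ((p - q) * y)
        ≈⟨ trans (+-assoc _ _ _) (trans (+-congˡ (+-comm _ _)) (sym (+-assoc _ _ _))) ⟩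
      (bar T * δ y + bar T * ((p - q) * y)) + p * δ z
        ≈⟨ +-congʳ (trans (sym (distribˡ _ _ _)) (trans (*-congˡ (δ-+ y)) (sym (ħ-central _)))) ⟩
      ħ * bar T + p * δ z
        ≈⟨ +-cong (*-congʳ (sym (δ-+ z))) (*-congʳ (trans (sym p-split) (+-comm _ _))) ⟩
      (δ z + (p - q) * z) * bar T + (q + (p - q)) * δ z
        ≈⟨ +-cong (distribʳ _ _ _) (distribʳ _ _ _) ⟩
      (δ z * bar T + (p - q) * z * bar T) + (q * δ z + (p - q) * δ z)
        ≈⟨ interchange _ _ _ _ ⟩
      (δ z * bar T + q * δ z) + ((p - q) * z * bar T + (p - q) * δ z)
        ≈⟨ +-congˡ (trans (+-congʳ (*-assoc _ _ _)) (sym (distribˡ _ _ _))) ⟩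
      (δ z * bar T + q * δ z) + (p - q) * (z * bar T + δ z)
        ≈⟨ +-congˡ (trans (*-congˡ (sym bar-lo)) (sym (pass (p-q-central _) y))) ⟩
      (δ z * bar T + q * δ z) + bar T * ((p - q) * y)
        ∎)
      where
      open Algebra.Properties.CommutativeSemigroup (CommutativeMonoid.commutativeSemigroup +-commutativeMonoid)
        using (interchange)
      p-split : (p - q) + q ≈ p
      p-split = trans (+-assoc p _ q) (trans (+-congˡ (-‿inverseˡ q)) (+-identityʳ p))

    module _ (hi : T * z ≈ y * T - δ y) where

      sum-⋈ : T ⋈ y + z
      sum-⋈ = begin
        T * (y + z)                          ≈⟨ trans (distribˡ _ _ _) (+-cong lo hi) ⟩
        (z * T + δ y) + (y * T - δ y)        ≈⟨ trans (+-assoc _ _ _) (+-congˡ (x∙yz≈y∙xz _ _ _)) ⟩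
        z * T + (y * T + (δ y - δ y))        ≈⟨ +-congˡ (trans (+-congˡ (-‿inverseʳ _)) (+-identityʳ _)) ⟩
        z * T + y * T                        ≈⟨ trans (+-comm _ _) (sym (distribʳ _ _ _)) ⟩
        (y + z) * T                          ∎

      product-⋈ : y ⋈ z → T ⋈ y * z
      product-⋈ yz = begin
        T * (y * z)                          ≈⟨ trans (sym (*-assoc _ _ _)) (trans (*-congʳ lo) (distribʳ _ _ _)) ⟩
        z * T * z + δ y * z                  ≈⟨ +-congʳ (trans (*-assoc _ _ _) (trans (*-congˡ hi) (distribˡ _ _ _))) ⟩
        (z * (y * T) + z * - δ y) + δ y * z  ≈⟨ +-assoc _ _ _ ⟩
        z * (y * T) + (z * - δ y + δ y * z)  ≈⟨ +-congˡ (+-cong (sym (-‿distribʳ-* z _)) (sym (δ-⋈ (sym yz)))) ⟩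
        z * (y * T) + (- (z * δ y) + z * δ y) ≈⟨ trans (+-congˡ (-‿inverseˡ _)) (+-identityʳ _) ⟩
        z * (y * T)                          ≈⟨ *-assoc _ _ _ ⟨
        z * y * T                            ≈⟨ *-congʳ yz ⟨
        y * z * T                            ∎

-- The affine Hecke algebra with generators indexed by all natural numbers.

extend : ∀ {X : Set} {m} → (Fin m → X) → X → ℕ → X
extend {m = zero}  f d i       = d
extend {m = suc m} f d zero    = f zero
extend {m = suc m} f d (suc i) = extend (f ∘ suc) d i

extend-toℕ : ∀ {X : Set} {m} (f : Fin m → X) d i → extend f d (toℕ i) ≡ f i
extend-toℕ f d zero    = ≡.refl
extend-toℕ f d (suc i) = extend-toℕ (f ∘ suc) d i

extend-elim : ∀ {X : Set} {m} (P : ℕ → X → Set) {f : Fin m → X} {d} → (∀ i → P (toℕ i) (f i)) → (∀ i → P i d) →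
              ∀ i → P i (extend f d i)
extend-elim {m = zero}  P h h′ i       = h′ i
extend-elim {m = suc m} P h h′ zero    = h zero
extend-elim {m = suc m} P h h′ (suc i) = extend-elim (P ∘ suc) (h ∘ suc) (h′ ∘ suc) i

toℕ-lo : ∀ {n} (i : Fin (pred n)) → toℕ (lo {n} i) ≡ toℕ i
toℕ-lo {suc n} i = Fin.toℕ-inject₁ i

toℕ-hi : ∀ {n} (i : Fin (pred n)) → toℕ (hi {n} i) ≡ suc (toℕ i)
toℕ-hi {suc n} i = ≡.refl

generator : ∀ {n} i → suc i < n → ∃[ f ] toℕ {pred n} f ≡ i
generator {suc n} i i<n = Fin.fromℕ< (s≤s⁻¹ i<n) , Fin.toℕ-fromℕ< (s≤s⁻¹ i<n)

module PresentedScalars (K : CommutativeRing 0ℓ 0ℓ) (G : Set) (_∼_ : Rel (Expr (CommutativeRing.Carrier K) G) 0ℓ) where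
  private module K = CommutativeRing K
  open Presented K G _∼_
  open Ring ring
  open Algebra.Properties.Group +-group using (inverseˡ-unique)

  con-- : ∀ a b → con (a K.- b) ≈ con a - con b
  con-- a b = trans (con-+ a (K.- b)) (+-congˡ (inverseˡ-unique _ _
    (trans (sym (con-+ _ _)) (con-cong (K.-‿inverseˡ b)))))

module HeckeAlgebra (K : CommutativeRing 0ℓ 0ℓ) (p q ħ : CommutativeRing.Carrier K) (n : ℕ) where
  private module K = CommutativeRing K
  open Hecke K p q ħ n using (Relation; T; x; ring; quadratic; braid; far; xx; Tx-far; Tx-lo; Tx-hi)
  open Presented K (HeckeGenerator n) Relation using (rel; con-central)
  open PresentedScalars K (HeckeGenerator n) Relation using (con--)
  open Ring ring
  open Commutation ring
  open Algebra.Properties.Ring ring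
  open Bar ring (con p) (con q) (con ħ) (con-central p) (con-central q) (con-central ħ)

  δ-con : ∀ j → Hecke.δ K p q ħ n j ≈ δ (x j)
  δ-con j = +-congˡ (-‿cong (*-congʳ (con-- p q)))

  -- The values 1# and 0# past the end commute with everything, so the relations between distant
  -- generators hold without any bound on the indices.
  t x′ : ℕ → Carrier
  t  = extend (λ i → bar (T i)) 1#
  x′ = extend x 0#

  t-toℕ : ∀ i → t (toℕ i) ≡ bar (T i)
  t-toℕ = extend-toℕ (λ i → bar (T i)) 1#

  x-lo : ∀ i → x′ (toℕ i) ≡ x (lo i)
  x-lo i = ≡.trans (≡.cong x′ (≡.sym (toℕ-lo i))) (extend-toℕ x 0# (lo i))

  x-hi : ∀ i → x′ (suc (toℕ i)) ≡ x (hi i)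
  x-hi i = ≡.trans (≡.cong x′ (≡.sym (toℕ-hi i))) (extend-toℕ x 0# (hi i))

  T-lo : ∀ i → T i * x (lo i) ≈ x (hi i) * T i + δ (x (lo i))
  T-lo i = trans (rel (Tx-lo i)) (+-congˡ (δ-con (lo i)))

  T-hi : ∀ i → T i * x (hi i) ≈ x (lo i) * T i - δ (x (lo i))
  T-hi i = trans (rel (Tx-hi i)) (+-congˡ (-‿cong (δ-con (lo i))))

  bar-inv : ∀ i → T i * bar (T i) ≈ con p * con q
  bar-inv i = bar-inverse (rel (quadratic i))

  heckeFamily : HeckeFamily ring n
  heckeFamily = record
    { p = con p
    ; q = con q
    ; p-central = con-central p
    ; q-central = con-central q
    ; t = t
    ; quadratic = quadratic′
    ; braid = braid′
    ; far = extend-elim (λ i a → ∀ j → suc i < j → a * t j ≈ t j * a)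
        (λ i → extend-elim (λ j b → suc (toℕ i) < j → bar (T i) ⋈ b)
          (λ j i<j → bar-⋈ (sym (bar-⋈ (sym (rel (far i j i<j)))))) (λ _ _ → ⋈-1))
        (λ i j _ → sym ⋈-1)
    }
    where
    quadratic′ : ∀ i → suc i < n → t i * t i + con q * t i ≈ con p * t i + con p * con q
    quadratic′ i i<n with generator i i<n
    ... | f , ≡.refl rewrite t-toℕ f = bar-quadratic (rel (quadratic f))
    braid′ : ∀ i → suc (suc i) < n → t i * t (suc i) * t i ≈ t (suc i) * t i * t (suc i)
    braid′ i i<n with generator i (ℕ.<⇒≤ i<n) | generator (suc i) i<n
    ... | f , ≡.refl | g , g≡ rewrite ≡.sym g≡ | t-toℕ f | t-toℕ g = bar-braid (bar-inv f) (bar-inv g) (rel (braid f g g≡))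

  affineHeckeFamily : AffineHeckeFamily ring n
  affineHeckeFamily = record
    { finite = heckeFamily
    ; x = x′
    ; δ = λ j → δ (x′ j)
    ; t-x-far = t-x-far _ _
    ; t-δ-far = λ j≢i j≢si → δ-⋈ (t-x-far _ _ j≢i j≢si)
    ; t-x = t-x
    ; t-δ = t-δ
    ; t-x+x = t-x+x
    ; t-x*x = t-x*x
    }
    where
    t-x-far : ∀ i j → j ≢ i → j ≢ suc i → t i ⋈ x′ j
    t-x-far = extend-elim (λ i a → ∀ j → j ≢ i → j ≢ suc i → a ⋈ x′ j)
      (λ i → extend-elim (λ j b → j ≢ toℕ i → j ≢ suc (toℕ i) → bar (T i) ⋈ b)
        (λ j j≢i j≢si → bar-⋈ (rel (Tx-far i j
          (λ e → j≢i (≡.trans (≡.cong toℕ e) (toℕ-lo i))) (λ e → j≢si (≡.trans (≡.cong toℕ e) (toℕ-hi i))))))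
        (λ _ _ _ → ⋈-0))
      (λ _ _ _ _ → sym ⋈-1)
    t-x : ∀ i → suc i < n → t i * x′ i ≈ x′ (suc i) * t i + δ (x′ (suc i))
    t-x i i<n with generator i i<n
    ... | f , ≡.refl rewrite t-toℕ f | x-lo f | x-hi f = bar-lo (T-lo f)
    t-δ : ∀ i → suc i < n → t i * δ (x′ i) + con p * δ (x′ (suc i)) ≈ δ (x′ (suc i)) * t i + con q * δ (x′ (suc i))
    t-δ i i<n with generator i i<n
    ... | f , ≡.refl rewrite t-toℕ f | x-lo f | x-hi f = bar-δ (T-lo f)
    t-x+x : ∀ i → suc i < n → t i ⋈ x′ i + x′ (suc i)
    t-x+x i i<n with generator i i<n
    ... | f , ≡.refl rewrite t-toℕ f | x-lo f | x-hi f = bar-⋈ (sum-⋈ (T-lo f) (T-hi f))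
    t-x*x : ∀ i → suc i < n → t i ⋈ x′ i * x′ (suc i)
    t-x*x i i<n with generator i i<n
    ... | f , ≡.refl rewrite t-toℕ f | x-lo f | x-hi f = bar-⋈ (product-⋈ (T-lo f) (T-hi f) (rel (xx (lo f) (hi f))))

-- From formal combinations to the pass

-- Ribbons below a shape and flips of its bits are linked by a one-to-one relation and not by a
-- function, so sums are reindexed along a relation.
module Matching {A B : Set} (_~_ : A → B → Set)
  (injectiveˡ : ∀ {a b b′} → a ~ b → a ~ b′ → b ≡ b′) (injectiveʳ : ∀ {a a′ b} → a ~ b → a′ ~ b → a ≡ a′) where

  data Matched : List A → List B → Set where
    []  : Matched [] []
    _∷_ : ∀ {a b as bs} → a ~ b → Matched as bs → Matched (a ∷ as) (b ∷ bs)

  match : ∀ {as} → (∀ {a} → a ∈ as → ∃ (a ~_)) → ∃ (Matched as)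
  match {[]}     f = [] , []
  match {a ∷ as} f = _ , proj₂ (f (here ≡.refl)) ∷ proj₂ (match (f ∘ there))

  matchedʳ : ∀ {as bs b} → Matched as bs → b ∈ bs → ∃[ a ] a ∈ as × a ~ b
  matchedʳ (r ∷ m) (here ≡.refl) = _ , here ≡.refl , r
  matchedʳ (r ∷ m) (there b∈) with matchedʳ m b∈
  ... | a , a∈ , r′ = a , there a∈ , r′

  matchedˡ : ∀ {as bs a} → Matched as bs → a ∈ as → ∃[ b ] b ∈ bs × a ~ b
  matchedˡ (r ∷ m) (here ≡.refl) = _ , here ≡.refl , r
  matchedˡ (r ∷ m) (there a∈) with matchedˡ m a∈
  ... | b , b∈ , r′ = b , there b∈ , r′

  matched-unique : ∀ {as bs} → Matched as bs → Unique as → Unique bs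
  matched-unique []      []         = []
  matched-unique (r ∷ m) (a∉ ∷ as!) = All.tabulate (λ b∈ b≡ → fresh b∈ b≡) ∷ matched-unique m as!
    where
    fresh : ∀ {b′} → b′ ∈ _ → _ ≡ b′ → _
    fresh b∈ ≡.refl with matchedʳ m b∈
    ... | a′ , a′∈ , r′ = All.lookup a∉ a′∈ (injectiveʳ r r′)

  module _ (R : Ring 0ℓ 0ℓ) where
    open Ring R
    open BigOperators R
    open Sums R

    sum-↭ : ∀ {g : B → Carrier} {bs bs′} → bs ↭ bs′ → sum (map g bs) ≈ sum (map g bs′)
    sum-↭ _↭_.refl         = refl
    sum-↭ (_↭_.prep b p)   = +-congˡ (sum-↭ p)
    sum-↭ (_↭_.swap b b′ p) = trans (x∙yz≈y∙xz _ _ _) (+-congˡ (+-congˡ (sum-↭ p)))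
      where open Algebra.Properties.CommutativeSemigroup (CommutativeMonoid.commutativeSemigroup +-commutativeMonoid) using (x∙yz≈y∙xz)
    sum-↭ (_↭_.trans p p′) = trans (sum-↭ p) (sum-↭ p′)

    sum-matched : ∀ {f : A → Carrier} {g : B → Carrier} → (∀ {a b} → a ~ b → f a ≈ g b) →
                  ∀ {as bs} → Matched as bs → sum (map f as) ≈ sum (map g bs)
    sum-matched h []      = refl
    sum-matched h (r ∷ m) = +-cong (h r) (sum-matched h m)

    -- The partners of as form a list without repetitions that has the same members as bs, hence a
    -- rearrangement of bs.
    sum-match : ∀ {f : A → Carrier} {g : B → Carrier} {as bs} → Unique as → Unique bs →
                (∀ {a} → a ∈ as → ∃[ b ] b ∈ bs × a ~ b) → (∀ {b} → b ∈ bs → ∃[ a ] a ∈ as × a ~ b) →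
                (∀ {a b} → a ~ b → f a ≈ g b) → sum (map f as) ≈ sum (map g bs)
    sum-match {bs = bs} as! bs! to from h with match (λ a∈ → let b , _ , r = to a∈ in b , r)
    ... | bs′ , m = trans (sum-matched h m) (sum-↭ (∼bag⇒↭ (unique∧set⇒bag (matched-unique m as!) bs! (mk⇔ there′ back))))
      where
      there′ : ∀ {b} → b ∈ bs′ → b ∈ bs
      there′ b∈ with matchedʳ m b∈
      ... | a , a∈ , r with to a∈
      ... | b′ , b′∈ , r′ = ≡.subst (_∈ bs) (injectiveˡ r′ r) b′∈
      back : ∀ {b} → b ∈ bs → b ∈ bs′
      back b∈ with from b∈
      ... | a , a∈ , r with matchedˡ m a∈
      ... | b′ , b′∈ , r′ = ≡.subst (_∈ bs′) (injectiveˡ r′ r) b′∈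

flipList : ∀ {l} → Vec Bool l → List (ℕ × ℕ × Vec Bool l)
flipList []           = []
flipList (false ∷ bs) = (0 , 0 , true ∷ bs) ∷ map (λ (u , v , as) → u , suc v , false ∷ as) (flipList bs)
flipList (true  ∷ bs) = map (λ (u , v , as) → suc u , v , true ∷ as) (flipList bs)

∈-flipList⁻ : ∀ {l} {bs : Vec Bool l} {u v as} → (u , v , as) ∈ flipList bs → Flip u v (toList bs) (toList as)
∈-flipList⁻ {bs = false ∷ bs} (here ≡.refl) = here
∈-flipList⁻ {bs = false ∷ bs} (there x∈) with ∈-map⁻ _ x∈
... | _ , y∈ , ≡.refl = skip₀ (∈-flipList⁻ y∈)
∈-flipList⁻ {bs = true ∷ bs} x∈ with ∈-map⁻ _ x∈
... | _ , y∈ , ≡.refl = skip₁ (∈-flipList⁻ y∈)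

∈-flipList⁺ : ∀ {l} {bs : Vec Bool l} {u v as} → Flip u v (toList bs) as → ∃[ as′ ] toList as′ ≡ as × (u , v , as′) ∈ flipList bs
∈-flipList⁺ {bs = false ∷ bs} here = true ∷ bs , ≡.refl , here ≡.refl
∈-flipList⁺ {bs = false ∷ bs} (skip₀ f) with ∈-flipList⁺ f
... | as′ , ≡.refl , y∈ = false ∷ as′ , ≡.refl , there (∈-map⁺ _ y∈)
∈-flipList⁺ {bs = true ∷ bs} (skip₁ f) with ∈-flipList⁺ f
... | as′ , ≡.refl , y∈ = true ∷ as′ , ≡.refl , ∈-map⁺ _ y∈

flipList-unique : ∀ {l} (bs : Vec Bool l) → Unique (flipList bs)
flipList-unique []           = []
flipList-unique (false ∷ bs) = All.tabulate (λ x∈ e → absurd (∈-map⁻ _ x∈) e) ∷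
  Unique.map⁺ (λ { ≡.refl → ≡.refl }) (flipList-unique bs)
  where
  absurd : ∀ {x} → ∃ (λ y → y ∈ flipList bs × x ≡ (proj₁ y , suc (proj₁ (proj₂ y)) , false ∷ proj₂ (proj₂ y))) →
           ¬ ((0 , 0 , true ∷ bs) ≡ x)
  absurd (_ , _ , ≡.refl) ()
flipList-unique (true  ∷ bs) = Unique.map⁺ (λ { ≡.refl → ≡.refl }) (flipList-unique bs)

ones-toList : ∀ {l} (bs : Vec Bool l) → listOnes (toList bs) ≡ ones bs
ones-toList []           = ≡.refl
ones-toList (false ∷ bs) = ones-toList bs
ones-toList (true  ∷ bs) = ≡.cong suc (ones-toList bs)

zeros-toList : ∀ {l} (bs : Vec Bool l) → zeros (fromList (toList bs)) ≡ zeros bs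
zeros-toList []           = ≡.refl
zeros-toList (false ∷ bs) = ≡.cong suc (zeros-toList bs)
zeros-toList (true  ∷ bs) = zeros-toList bs

listOnes-reverse : ∀ as bs → listOnes (as ʳ++ bs) ≡ listOnes as ℕ.+ listOnes bs
listOnes-reverse []           bs = ≡.refl
listOnes-reverse (false ∷ as) bs = listOnes-reverse as (false ∷ bs)
listOnes-reverse (true  ∷ as) bs = ≡.trans (listOnes-reverse as (true ∷ bs)) (ℕ.+-suc (listOnes as) (listOnes bs))

-- The reduced word of a Grassmannian permutation.

module Codes {R : Ring 0ℓ 0ℓ} {n : ℕ} (H : HeckeFamily R n) where
  open Ring R hiding (zero)
  open HeckeFamily H
  open HeckeWords H
  open YoungSum H
  open import Relation.Binary.Reasoning.Setoid setoid

  -- The product that the word of `fromCode` spells: the i-th element climbs c i positions from s +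
  -- i.
  code : ∀ {k} → ℕ → (Fin k → ℕ) → Carrier
  code {zero}  s c = 1#
  code {suc k} s c = desc s (c zero) * code (suc s) (c ∘ suc)

  code-cong : ∀ {k} s {c c′ : Fin k → ℕ} → (∀ i → c i ≡ c′ i) → code s c ≡ code s c′
  code-cong {zero}  s h = ≡.refl
  code-cong {suc k} s h = ≡.cong₂ (λ z y → desc s z * y) (h zero) (code-cong (suc s) (h ∘ suc))

  -- `code` splits off the smallest part and `grass` the largest; this aligns the two recursions.
  code-last : ∀ {k} s (c : Fin (suc k) → ℕ) → code s c ≈ code s (c ∘ inject₁) * desc (k ℕ.+ s) (c (fromℕ k))
  code-last {zero}  s c = trans (*-identityʳ _) (sym (*-identityˡ _))
  code-last {suc k} s c = begin
    desc s (c zero) * code (suc s) (c ∘ suc)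
      ≈⟨ *-congˡ (code-last (suc s) (c ∘ suc)) ⟩
    desc s (c zero) * (code (suc s) (c ∘ suc ∘ inject₁) * desc (k ℕ.+ suc s) (c (fromℕ (suc k))))
      ≈⟨ *-assoc _ _ _ ⟨
    code s (c ∘ inject₁) * desc (k ℕ.+ suc s) (c (fromℕ (suc k)))
      ≡⟨ ≡.cong (λ s′ → code s (c ∘ inject₁) * desc s′ (c (fromℕ (suc k)))) (ℕ.+-suc k s) ⟩
    code s (c ∘ inject₁) * desc (suc k ℕ.+ s) (c (fromℕ (suc k)))
      ∎

  word-id : ∀ m → word (idₚ {m}) ≡ []
  word-id m with word (idₚ {m}) | length-word-id m
  ... | [] | _ = ≡.refl

  letters-fromCode : ∀ {m k} s (k≤m : k ≤ m) (c : Fin k → Fin (suc (m ∸ k))) →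
                     letters s (word (fromCode k≤m c)) ≈ code s (toℕ ∘ c)
  letters-fromCode {m} {zero}  s k≤m c = reflexive (≡.cong (letters s) (word-id m))
  letters-fromCode {suc m} {suc k} s (s≤s k≤m) c = begin
    letters s (word w)                                               ≈⟨ letters-word s w ⟩
    desc s (toℕ (inject≤ (c zero) _)) * letters (suc s) (word (remove zero w))
      ≡⟨ ≡.cong₂ (λ z ls → desc s z * letters (suc s) ls) (Fin.toℕ-inject≤ (c zero) _) (word-cong (remove-insert zero (w ⟨$⟩ʳ zero) w′)) ⟩
    desc s (toℕ (c zero)) * letters (suc s) (word w′)                ≈⟨ *-congˡ (letters-fromCode (suc s) k≤m (c ∘ suc)) ⟩
    code s (toℕ ∘ c)                                                 ∎
    where
    w  = fromCode (s≤s k≤m) c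
    w′ = fromCode k≤m (c ∘ suc)

  grass-zeroBits : ∀ d bs → grass (fromList (zeroBits d ++ bs)) ≡ grass (fromList bs)
  grass-zeroBits zero    bs = ≡.refl
  grass-zeroBits (suc d) bs = grass-zeroBits d bs

  bits-zeros : ∀ {k m c} {v : Rows k m} → Below c v → zeros (fromList (bits c v)) ≡ c
  bits-zeros {k} {c = c} {v} bel = ℕ.+-cancelʳ-≡ k _ _ (≡.trans
    (≡.cong (zeros (fromList (bits c v)) ℕ.+_) (≡.sym (bits-ones c v)))
    (≡.trans (zeros+ones (fromList (bits c v))) (bits-length bel)))

  opposite-fromℕ : ∀ k → opposite (fromℕ k) ≡ zero
  opposite-fromℕ k = Fin.toℕ-injective (≡.trans (Fin.opposite-prop (fromℕ k))
    (≡.trans (≡.cong (k ∸_) (Fin.toℕ-fromℕ k)) (ℕ.n∸n≡0 k)))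

  opposite-inject₁ : ∀ {k} (i : Fin k) → opposite (inject₁ i) ≡ suc (opposite i)
  opposite-inject₁ {suc k} zero    = ≡.refl
  opposite-inject₁ {suc k} (suc i) = ≡.cong inject₁ (opposite-inject₁ i)

  grass-bits : ∀ {k m c} {v : Rows k m} → Below c v → grass (fromList (bits c v)) ≈ code 0 (λ i → toℕ (lookup v (opposite i)))
  grass-bits {c = c} [] = reflexive (≡.trans (≡.cong (grass ∘ fromList) (≡.sym (++-identityʳ (zeroBits c)))) (grass-zeroBits c []))
  grass-bits {suc k} {c = c} {a ∷ v} (cons d e bel) = begin
    grass (fromList (bits c (a ∷ v)))
      ≡⟨ grass-zeroBits (c ∸ toℕ a) _ ⟩
    grass (fromList (bits (toℕ a) v)) * desc (listOnes (bits (toℕ a) v)) (zeros (fromList (bits (toℕ a) v)))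
      ≈⟨ *-cong (grass-bits bel) (reflexive (≡.cong₂ desc (≡.trans (bits-ones (toℕ a) v) (≡.sym (ℕ.+-identityʳ k))) (bits-zeros bel))) ⟩
    code 0 (λ i → toℕ (lookup v (opposite i))) * desc (k ℕ.+ 0) (toℕ a)
      ≡⟨ ≡.cong₂ (λ x y → x * desc (k ℕ.+ 0) y)
           (code-cong 0 λ i → ≡.cong (toℕ ∘ lookup (a ∷ v)) (≡.sym (opposite-inject₁ i)))
           (≡.cong (toℕ ∘ lookup (a ∷ v)) (≡.sym (opposite-fromℕ k))) ⟩
    code 0 (λ i → toℕ (lookup (a ∷ v) (opposite (inject₁ i)))) * desc (k ℕ.+ 0) (toℕ (lookup (a ∷ v) (opposite (fromℕ k))))
      ≈⟨ code-last 0 (λ i → toℕ (lookup (a ∷ v) (opposite i))) ⟨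
    code 0 (λ i → toℕ (lookup (a ∷ v) (opposite i)))
      ∎

  grass-toList : ∀ {l} (bs : Vec Bool l) → grass (fromList (toList bs)) ≡ grass bs
  grass-toList []           = ≡.refl
  grass-toList (false ∷ bs) = grass-toList bs
  grass-toList (true  ∷ bs) = ≡.cong₂ _*_ (grass-toList bs) (≡.cong₂ desc (ones-toList bs) (zeros-toList bs))

  element-toList : ∀ c {l} (bs : Vec Bool l) {as} → toList bs ≡ as → element c bs ≡ element c (fromList as)
  element-toList c bs ≡.refl = ≡.cong₂ (λ w s → w * (c * s)) (≡.sym (grass-toList bs))
    (≡.cong₂ (λ l k → symmetrizer l k 0) (≡.sym (length-toList bs)) (≡.sym (ones-toList bs)))

module SublistSums (R : Ring 0ℓ 0ℓ) where
  open Ring R hiding (zero)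
  open BigOperators R
  open Sums R
  open Esym R
  open import Relation.Binary.Reasoning.Setoid setoid
  open Algebra.Properties.CommutativeSemigroup (CommutativeMonoid.commutativeSemigroup +-commutativeMonoid) using (interchange)

  sublistSum : ∀ {A : Set} → ℕ → List A → (List A → Carrier) → Carrier
  sublistSum r xs f = sum (map f (sublists r xs))

  sublistSum-∷ : ∀ {A : Set} r x (xs : List A) f → sublistSum (suc r) (x ∷ xs) f ≈ sublistSum r xs (f ∘ (x ∷_)) + sublistSum (suc r) xs f
  sublistSum-∷ r x xs f = begin
    sum (map f (map (x ∷_) (sublists r xs) ++ sublists (suc r) xs))
      ≡⟨ ≡.cong sum (map-++ f (map (x ∷_) (sublists r xs)) _) ⟩
    sum (map f (map (x ∷_) (sublists r xs)) ++ map f (sublists (suc r) xs))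
      ≈⟨ sum-++ (map f (map (x ∷_) (sublists r xs))) _ ⟩
    sum (map f (map (x ∷_) (sublists r xs))) + sublistSum (suc r) xs f
      ≡⟨ ≡.cong (λ ys → sum ys + sublistSum (suc r) xs f) (≡.sym (map-∘ (sublists r xs))) ⟩
    sublistSum r xs (f ∘ (x ∷_)) + sublistSum (suc r) xs f
      ∎

  -- The split is at the last entry because the operator of the largest row is the innermost one.
  sublistSum-∷ʳ : ∀ {A : Set} r xs (y : A) f → sublistSum (suc r) (xs ∷ʳ y) f ≈ sublistSum (suc r) xs f + sublistSum r xs (f ∘ (_∷ʳ y))
  sublistSum-∷ʳ zero    []       y f = sym (+-identityˡ _)
  sublistSum-∷ʳ (suc r) []       y f = sym (+-identityˡ _)
  sublistSum-∷ʳ zero    (x ∷ xs) y f = begin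
    sublistSum 1 (x ∷ xs ∷ʳ y) f
      ≈⟨ sublistSum-∷ zero x (xs ∷ʳ y) f ⟩
    sublistSum 0 xs (f ∘ (x ∷_)) + sublistSum 1 (xs ∷ʳ y) f
      ≈⟨ +-congˡ (sublistSum-∷ʳ zero xs y f) ⟩
    sublistSum 0 xs (f ∘ (x ∷_)) + (sublistSum 1 xs f + sublistSum 0 xs (f ∘ (_∷ʳ y)))
      ≈⟨ +-assoc _ _ _ ⟨
    (sublistSum 0 xs (f ∘ (x ∷_)) + sublistSum 1 xs f) + sublistSum 0 xs (f ∘ (_∷ʳ y))
      ≈⟨ +-congʳ (sublistSum-∷ zero x xs f) ⟨
    sublistSum 1 (x ∷ xs) f + sublistSum 0 (x ∷ xs) (f ∘ (_∷ʳ y))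
      ∎
  sublistSum-∷ʳ (suc r) (x ∷ xs) y f = begin
    sublistSum (suc (suc r)) (x ∷ xs ∷ʳ y) f
      ≈⟨ sublistSum-∷ (suc r) x (xs ∷ʳ y) f ⟩
    sublistSum (suc r) (xs ∷ʳ y) (f ∘ (x ∷_)) + sublistSum (suc (suc r)) (xs ∷ʳ y) f
      ≈⟨ +-cong (sublistSum-∷ʳ r xs y (f ∘ (x ∷_))) (sublistSum-∷ʳ (suc r) xs y f) ⟩
    (sublistSum (suc r) xs (f ∘ (x ∷_)) + sublistSum r xs (f ∘ (x ∷_) ∘ (_∷ʳ y))) +
    (sublistSum (suc (suc r)) xs f + sublistSum (suc r) xs (f ∘ (_∷ʳ y)))
      ≈⟨ interchange _ _ _ _ ⟩
    (sublistSum (suc r) xs (f ∘ (x ∷_)) + sublistSum (suc (suc r)) xs f) +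
    (sublistSum r xs (f ∘ (x ∷_) ∘ (_∷ʳ y)) + sublistSum (suc r) xs (f ∘ (_∷ʳ y)))
      ≈⟨ +-cong (sublistSum-∷ (suc r) x xs f) (sublistSum-∷ r x xs (f ∘ (_∷ʳ y))) ⟨
    sublistSum (suc (suc r)) (x ∷ xs) f + sublistSum (suc r) (x ∷ xs) (f ∘ (_∷ʳ y))
      ∎

  sublistSum-product : ∀ r xs → sublistSum r xs product ≈ esym r xs
  sublistSum-product zero    xs       = +-identityʳ 1#
  sublistSum-product (suc r) []       = refl
  sublistSum-product (suc r) (x ∷ xs) = trans (sublistSum-∷ r x xs product)
    (+-cong (trans (sum-*ˡ x product (sublists r xs)) (*-congˡ (sublistSum-product r xs))) (sublistSum-product (suc r) xs))

-- The right-hand side of the theorem as a pass.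

module Assembly (n k : ℕ) (k≤n : k ≤ n) where
  open Grassmannian n k k≤n
  open Skew using (isRibbon?; headInRow?)
  open Scalars
  open Ring Ĥ using (-_; refl; sym; trans; reflexive; setoid; +-cong; +-congˡ; +-congʳ; *-cong; *-congˡ; *-congʳ; *-assoc; +-identityʳ; *-identityˡ; distribˡ; zeroʳ; semiring; -‿cong)
  open import Relation.Binary.Reasoning.Setoid setoid
  open Algebra.Properties.Semiring.Exp semiring using (_^_)
  open Sums Ĥ
  open SublistSums Ĥ
  open Esym Ĥ

  private
    module A = CommutativeRing A
    module Hecke′ = HeckeAlgebra Aloc (scalar p) (scalar q) (scalar ħ) n
    module Exp-A = Algebra.Properties.Semiring.Exp A.semiring

  open Hecke′ using (heckeFamily; affineHeckeFamily; t; t-toℕ; x′)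
  open HeckeWords heckeFamily
  open YoungSum heckeFamily
  open Codes heckeFamily
  open Presented Aloc (HeckeGenerator n) (Hecke.Relation Aloc (scalar p) (scalar q) (scalar ħ) n) using (con-cong; con-*; con-central)
  open Climb affineHeckeFamily [k]![n-k]!⁻¹ (con-central (gen tt))
  open AffineHeckeFamily affineHeckeFamily using (δ)
  open PresentedScalars Aloc (HeckeGenerator n) (Hecke.Relation Aloc (scalar p) (scalar q) (scalar ħ) n) using (con--)
  open Commutation Ĥ using (pass)

  m : ℕ
  m = n ∸ k

  T̄ₚ-letters : ∀ w → T̄ₚ w ≈ letters 0 (word w)
  T̄ₚ-letters w = product-cong (λ i → reflexive (≡.trans (≡.sym (t-toℕ i)) (≡.cong t (≡.sym (ℕ.+-identityʳ (toℕ i)))))) (word w)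

  Σⁿₖ-symmetrizer : Σⁿₖ ≈ [k]![n-k]!⁻¹ * symmetrizer n k 0
  Σⁿₖ-symmetrizer = *-congˡ (trans (sum-cong (λ v → *-congˡ (T̄ₚ-letters v)) (youngSubgroup n k)) (youngSum n k 0 k≤n))

  T̄ₛ-element : ∀ {l} (bs : Vec Bool l) ν → toList bs ≡ bits m (proj₁ ν) → T̄ₛ ν ≈ element [k]![n-k]!⁻¹ bs
  T̄ₛ-element bs ν eq = begin
    T̄ₚ (fromCode k≤n (part ν ∘ opposite)) * Σⁿₖ
      ≈⟨ *-cong (trans (T̄ₚ-letters _) (letters-fromCode 0 k≤n (part ν ∘ opposite))) Σⁿₖ-symmetrizer ⟩
    code 0 (toℕ ∘ part ν ∘ opposite) * ([k]![n-k]!⁻¹ * symmetrizer n k 0)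
      ≈⟨ *-congʳ (grass-bits (partition-below ν)) ⟨
    grass (fromList (bits m (proj₁ ν))) * ([k]![n-k]!⁻¹ * symmetrizer n k 0)
      ≡⟨ ≡.cong₂ (λ l o → grass (fromList (bits m (proj₁ ν))) * ([k]![n-k]!⁻¹ * symmetrizer l o 0))
           (≡.trans (≡.sym (ℕ.m∸n+n≡m k≤n)) (≡.sym (bits-length (partition-below ν)))) (≡.sym (bits-ones m (proj₁ ν))) ⟩
    element [k]![n-k]!⁻¹ (fromList (bits m (proj₁ ν)))
      ≡⟨ element-toList _ bs eq ⟨
    element [k]![n-k]!⁻¹ bs
      ∎

  ext : (Shape → Carrier) → Combination → Carrier
  ext φ c = sum (map (λ (g , ν) → embed g * φ ν) c)

  -- The transpose of D_i: it changes the function by which combinations are evaluated instead of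
  -- the combination. The induction can then run over single shapes.
  adjoint : Fin k → (Shape → Carrier) → Shape → Carrier
  adjoint i φ ν = ext φ (D₀ i ν)

  ext-++ : ∀ φ c c′ → ext φ (c ++ c′) ≈ ext φ c + ext φ c′
  ext-++ φ c c′ = trans (reflexive (≡.cong sum (map-++ _ c c′))) (sum-++ (map _ c) _)

  ext-· : ∀ φ g c → ext φ (g · c) ≈ embed g * ext φ c
  ext-· φ g []            = sym (zeroʳ _)
  ext-· φ g ((f , ν) ∷ c) = trans (+-cong (*-assoc _ _ _) (ext-· φ g c)) (sym (distribˡ _ _ _))

  ext-D : ∀ φ i c → ext φ (D i c) ≈ ext (adjoint i φ) c
  ext-D φ i []            = refl
  ext-D φ i ((g , ν) ∷ c) = trans (ext-++ φ (g · D₀ i ν) (D i c)) (+-cong (ext-· φ g (D₀ i ν)) (ext-D φ i c))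

  -- Transposing reverses the order, hence `foldl` against the `foldr` of the statement: the
  -- outermost operator is transposed first.
  evaluate : List (Fin k) → Shape → Carrier
  evaluate = foldl (λ φ i → adjoint i φ) T̄ₛ

  ext-foldr : ∀ φ is c → ext φ (foldr D c is) ≈ ext (foldl (λ φ i → adjoint i φ) φ is) c
  ext-foldr φ []       c = refl
  ext-foldr φ (i ∷ is) c = trans (ext-D φ i (foldr D c is)) (ext-foldr (adjoint i φ) is c)

  evaluate-basis : ∀ is ν → ⟦ foldr D (basis ν) is ⟧ ≈ evaluate is ν
  evaluate-basis is ν = trans (ext-foldr T̄ₛ is (basis ν)) (trans (+-identityʳ _) (*-identityˡ _))

  partialSum : ℕ → ℕ → Shape → Carrier
  partialSum r i ν = sublistSum r (take i (allFin k)) (λ is → evaluate is ν)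

  sum-ext : ∀ (xs : List (List (Fin k))) c → sum (map (λ is → ext (evaluate is) c) xs) ≈ ext (λ ν → sum (map (λ is → evaluate is ν) xs)) c
  sum-ext xs []            = none xs
    where
    none : ∀ (xs : List (List (Fin k))) → sum (map (λ _ → 0#) xs) ≈ 0#
    none []       = refl
    none (_ ∷ xs) = trans (+-congˡ (none xs)) (+-identityʳ _)
  sum-ext xs ((g , ν) ∷ c) = trans (sum-+ _ _ xs) (+-cong (sum-*ˡ (embed g) (λ is → evaluate is ν) xs) (sum-ext xs c))

  partialSum-suc : ∀ r (o : Fin k) ν → partialSum (suc r) (suc (toℕ o)) ν ≈
                   partialSum (suc r) (toℕ o) ν + ext (partialSum r (toℕ o)) (D₀ o ν)
  partialSum-suc r o ν = begin
    sublistSum (suc r) (take (suc (toℕ o)) (allFin k)) (λ is → evaluate is ν)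
      ≡⟨ ≡.cong (λ xs → sublistSum (suc r) xs (λ is → evaluate is ν)) (take-suc-tabulate id o) ⟩
    sublistSum (suc r) (take (toℕ o) (allFin k) ∷ʳ o) (λ is → evaluate is ν)
      ≈⟨ sublistSum-∷ʳ r (take (toℕ o) (allFin k)) o _ ⟩
    partialSum (suc r) (toℕ o) ν + sublistSum r (take (toℕ o) (allFin k)) (λ is → evaluate (is ∷ʳ o) ν)
      ≈⟨ +-congˡ (sum-cong (λ is → reflexive (≡.cong (λ φ → φ ν) (foldl-∷ʳ (λ φ i → adjoint i φ) T̄ₛ o is))) (sublists r (take (toℕ o) (allFin k)))) ⟩
    partialSum (suc r) (toℕ o) ν + sublistSum r (take (toℕ o) (allFin k)) (λ is → ext (evaluate is) (D₀ o ν))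
      ≈⟨ +-congˡ (sum-ext (sublists r (take (toℕ o) (allFin k))) (D₀ o ν)) ⟩
    partialSum (suc r) (toℕ o) ν + ext (partialSum r (toℕ o)) (D₀ o ν)
      ∎

  x′-h : ∀ i ν → x′ (toℕ (part ν i) ℕ.+ toℕ (opposite i)) ≡ x (h i ν)
  x′-h i ν = ≡.trans (≡.cong x′ (≡.sym (Fin.toℕ-fromℕ< _))) (extend-toℕ x 0# (h i ν))

  private
    Inverse : Rel (Expr A.Carrier ⊤) 0ℓ
    Inverse = Commutative (Invert (⟨ k ⟩! A.* ⟨ n ∸ k ⟩!) A.1#)
      where open QuantumIntegers A p q using (⟨_⟩!)
    module Loc = Presented A ⊤ Inverse

  σ : A.Carrier → Carrier
  σ a = con (scalar a)

  σ-* : ∀ a b → σ (a A.* b) ≈ σ a * σ b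
  σ-* a b = trans (con-cong (Loc.con-* a b)) (con-* _ _)

  σ-^ : ∀ a e → σ (a Exp-A.^ e) ≈ σ a ^ e
  σ-^ a zero    = refl
  σ-^ a (suc e) = trans (σ-* a (a Exp-A.^ e)) (*-congˡ (σ-^ a e))

  σ-- : ∀ a b → σ (a A.- b) ≈ σ a - σ b
  σ-- a b = trans (con-cong (PresentedScalars.con-- A ⊤ Inverse a b)) (con-- _ _)

  embed-coefficient : ∀ i ν κ → embed (ribbonCoefficient i ν κ) ≈
    δ (toℕ (part ν i) ℕ.+ toℕ (opposite i)) * (p̂ ^ (Skew.ht ν κ ∸ 1) * q̂ ^ (Skew.wd ν κ ∸ 1))
  embed-coefficient i ν κ = *-cong
    (+-congˡ (-‿cong (*-cong (σ-- p q) (reflexive (≡.sym (x′-h i ν))))))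
    (trans (σ-* _ _) (*-cong (σ-^ p (Skew.ht ν κ ∸ 1)) (σ-^ q (Skew.wd ν κ ∸ 1))))

  flips-list : ∀ {l} (f : Vec Bool l → Carrier) bs →
               sum (map (λ (u , v , as) → p̂ ^ u * q̂ ^ v * f as) (flipList bs)) ≈ flips f bs
  flips-list f []           = refl
  flips-list f (false ∷ bs) = +-cong (trans (*-congʳ (*-identityˡ 1#)) (*-identityˡ _)) (begin
    sum (map (λ (u , v , as) → p̂ ^ u * q̂ ^ v * f as) (map _ (flipList bs)))
      ≡⟨ ≡.cong sum (≡.sym (map-∘ (flipList bs))) ⟩
    sum (map (λ (u , v , as) → p̂ ^ u * (q̂ * q̂ ^ v) * f (false ∷ as)) (flipList bs))
      ≈⟨ sum-cong (λ (u , v , as) → trans (*-congʳ (sym (pass (con-central (scalar q) _) _))) (*-assoc _ _ _)) (flipList bs) ⟩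
    sum (map (λ (u , v , as) → q̂ * (p̂ ^ u * q̂ ^ v * f (false ∷ as))) (flipList bs))
      ≈⟨ sum-*ˡ q̂ _ (flipList bs) ⟩
    q̂ * sum (map (λ (u , v , as) → p̂ ^ u * q̂ ^ v * f (false ∷ as)) (flipList bs))
      ≈⟨ *-congˡ (flips-list (f ∘ (false ∷_)) bs) ⟩
    q̂ * flips (f ∘ (false ∷_)) bs
      ∎)
  flips-list f (true ∷ bs) = begin
    sum (map (λ (u , v , as) → p̂ ^ u * q̂ ^ v * f as) (map _ (flipList bs)))
      ≡⟨ ≡.cong sum (≡.sym (map-∘ (flipList bs))) ⟩
    sum (map (λ (u , v , as) → p̂ * p̂ ^ u * q̂ ^ v * f (true ∷ as)) (flipList bs))
      ≈⟨ sum-cong (λ (u , v , as) → trans (*-congʳ (*-assoc _ _ _)) (*-assoc _ _ _)) (flipList bs) ⟩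
    sum (map (λ (u , v , as) → p̂ * (p̂ ^ u * q̂ ^ v * f (true ∷ as))) (flipList bs))
      ≈⟨ sum-*ˡ p̂ _ (flipList bs) ⟩
    p̂ * sum (map (λ (u , v , as) → p̂ ^ u * q̂ ^ v * f (true ∷ as)) (flipList bs))
      ≈⟨ *-congˡ (flips-list (f ∘ (true ∷_)) bs) ⟩
    p̂ * flips (f ∘ (true ∷_)) bs
      ∎

  partition-≡ : ∀ {ν κ : Shape} → proj₁ ν ≡ proj₁ κ → ν ≡ κ
  partition-≡ {v , a} {.v , b} ≡.refl = ≡.cong (v ,_) (Linked.irrelevant ℕ.≤-irrelevant a b)

  -- A ribbon is matched with the flip that its bits exhibit. Height and width determine the
  -- exponents, and the bits determine the shape, so the matching is one-to-one.
  ribbon-sum : ∀ o ν {l} (bs : Vec Bool l) (φ : Shape → Carrier) (f : Vec Bool l → Carrier) →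
    lower (proj₁ ν) o ≡ toList bs →
    (∀ κ as → bits m (proj₁ κ) ≡ upper m (proj₁ ν) o ++ false ∷ toList as → φ κ ≈ f as) →
    sum (map (λ κ → p̂ ^ (Skew.ht ν κ ∸ 1) * q̂ ^ (Skew.wd ν κ ∸ 1) * φ κ) (ribbonsBelow o ν)) ≈ flips f bs
  ribbon-sum o ν {l} bs φ f low h = trans
    (Matching.sum-match _~_ (λ {κ} → injectiveˡ {κ}) injectiveʳ Ĥ (Unique.filter⁺ (λ κ → isRibbon? ν κ ×-dec headInRow? ν κ o) (partitions-unique k m)) (flipList-unique bs) to from value)
    (flips-list f bs)
    where
    _~_ : Shape → ℕ × ℕ × Vec Bool l → Set
    κ ~ (u , v , as) = Ribbon o u v (proj₁ ν) (proj₁ κ) × bits m (proj₁ κ) ≡ upper m (proj₁ ν) o ++ false ∷ toList as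

    injectiveˡ : ∀ {κ y y′} → κ ~ y → κ ~ y′ → y ≡ y′
    injectiveˡ {κ} {u , v , as} {u′ , v′ , as′} (ρ , e) (ρ′ , e′)
      with ℕ.suc-injective (≡.trans (≡.sym (ribbon-ht ν κ ρ)) (ribbon-ht ν κ ρ′))
         | ℕ.suc-injective (≡.trans (≡.sym (ribbon-wd ν κ ρ)) (ribbon-wd ν κ ρ′))
         | ≡.trans (≡.sym (cast-is-id ≡.refl as)) (toList-injective ≡.refl as as′ (proj₂ (∷-injective (++-cancelˡ (upper m (proj₁ ν) o) _ _ (≡.trans (≡.sym e) e′)))))
    ... | ≡.refl | ≡.refl | ≡.refl = ≡.refl

    injectiveʳ : ∀ {κ κ′ y} → κ ~ y → κ′ ~ y → κ ≡ κ′
    injectiveʳ {κ} {κ′} (_ , e) (_ , e′) =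
      partition-≡ (bits-injective (partition-below κ) (partition-below κ′) (≡.trans e (≡.sym e′)))

    to : ∀ {κ} → κ ∈ ribbonsBelow o ν → ∃[ y ] y ∈ flipList bs × κ ~ y
    to {κ} κ∈ with ∈-filter⁻ (λ κ → isRibbon? ν κ ×-dec headInRow? ν κ o) {xs = partitions k m} κ∈
    ... | _ , ribbon , inRow with local⇒ribbon (partition-below ν) (partition-below κ) (isRibbon⇒local ν κ ribbon inRow)
    ... | u , v , ρ with ribbon⇒flip ρ (partition-below ν)
    ... | as , flip , e with ∈-flipList⁺ {bs = bs} (≡.subst (λ bs → Flip u v bs as) low flip)
    ... | as′ , ≡.refl , y∈ = _ , y∈ , ρ , e

    from : ∀ {y} → y ∈ flipList bs → ∃[ κ ] κ ∈ ribbonsBelow o ν × κ ~ y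
    from {u , v , as} y∈ with ≡.subst (λ bs → Flip u v bs (toList as)) (≡.sym low) (∈-flipList⁻ y∈)
    ... | flip with flip⇒ribbon o (partition-below ν) flip
    ... | κ , ρ , bel with ribbon⇒flip ρ (partition-below ν)
    ... | as′ , flip′ , e with flip-functional flip flip′
    ... | ≡.refl = (κ , below⇒linked bel) ,
      ∈-filter⁺ (λ κ → isRibbon? ν κ ×-dec headInRow? ν κ o) (partitions-complete (κ , below⇒linked bel))
        (local⇒isRibbon ν (κ , below⇒linked bel) (ribbon⇒local ρ) , local⇒head ν (κ , below⇒linked bel) (ribbon⇒local ρ)) ,
      ρ , e

    value : ∀ {κ y} → κ ~ y → p̂ ^ (Skew.ht ν κ ∸ 1) * q̂ ^ (Skew.wd ν κ ∸ 1) * φ κ ≈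
            (let u , v , as = y in p̂ ^ u * q̂ ^ v * f as)
    value {κ} {u , v , as} (ρ , e) = *-cong
      (reflexive (≡.cong₂ (λ u v → p̂ ^ (u ∸ 1) * q̂ ^ (v ∸ 1)) (ribbon-ht ν κ ρ) (ribbon-wd ν κ ρ)))
      (h κ as e)

  partialSum-climb : ∀ R r {l} (bs : Vec Bool l) ν → R ʳ++ toList bs ≡ bits m (proj₁ ν) →
                     partialSum r (listOnes R) ν ≈ climb R r bs
  partialSum-climb []          zero    bs ν eq = trans (+-identityʳ _) (T̄ₛ-element bs ν eq)
  partialSum-climb []          (suc r) bs ν eq = refl
  partialSum-climb (false ∷ R) r       bs ν eq = partialSum-climb R r (false ∷ bs) ν eq
  partialSum-climb (true  ∷ R) zero    bs ν eq = partialSum-climb R zero (true ∷ bs) ν eq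
  partialSum-climb (true  ∷ R) (suc r) {l} bs ν eq = begin
    partialSum (suc r) (suc (listOnes R)) ν
      ≡⟨ ≡.cong (λ i → partialSum (suc r) (suc i) ν) (≡.sym o≡) ⟩
    partialSum (suc r) (suc (toℕ o)) ν
      ≈⟨ partialSum-suc r o ν ⟩
    partialSum (suc r) (toℕ o) ν + (x (h o ν) * partialSum r (toℕ o) ν + ext (partialSum r (toℕ o)) (map (λ κ → ribbonCoefficient o ν κ , κ) (ribbonsBelow o ν)))
      ≡⟨ ≡.cong (λ i → partialSum (suc r) i ν + (x (h o ν) * partialSum r i ν + ext (partialSum r i) (map (λ κ → ribbonCoefficient o ν κ , κ) (ribbonsBelow o ν)))) o≡ ⟩
    partialSum (suc r) i ν + (x (h o ν) * partialSum r i ν + ext (partialSum r i) (map (λ κ → ribbonCoefficient o ν κ , κ) (ribbonsBelow o ν)))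
      ≈⟨ +-cong (partialSum-climb R (suc r) (true ∷ bs) ν eq)
           (+-cong (*-cong (reflexive x≡) (partialSum-climb R r (true ∷ bs) ν eq)) ribbons) ⟩
    climb R (suc r) (true ∷ bs) + (x′ l * climb R r (true ∷ bs) + δ l * flips (λ as → climb R r (false ∷ as)) bs)
      ∎
    where
    i = listOnes R
    i<k : i < k
    i<k = ≡.subst (i <_) (≡.trans (≡.sym (listOnes-reverse R (true ∷ toList bs))) (≡.trans (≡.cong listOnes eq) (bits-ones m (proj₁ ν))))
      (ℕ.m<m+n i (s≤s z≤n))
    o : Fin k
    o = fromℕ< i<k
    o≡ : toℕ o ≡ i
    o≡ = Fin.toℕ-fromℕ< i<k
    split : reverse R ≡ upper m (proj₁ ν) o × toList bs ≡ lower (proj₁ ν) o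
    split = split-unique (reverse R) _
      (≡.trans (≡.sym (ʳ++-defn R)) (≡.trans eq (bits-split m (proj₁ ν) o)))
      (≡.trans (≡.trans (listOnes-reverse R []) (ℕ.+-identityʳ i)) (≡.trans (≡.sym o≡) (≡.sym (upper-ones m (proj₁ ν) o))))
    height≡ : toℕ (part ν o) ℕ.+ toℕ (opposite o) ≡ l
    height≡ = ≡.trans (≡.sym (lower-length o (partition-below ν))) (≡.trans (≡.cong length (≡.sym (proj₂ split))) (length-toList bs))
    x≡ : x (h o ν) ≡ x′ l
    x≡ = ≡.trans (≡.sym (x′-h o ν)) (≡.cong x′ height≡)
    ribbons : ext (partialSum r i) (map (λ κ → ribbonCoefficient o ν κ , κ) (ribbonsBelow o ν)) ≈
              δ l * flips (λ as → climb R r (false ∷ as)) bs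
    ribbons = begin
      ext (partialSum r i) (map (λ κ → ribbonCoefficient o ν κ , κ) (ribbonsBelow o ν))
        ≡⟨ ≡.cong sum (≡.sym (map-∘ (ribbonsBelow o ν))) ⟩
      sum (map (λ κ → embed (ribbonCoefficient o ν κ) * partialSum r i κ) (ribbonsBelow o ν))
        ≈⟨ sum-cong (λ κ → trans (*-congʳ (trans (embed-coefficient o ν κ) (*-congʳ (reflexive (≡.cong δ height≡))))) (*-assoc _ _ _)) (ribbonsBelow o ν) ⟩
      sum (map (λ κ → δ l * (p̂ ^ (Skew.ht ν κ ∸ 1) * q̂ ^ (Skew.wd ν κ ∸ 1) * partialSum r i κ)) (ribbonsBelow o ν))
        ≈⟨ sum-*ˡ (δ l) _ (ribbonsBelow o ν) ⟩
      δ l * sum (map (λ κ → p̂ ^ (Skew.ht ν κ ∸ 1) * q̂ ^ (Skew.wd ν κ ∸ 1) * partialSum r i κ) (ribbonsBelow o ν))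
        ≈⟨ *-congˡ (ribbon-sum o ν bs (partialSum r i) (λ as → climb R r (false ∷ as)) (≡.sym (proj₂ split))
             λ κ as e → partialSum-climb R r (false ∷ as) κ
               (≡.trans (ʳ++-defn R) (≡.trans (≡.cong (_++ false ∷ toList as) (proj₁ split)) (≡.sym e)))) ⟩
      δ l * flips (λ as → climb R r (false ∷ as)) bs
        ∎

  xs-tabulate : ∀ j s (f : Fin j → Carrier) → (∀ i → f i ≡ x′ (toℕ i ℕ.+ s)) → tabulate f ≡ xs s j
  xs-tabulate zero    s f h = ≡.refl
  xs-tabulate (suc j) s f h = ≡.cong₂ _∷_ (h zero)
    (xs-tabulate j (suc s) (f ∘ suc) λ i → ≡.trans (h (suc i)) (≡.cong x′ (≡.sym (ℕ.+-suc (toℕ i) s))))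

  e-esym : ∀ r → e r ≈ esym r (xs 0 k)
  e-esym r = trans (sublistSum-product r _) (reflexive (≡.cong (esym r) (≡.trans (map-tabulate id _)
    (xs-tabulate k 0 _ λ i → ≡.trans (≡.sym (extend-toℕ x 0# (inject≤ i k≤n)))
      (≡.cong x′ (≡.trans (Fin.toℕ-inject≤ i k≤n) (≡.sym (ℕ.+-identityʳ (toℕ i)))))))))

  pieri : ∀ μ r → T̄ₛ μ * e r ≈ sum (map (λ is → ⟦ foldr D (basis μ) is ⟧) (sublists r (allFin k)))
  pieri μ r = begin
    T̄ₛ μ * e r                                         ≈⟨ *-cong zeroth (e-esym r) ⟩
    climb R zero [] * esym r (xs 0 k)                  ≡⟨ ≡.cong (λ i → climb R zero [] * esym r (xs 0 i)) (≡.sym ones≡) ⟩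
    climb R zero [] * esym r (xs 0 (listOnes R))       ≈⟨ climb-esym R r length≤ ⟨
    climb R r []                                       ≈⟨ partialSum-climb R r [] μ R≡ ⟨
    partialSum r (listOnes R) μ                        ≡⟨ ≡.cong (λ is → sublistSum r is (λ is → evaluate is μ)) rows ⟩
    sublistSum r (allFin k) (λ is → evaluate is μ)     ≈⟨ sum-cong (λ is → evaluate-basis is μ) (sublists r (allFin k)) ⟨
    sublistSum r (allFin k) (λ is → ⟦ foldr D (basis μ) is ⟧) ∎
    where
    bs = bits m (proj₁ μ)
    R = reverse bs
    R≡ : R ʳ++ [] ≡ bs
    R≡ = reverse-involutive bs
    ones≡ : listOnes R ≡ k
    ones≡ = ≡.trans (listOnes-reverse bs []) (≡.trans (ℕ.+-identityʳ _) (bits-ones m (proj₁ μ)))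
    length≤ : length R ≤ n
    length≤ = ℕ.≤-reflexive (≡.trans (length-reverse bs) (≡.trans (bits-length (partition-below μ)) (ℕ.m∸n+n≡m k≤n)))
    rows : take (listOnes R) (allFin k) ≡ allFin k
    rows = take-all (listOnes R) (allFin k) (ℕ.≤-reflexive (≡.trans (length-tabulate {n = k} id) (≡.sym ones≡)))
    -- With no element to choose, the pass only rebuilds the word of μ.
    zeroth : T̄ₛ μ ≈ climb R zero []
    zeroth = trans (sym (+-identityʳ _)) (partialSum-climb R zero [] μ R≡)

theorem5p2 : ∀ (n k : ℕ) (k≤n : k ≤ n) (μ : Partition k (n ∸ k)) (r : ℕ) → r ≤ k →
    let open Grassmannian n k k≤n in
    T̄ₛ μ * e r ≈ sum (map (λ is → ⟦ foldr D (basis μ) is ⟧) (sublists r (allFin k)))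
theorem5p2 n k k≤n μ r _ = Assembly.pieri n k k≤n μ r
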